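{- Let $E=[n]=\{1,\dots,n\}$ and let $f:\mathbb{Z}^E\to\mathbb{Z}\cup\{+\infty\}$ be a valuated generalized matroid, identified with a function on $2^E$ via $f(X)=f(\chi_X)$. Let its compression be $$\hat f(x)=\min\Big\{\sum_{\alpha\in[n]}f(Y_\alpha)\ \Big|\ x=\sum_{\alpha\in[n]}\chi_{Y_\alpha},\ Y_\alpha\subseteq E,\ |Y_\alpha|=\alpha\ (\alpha\in[n])\Big\}\quad(x\in\mathbb{Z}^E),$$ with $\hat f(x)=+\infty$ if no such decomposition exists. Then the convex hull of the effective domain $\mathrm{dom}(\hat f)$ is the permutohedron. Hence $\hat f$ is a valuated permutohedron, and for every $w\in(\mathbb{R}^E)^*$ the convex hull of the linearity domain $\mathrm{Arg}\min\{\hat f(x)-\langle w,x\rangle\mid x\in\mathbb{Z}^E\}$ is a sub-permutohedron.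
   Context: $\chi_X\in\{0,1\}^E$ is the characteristic vector of $X\subseteq E$, $x(X)=\sum_{e\in X}x(e)$, and $\langle w,x\rangle=\sum_e w(e)x(e)$. A generalized polymatroid is a polyhedron $\{x\mid g(X)\le x(X)\le f(X)\ \forall X\subseteq E\}$ with $f$ submodular, $g$ supermodular, $f(\emptyset)=g(\emptyset)=0$ and $f(X)-g(Y)\ge f(X\setminus Y)-g(Y\setminus X)$ for all $X,Y$. A function $f:\mathbb{Z}^E\to\mathbb{R}\cup\{+\infty\}$ is M${}^\natural$-convex if it is the restriction to $\mathbb{Z}^E$ of a polyhedral convex function whose effective domain and all linearity domains $\mathrm{Arg}\min(F-\langle z,\cdot\rangle)$ are integral generalized polymatroids; it is M-convex if moreover its effective domain is a base polyhedron (a generalized polymatroid lying in a hyperplane $x(E)=$ const, equivalently $\{x\mid x(X)\le h(X)\ \forall X,\ x(E)=h(E)\}$ for a submodular $h$). A valuated generalized matroid is an M${}^\natural$-convex function $f:\mathbb{Z}^E\to\mathbb{Z}\cup\{+\infty\}$ with $\mathrm{dom}(f)=\{0,1\}^E$. A permutation $\pi$ of $[n]$ is identified with the vector $(\pi(1),\dots,\pi(n))\in\mathbb{Z}^n$; the permutohedron is the convex hull of all $n!$ such permutation vectors. A sub-permutohedron is a polyhedron that is the convex hull of a set of permutation vectors and is a base polyhedron. A valuated permutohedron is an M-convex function $f:\mathbb{Z}^E\to\mathbb{R}\cup\{+\infty\}$ such that the convex hull of $\mathrm{dom}(f)$ is the permutohedron.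
   Formalization: The weight vectors w, and the vectors z defining linearity domains, range over rational instead of real vectors, and all polyhedra, convex hulls and polyhedral convex functions are taken over the rationals. -}

module Defs where

open import Data.Nat as ℕ using (ℕ; zero; suc)
open import Data.Integer as ℤ using (ℤ; +_)
open import Data.Rational as ℚ using (ℚ; 0ℚ; 1ℚ; _≤_; _/_)
open import Data.Fin using (Fin; toℕ)
import Data.Fin as Fin
open import Data.Fin.Subset using (Subset; _∪_; _∩_; _─_; ∣_∣; inside; outside)
import Data.Fin.Subset as Sub
open import Data.Fin.Permutation using (Permutation; _⟨$⟩ʳ_)
open import Data.Vec using (lookup)
open import Data.Bool using (true; false; if_then_else_)
open import Data.List using (List)
open import Data.List.NonEmpty using (List⁺; foldr₁; map)
open import Data.List.Relation.Unary.All using (All)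
open import Data.Product using (Σ; ∃; _×_; _,_; proj₁; proj₂)
open import Data.Sum using (_⊎_)
open import Relation.Binary.PropositionalEquality using (_≡_)
open import Relation.Unary using (Pred)
open import Level using (0ℓ)

Vecℤ : ℕ → Set
Vecℤ n = Fin n → ℤ

Vecℚ : ℕ → Set
Vecℚ n = Fin n → ℚ

∑ℤ : ∀ {n} → (Fin n → ℤ) → ℤ
∑ℤ {zero}  f = + 0
∑ℤ {suc n} f = f Fin.zero ℤ.+ ∑ℤ (λ i → f (Fin.suc i))

∑ℚ : ∀ {n} → (Fin n → ℚ) → ℚ
∑ℚ {zero}  f = 0ℚ
∑ℚ {suc n} f = f Fin.zero ℚ.+ ∑ℚ (λ i → f (Fin.suc i))

ι : ℤ → ℚ
ι k = k / 1

ιv : ∀ {n} → Vecℤ n → Vecℚ n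
ιv x i = ι (x i)

IsInteger : ℚ → Set
IsInteger q = ∃ λ (k : ℤ) → q ≡ ι k

⟨_,_⟩ : ∀ {n} → Vecℚ n → Vecℚ n → ℚ
⟨ w , x ⟩ = ∑ℚ (λ i → w i ℚ.* x i)

sumOn : ∀ {n} → Vecℚ n → Subset n → ℚ
sumOn x X = ∑ℚ (λ i → if lookup X i then x i else 0ℚ)

χ : ∀ {n} → Subset n → Vecℤ n
χ X i = if lookup X i then + 1 else + 0

data ℤ∞ : Set where
  fin : ℤ → ℤ∞
  ∞   : ℤ∞

_+∞_ : ℤ∞ → ℤ∞ → ℤ∞
fin a +∞ fin b = fin (a ℤ.+ b)
fin a +∞ ∞     = ∞
∞     +∞ _     = ∞

data _≤∞_ : ℤ∞ → ℤ∞ → Set where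
  fin≤fin : ∀ {a b} → a ℤ.≤ b → fin a ≤∞ fin b
  _≤∞∞    : ∀ c → c ≤∞ ∞

∑∞ : ∀ {n} → (Fin n → ℤ∞) → ℤ∞
∑∞ {zero}  f = fin (+ 0)
∑∞ {suc n} f = f Fin.zero +∞ ∑∞ (λ i → f (Fin.suc i))

IsFinite : ℤ∞ → Set
IsFinite c = ∃ λ v → c ≡ fin v

Dom : ∀ {n} → (Vecℤ n → ℤ∞) → Pred (Vecℤ n) 0ℓ
Dom f x = IsFinite (f x)

sumL : List ℚ → ℚ
sumL = Data.List.foldr ℚ._+_ 0ℚ
  where import Data.List

Conv : ∀ {n} → Pred (Vecℤ n) 0ℓ → Pred (Vecℚ n) 0ℓ
Conv {n} S x =
  Σ (List (ℚ × Vecℤ n)) λ L →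
    All (λ (p : ℚ × Vecℤ n) → (0ℚ ≤ proj₁ p) × S (proj₂ p)) L
    × (sumL (Data.List.map proj₁ L) ≡ 1ℚ)
    × (∀ i → x i ≡ sumL (Data.List.map (λ (p : ℚ × Vecℤ n) → proj₁ p ℚ.* ι (proj₂ p i)) L))
  where import Data.List

_≐_ : ∀ {n} → Pred (Vecℚ n) 0ℓ → Pred (Vecℚ n) 0ℓ → Set
P ≐ Q = ∀ x → (P x → Q x) × (Q x → P x)

Submodular : ∀ {n} → (Subset n → ℚ) → Set
Submodular h = ∀ X Y → h (X ∪ Y) ℚ.+ h (X ∩ Y) ≤ h X ℚ.+ h Y

Supermodular : ∀ {n} → (Subset n → ℚ) → Set
Supermodular h = ∀ X Y → h X ℚ.+ h Y ≤ h (X ∪ Y) ℚ.+ h (X ∩ Y)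

IsGPolyBy : ∀ {n} → (Subset n → ℚ) → (Subset n → ℚ) → Pred (Vecℚ n) 0ℓ → Set
IsGPolyBy {n} f g P =
  Submodular f × Supermodular g
  × (f Sub.⊥ ≡ 0ℚ) × (g Sub.⊥ ≡ 0ℚ)
  × (∀ X Y → f (X ─ Y) ℚ.- g (Y ─ X) ≤ f X ℚ.- g Y)
  × (P ≐ λ x → ∀ X → (g X ≤ sumOn x X) × (sumOn x X ≤ f X))

IsGPolymatroid : ∀ {n} → Pred (Vecℚ n) 0ℓ → Set
IsGPolymatroid {n} P = Σ (Subset n → ℚ) λ f → Σ (Subset n → ℚ) λ g → IsGPolyBy f g P

IsIntGPolymatroid : ∀ {n} → Pred (Vecℚ n) 0ℓ → Set
IsIntGPolymatroid {n} P =
  Σ (Subset n → ℚ) λ f → Σ (Subset n → ℚ) λ g →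
    IsGPolyBy f g P × (∀ X → IsInteger (f X) × IsInteger (g X))

IsBasePolyhedron : ∀ {n} → Pred (Vecℚ n) 0ℓ → Set
IsBasePolyhedron P = IsGPolymatroid P × ∃ λ c → ∀ x → P x → ∑ℚ x ≡ c

-- Polyhedral convex functions on ℚ^E (proper ones), given by the standard
-- representation  F(x) = max_k (⟨a_k,x⟩ + b_k)  on the polyhedral domain
-- {x | ⟨c_j,x⟩ ≤ d_j ∀ j}, and +∞ outside.

record PolyConvFn (n : ℕ) : Set where
  field
    pieces : List⁺ (Vecℚ n × ℚ)
    constraints : List (Vecℚ n × ℚ)

  domF : Pred (Vecℚ n) 0ℓ
  domF x = All (λ (c : Vecℚ n × ℚ) → ⟨ proj₁ c , x ⟩ ≤ proj₂ c) constraints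

  val : Vecℚ n → ℚ
  val x = foldr₁ ℚ._⊔_ (map (λ (p : Vecℚ n × ℚ) → ⟨ proj₁ p , x ⟩ ℚ.+ proj₂ p) pieces)

  LinDom : Vecℚ n → Pred (Vecℚ n) 0ℓ
  LinDom z x = domF x × (∀ y → domF y → val x ℚ.- ⟨ z , x ⟩ ≤ val y ℚ.- ⟨ z , y ⟩)

RestrictsTo : ∀ {n} → PolyConvFn n → (Vecℤ n → ℤ∞) → Set
RestrictsTo {n} F f = ∀ x → Agree (f x) x
  where
  open PolyConvFn F
  Agree : ℤ∞ → Vecℤ n → Set
  Agree ∞       x = domF (ιv x) → Data.Empty.⊥
    where import Data.Empty
  Agree (fin v) x = domF (ιv x) × (val (ιv x) ≡ ι v)

IsMNatConvexVia : ∀ {n} → PolyConvFn n → (Vecℤ n → ℤ∞) → Set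
IsMNatConvexVia {n} F f =
  RestrictsTo F f
  × IsIntGPolymatroid (PolyConvFn.domF F)
  × (∀ (z : Vecℚ n) → (∃ λ x → PolyConvFn.LinDom F z x) →
       IsIntGPolymatroid (PolyConvFn.LinDom F z))

IsMNatConvex : ∀ {n} → (Vecℤ n → ℤ∞) → Set
IsMNatConvex {n} f = Σ (PolyConvFn n) λ F → IsMNatConvexVia F f

IsMConvex : ∀ {n} → (Vecℤ n → ℤ∞) → Set
IsMConvex {n} f = Σ (PolyConvFn n) λ F →
  IsMNatConvexVia F f × IsBasePolyhedron (PolyConvFn.domF F)

IsValuatedGMatroid : ∀ {n} → (Vecℤ n → ℤ∞) → Set
IsValuatedGMatroid {n} f =
  IsMNatConvex f
  × (∀ x → (Dom f x → ∀ i → (x i ≡ + 0) ⊎ (x i ≡ + 1))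
         × ((∀ i → (x i ≡ + 0) ⊎ (x i ≡ + 1)) → Dom f x))

IsPermVec : ∀ {n} → Pred (Vecℤ n) 0ℓ
IsPermVec {n} x = Σ (Permutation n n) λ π → ∀ i → x i ≡ + suc (toℕ (π ⟨$⟩ʳ i))

Permutohedron : ∀ {n} → Pred (Vecℚ n) 0ℓ
Permutohedron = Conv IsPermVec

IsSubPermutohedron : ∀ {n} → Pred (Vecℚ n) 0ℓ → Set₁
IsSubPermutohedron {n} P =
  (Σ (Pred (Vecℤ n) 0ℓ) λ T → (∀ x → T x → IsPermVec x) × (P ≐ Conv T))
  × IsBasePolyhedron P

IsValuatedPermutohedron : ∀ {n} → (Vecℤ n → ℤ∞) → Set
IsValuatedPermutohedron f = IsMConvex f × (Conv (Dom f) ≐ Permutohedron)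

ArgMin : ∀ {n} → (Vecℤ n → ℤ∞) → Vecℚ n → Pred (Vecℤ n) 0ℓ
ArgMin f w x = Σ ℤ λ v → (f x ≡ fin v) ×
  (∀ y u → f y ≡ fin u → ι v ℚ.- ⟨ w , ιv x ⟩ ≤ ι u ℚ.- ⟨ w , ιv y ⟩)

-- Y_α (α ∈ [n], encoded as Fin n with α = toℕ α + 1) with |Y_α| = α
-- and x = Σ_α χ_{Y_α}
IsDecomposition : ∀ {n} → Vecℤ n → (Fin n → Subset n) → Set
IsDecomposition x Y =
  (∀ α → ∣ Y α ∣ ≡ suc (toℕ α)) × (∀ i → x i ≡ ∑ℤ (λ α → χ (Y α) i))

cost : ∀ {n} → (Vecℤ n → ℤ∞) → (Fin n → Subset n) → ℤ∞
cost f Y = ∑∞ (λ α → f (χ (Y α)))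

IsMinCost : ∀ {n} → (Vecℤ n → ℤ∞) → Vecℤ n → ℤ∞ → Set
IsMinCost f x c =
  (∀ Y → IsDecomposition x Y → c ≤∞ cost f Y)
  × ((c ≡ ∞) ⊎ (∃ λ Y → IsDecomposition x Y × (cost f Y ≡ c)))

IsCompressionOf : ∀ {n} → (Vecℤ n → ℤ∞) → (Vecℤ n → ℤ∞) → Set
IsCompressionOf f fhat = ∀ x → IsMinCost f x (fhat x)

{-# OPTIONS --safe #-}
module Submission where

-- Everything reduces to base polyhedra of integral submodular functions.  Fix z.  By the hypothesis on linearity
-- domains the subsets minimising f − z − t|·| are, for every slope t, the integral points of a generalized
-- polymatroid, and for a suitable t they include minimisers of two consecutive sizes k and k + 1.  Slicing the
-- generalized polymatroid by size shows that the minimisers of f − z of size k are the integral points of the base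
-- polyhedron of a submodular function r_k, and that r_{k+1} − r_k is monotone with values in {0, 1}, so that for every
-- order of the ground set the greedy vertices of r_1, …, r_n form a chain.  Put H = Σ r_k.  The greedy vertices of H
-- are the sums of these chains, hence permutation vectors, and they generate the base polyhedron of H; by the discrete
-- sandwich theorem its integral points are sums of minimisers, one of each size.  So the base polyhedron of H is the
-- linearity domain at z of the convex envelope of the compression, which agrees with the compression on integral
-- points.  The envelope is polyhedral by Fourier–Motzkin elimination.

open import Defs
open import Algebra using (CommutativeRing)
import Algebra.Properties.CommutativeMonoid.Sum as MonoidSum
import Algebra.Properties.Semiring.Sum as SemiringSum
open import Data.Bool as Bool using (Bool; true; false; if_then_else_; _∧_; _∨_; not)
open import Data.Empty using () renaming (⊥ to Empty; ⊥-elim to Empty-elim)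
open import Data.Fin as Fin using (Fin; toℕ)
import Data.Fin.Induction as FinI
open import Data.Fin.Permutation as Perm using (Permutation; _⟨$⟩ʳ_; _⟨$⟩ˡ_; _∘ₚ_; lift₀; transpose; permutation)
import Data.Fin.Properties as FinP
open import Data.Fin.Subset using (Subset; _∪_; _∩_; _─_; ∁; ∣_∣; inside; outside; ⊤; ⊥; ⁅_⁆)
import Data.Fin.Subset.Properties as SubP
open import Data.Integer as ℤ using (ℤ; +_)
import Data.Integer.Properties as ℤP
open import Data.Integer.Tactic.RingSolver using (solve-∀)
open import Data.List as List using (List; []; _∷_; _++_; filter; cartesianProductWith)
open import Data.List.Membership.Propositional using (_∈_; find)
open import Data.List.Membership.Propositional.Properties using (∈-filter⁺; ∈-filter⁻; ∈-map⁺; ∈-map⁻; ∈-cartesianProductWith⁺; ∈-cartesianProductWith⁻; ∈-++⁺ˡ; ∈-++⁺ʳ; ∈-++⁻)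
open import Data.List.NonEmpty as List⁺ using (List⁺; _∷_; foldr₁)
open import Data.List.Relation.Unary.All as All using (All; []; _∷_)
import Data.List.Relation.Unary.All.Properties as AllP
open import Data.List.Relation.Unary.Any as Any using (here; there; any?)
open import Data.Nat as ℕ using (ℕ; zero; suc)
import Data.Nat.Properties as ℕP
open import Data.Product using (Σ; ∃; _×_; _,_; proj₁; proj₂)
open import Data.Rational as ℚ using (ℚ; 0ℚ; 1ℚ; ½)
import Data.Rational.Properties as ℚP
open import Data.Rational.Solver using (module +-*-Solver)
open import Data.Rational.Unnormalised as ℚᵘ using (mkℚᵘ)
import Data.Rational.Unnormalised.Properties as ℚᵘP
open import Data.Sum using (_⊎_; inj₁; inj₂)
open import Data.Unit using (tt) renaming (⊤ to Unit)
open import Data.Vec as Vec using (Vec; []; _∷_; lookup; tabulate)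
import Data.Vec.Properties as VecP
open import Function using (_∘_; id; Injective)
open import Level using (0ℓ)
open import Relation.Binary.PropositionalEquality
open import Relation.Nullary using (yes; no; contradiction; _×-dec_; _→-dec_; ¬_)
import Relation.Nullary.Decidable as Decidable
open import Relation.Unary using (Pred; Decidable)

open +-*-Solver using (solve; _:=_; _:+_; _:*_; :-_; _:-_; con)

-- The hypothesis speaks of linearity domains of `f` on all subsets at once and not of its
-- restriction to one size, so a layer can only be reached as a slice of such a domain. The slope is
-- taken at k + ½ because a convex combination of sets with this mean size must contain a set of
-- size at most k and one of size at least k + 1. The slopes for different k are chosen
-- independently; the resulting pieces fit together because every value of a base function is
-- attained by an integral base, so a rank function is determined by the family that it describes.
-- The minimum defining the compression couples the sizes through the prescribed sum. Minimising
-- over all sums as well removes the coupling, and the problem separates by size. The construction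
-- is run twice: for the minimisers of f - z, and for all subsets of each size. The second run
-- describes the effective domain and identifies its hull with the permutohedron.

module ΣZ = MonoidSum ℤP.+-0-commutativeMonoid
module ΣQ = MonoidSum ℚP.+-0-commutativeMonoid
module ΣQ* = SemiringSum (CommutativeRing.semiring ℚP.+-*-commutativeRing)

-- Inequalities, and the embedding of the integers into the rationals

≤-diffℤ : ∀ {a b} a' b' → a' ℤ.≤ b' → b' ℤ.- a' ≡ b ℤ.- a → a ℤ.≤ b
≤-diffℤ a' b' le eq = ℤP.0≤i-j⇒j≤i (subst (+ 0 ℤ.≤_) eq (ℤP.i≤j⇒0≤j-i le))

p≤q⇒0≤q-p : ∀ {p q} → p ℚ.≤ q → 0ℚ ℚ.≤ q ℚ.- p
p≤q⇒0≤q-p {p} {q} le = subst (ℚ._≤ q ℚ.- p) (ℚP.+-inverseʳ p) (ℚP.+-monoˡ-≤ (ℚ.- p) le)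

0≤q-p⇒p≤q : ∀ {p q} → 0ℚ ℚ.≤ q ℚ.- p → p ℚ.≤ q
0≤q-p⇒p≤q {p} {q} le = subst₂ ℚ._≤_ (ℚP.+-identityˡ p)
  (solve 2 (λ p q → q :- p :+ p := q) refl p q) (ℚP.+-monoˡ-≤ p le)

-- Reduces a linear inequality to a known one whose slack is the same, so that only a ring identity
-- is left; the integer version serves the same purpose.
≤-diffℚ : ∀ {a b} a' b' → a' ℚ.≤ b' → b' ℚ.- a' ≡ b ℚ.- a → a ℚ.≤ b
≤-diffℚ a' b' le eq = 0≤q-p⇒p≤q (subst (0ℚ ℚ.≤_) eq (p≤q⇒0≤q-p le))

*-nonNeg : ∀ {p q} → 0ℚ ℚ.≤ p → 0ℚ ℚ.≤ q → 0ℚ ℚ.≤ p ℚ.* q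
*-nonNeg {p} {q} 0≤p 0≤q = subst (ℚ._≤ p ℚ.* q) (ℚP.*-zeroʳ p)
  (ℚP.*-monoˡ-≤-nonNeg p {{ℚ.nonNegative 0≤p}} 0≤q)

*-monoˡ-≤ : ∀ {p q r} → 0ℚ ℚ.≤ p → q ℚ.≤ r → p ℚ.* q ℚ.≤ p ℚ.* r
*-monoˡ-≤ {p} 0≤p = ℚP.*-monoˡ-≤-nonNeg p {{ℚ.nonNegative 0≤p}}

-- `_/_` normalises by a gcd and is stuck on a variable. Facts about `ι` are therefore proved for
-- unnormalised rationals and carried back.
toℚᵘ-ι : ∀ a → ℚ.toℚᵘ (ι a) ℚᵘ.≃ mkℚᵘ a 0
toℚᵘ-ι a = ℚP.toℚᵘ-fromℚᵘ (mkℚᵘ a 0)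

ι-+ : ∀ a b → ι (a ℤ.+ b) ≡ ι a ℚ.+ ι b
ι-+ a b = ℚP.toℚᵘ-injective (begin
  ℚ.toℚᵘ (ι (a ℤ.+ b))               ≈⟨ toℚᵘ-ι (a ℤ.+ b) ⟩
  mkℚᵘ (a ℤ.+ b) 0                   ≈⟨ ℚᵘ.*≡* (lem a b) ⟩
  mkℚᵘ a 0 ℚᵘ.+ mkℚᵘ b 0             ≈⟨ ℚᵘP.+-cong (toℚᵘ-ι a) (toℚᵘ-ι b) ⟨
  ℚ.toℚᵘ (ι a) ℚᵘ.+ ℚ.toℚᵘ (ι b)     ≈⟨ ℚP.toℚᵘ-homo-+ (ι a) (ι b) ⟨
  ℚ.toℚᵘ (ι a ℚ.+ ι b)               ∎)
  where
  open import Relation.Binary.Reasoning.Setoid ℚᵘP.≃-setoid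
  lem : ∀ a b → (a ℤ.+ b) ℤ.* + 1 ≡ (a ℤ.* + 1 ℤ.+ b ℤ.* + 1) ℤ.* + 1
  lem = solve-∀

ι-neg : ∀ a → ι (ℤ.- a) ≡ ℚ.- ι a
ι-neg a = trans (solve 2 (λ x y → x := x :+ y :- y) refl (ι (ℤ.- a)) (ι a))
  (trans (cong (ℚ._- ι a) (trans (sym (ι-+ (ℤ.- a) a)) (cong ι (ℤP.+-inverseˡ a)))) (ℚP.+-identityˡ (ℚ.- ι a)))

ι-- : ∀ a b → ι (a ℤ.- b) ≡ ι a ℚ.- ι b
ι-- a b = trans (ι-+ a (ℤ.- b)) (cong (ι a ℚ.+_) (ι-neg b))

ι-mono : ∀ {a b} → a ℤ.≤ b → ι a ℚ.≤ ι b
ι-mono {a} {b} le = ℚP.toℚᵘ-cancel-≤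
  (ℚᵘP.≤-respˡ-≃ (ℚᵘP.≃-sym (toℚᵘ-ι a)) (ℚᵘP.≤-respʳ-≃ (ℚᵘP.≃-sym (toℚᵘ-ι b))
    (ℚᵘ.*≤* (ℤP.*-monoʳ-≤-nonNeg (+ 1) le))))

ι-cancel-≤ : ∀ {a b} → ι a ℚ.≤ ι b → a ℤ.≤ b
ι-cancel-≤ {a} {b} le with ℚᵘP.≤-respˡ-≃ (toℚᵘ-ι a) (ℚᵘP.≤-respʳ-≃ (toℚᵘ-ι b) (ℚP.toℚᵘ-mono-≤ le))
... | ℚᵘ.*≤* le′ = subst₂ ℤ._≤_ (ℤP.*-identityʳ a) (ℤP.*-identityʳ b) le′

ι-injective : ∀ {a b} → ι a ≡ ι b → a ≡ b
ι-injective eq = ℤP.≤-antisym (ι-cancel-≤ (ℚP.≤-reflexive eq)) (ι-cancel-≤ (ℚP.≤-reflexive (sym eq)))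

-- Finite sums and inner products

∑ℤ-sum : ∀ {n} (f : Fin n → ℤ) → ∑ℤ f ≡ ΣZ.sum f
∑ℤ-sum {zero}  f = refl
∑ℤ-sum {suc n} f = cong (ℤ._+_ (f Fin.zero)) (∑ℤ-sum (f ∘ Fin.suc))

∑ℚ-sum : ∀ {n} (f : Fin n → ℚ) → ∑ℚ f ≡ ΣQ.sum f
∑ℚ-sum {zero}  f = refl
∑ℚ-sum {suc n} f = cong (f Fin.zero ℚ.+_) (∑ℚ-sum (f ∘ Fin.suc))

∑ℤ-cong : ∀ {n} {f g : Fin n → ℤ} → (∀ i → f i ≡ g i) → ∑ℤ f ≡ ∑ℤ g
∑ℤ-cong {zero}  e = refl
∑ℤ-cong {suc n} e = cong₂ ℤ._+_ (e Fin.zero) (∑ℤ-cong (e ∘ Fin.suc))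

∑ℚ-cong : ∀ {n} {f g : Fin n → ℚ} → (∀ i → f i ≡ g i) → ∑ℚ f ≡ ∑ℚ g
∑ℚ-cong {zero}  e = refl
∑ℚ-cong {suc n} e = cong₂ ℚ._+_ (e Fin.zero) (∑ℚ-cong (e ∘ Fin.suc))

∑ℤ-zero : ∀ n → ∑ℤ {n} (λ _ → + 0) ≡ + 0
∑ℤ-zero zero    = refl
∑ℤ-zero (suc n) = trans (ℤP.+-identityˡ _) (∑ℤ-zero n)

∑ℚ-zero : ∀ n → ∑ℚ {n} (λ _ → 0ℚ) ≡ 0ℚ
∑ℚ-zero zero    = refl
∑ℚ-zero (suc n) = trans (ℚP.+-identityˡ _) (∑ℚ-zero n)

∑ℤ-+ : ∀ {n} (f g : Fin n → ℤ) → ∑ℤ (λ i → f i ℤ.+ g i) ≡ ∑ℤ f ℤ.+ ∑ℤ g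
∑ℤ-+ f g = trans (∑ℤ-sum (λ i → f i ℤ.+ g i)) (trans (ΣZ.∑-distrib-+ f g) (sym (cong₂ ℤ._+_ (∑ℤ-sum f) (∑ℤ-sum g))))

∑ℚ-+ : ∀ {n} (f g : Fin n → ℚ) → ∑ℚ (λ i → f i ℚ.+ g i) ≡ ∑ℚ f ℚ.+ ∑ℚ g
∑ℚ-+ f g = trans (∑ℚ-sum (λ i → f i ℚ.+ g i)) (trans (ΣQ.∑-distrib-+ f g) (sym (cong₂ ℚ._+_ (∑ℚ-sum f) (∑ℚ-sum g))))

∑ℚ-*ˡ : ∀ {n} c (f : Fin n → ℚ) → ∑ℚ (λ i → c ℚ.* f i) ≡ c ℚ.* ∑ℚ f
∑ℚ-*ˡ c f = trans (∑ℚ-sum (λ i → c ℚ.* f i)) (trans (sym (ΣQ*.*-distribˡ-sum c f)) (cong (c ℚ.*_) (sym (∑ℚ-sum f))))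

∑ℤ-neg : ∀ {n} (f : Fin n → ℤ) → ∑ℤ (λ i → ℤ.- f i) ≡ ℤ.- ∑ℤ f
∑ℤ-neg {zero}  f = refl
∑ℤ-neg {suc n} f = trans (cong (ℤ._+_ (ℤ.- f Fin.zero)) (∑ℤ-neg (f ∘ Fin.suc))) (sym (ℤP.neg-distrib-+ (f Fin.zero) _))

∑ℤ-- : ∀ {n} (f g : Fin n → ℤ) → ∑ℤ (λ i → f i ℤ.- g i) ≡ ∑ℤ f ℤ.- ∑ℤ g
∑ℤ-- f g = trans (∑ℤ-+ f (λ i → ℤ.- g i)) (cong (ℤ._+_ (∑ℤ f)) (∑ℤ-neg g))

∑ℤ-mono : ∀ {n} {f g : Fin n → ℤ} → (∀ i → f i ℤ.≤ g i) → ∑ℤ f ℤ.≤ ∑ℤ g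
∑ℤ-mono {zero}  le = ℤP.≤-refl
∑ℤ-mono {suc n} le = ℤP.+-mono-≤ (le Fin.zero) (∑ℤ-mono (le ∘ Fin.suc))

∑ℚ-mono : ∀ {n} {f g : Fin n → ℚ} → (∀ i → f i ℚ.≤ g i) → ∑ℚ f ℚ.≤ ∑ℚ g
∑ℚ-mono {zero}  le = ℚP.≤-refl
∑ℚ-mono {suc n} le = ℚP.+-mono-≤ (le Fin.zero) (∑ℚ-mono (le ∘ Fin.suc))

∑ℤ-comm : ∀ {m n} (f : Fin m → Fin n → ℤ) → ∑ℤ (λ i → ∑ℤ (f i)) ≡ ∑ℤ (λ j → ∑ℤ (λ i → f i j))
∑ℤ-comm {m} {n} f = begin
  ∑ℤ (λ i → ∑ℤ (f i))                 ≡⟨ ∑ℤ-cong (λ i → ∑ℤ-sum (f i)) ⟩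
  ∑ℤ (λ i → ΣZ.sum (f i))             ≡⟨ ∑ℤ-sum (λ i → ΣZ.sum (f i)) ⟩
  ΣZ.sum (λ i → ΣZ.sum (f i))         ≡⟨ ΣZ.∑-comm f ⟩
  ΣZ.sum (λ j → ΣZ.sum (λ i → f i j)) ≡⟨ ∑ℤ-sum (λ j → ΣZ.sum (λ i → f i j)) ⟨
  ∑ℤ (λ j → ΣZ.sum (λ i → f i j))     ≡⟨ ∑ℤ-cong (λ j → ∑ℤ-sum (λ i → f i j)) ⟨
  ∑ℤ (λ j → ∑ℤ (λ i → f i j))         ∎
  where open ≡-Reasoning

∑ℤ-permute : ∀ {n} (f : Fin n → ℤ) (π : Permutation n n) → ∑ℤ f ≡ ∑ℤ (λ i → f (π ⟨$⟩ʳ i))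
∑ℤ-permute f π = trans (∑ℤ-sum f) (trans (ΣZ.sum-permute f π) (sym (∑ℤ-sum (λ i → f (π ⟨$⟩ʳ i)))))

∑ℚ-permute : ∀ {n} (f : Fin n → ℚ) (π : Permutation n n) → ∑ℚ f ≡ ∑ℚ (λ i → f (π ⟨$⟩ʳ i))
∑ℚ-permute f π = trans (∑ℚ-sum f) (trans (ΣQ.sum-permute f π) (sym (∑ℚ-sum (λ i → f (π ⟨$⟩ʳ i)))))

∑ℤ-ι : ∀ {n} (f : Fin n → ℤ) → ι (∑ℤ f) ≡ ∑ℚ (λ i → ι (f i))
∑ℤ-ι {zero}  f = refl
∑ℤ-ι {suc n} f = trans (ι-+ (f Fin.zero) (∑ℤ (f ∘ Fin.suc))) (cong (ι (f Fin.zero) ℚ.+_) (∑ℤ-ι (f ∘ Fin.suc)))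

⟨,⟩-+ʳ : ∀ {n} (w x y : Vecℚ n) → ⟨ w , (λ i → x i ℚ.+ y i) ⟩ ≡ ⟨ w , x ⟩ ℚ.+ ⟨ w , y ⟩
⟨,⟩-+ʳ w x y = trans (∑ℚ-cong (λ i → ℚP.*-distribˡ-+ (w i) (x i) (y i))) (∑ℚ-+ (λ i → w i ℚ.* x i) (λ i → w i ℚ.* y i))

⟨,⟩-+ˡ : ∀ {n} (v w x : Vecℚ n) → ⟨ (λ i → v i ℚ.+ w i) , x ⟩ ≡ ⟨ v , x ⟩ ℚ.+ ⟨ w , x ⟩
⟨,⟩-+ˡ v w x = trans (∑ℚ-cong (λ i → ℚP.*-distribʳ-+ (x i) (v i) (w i))) (∑ℚ-+ (λ i → v i ℚ.* x i) (λ i → w i ℚ.* x i))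

⟨,⟩-*ʳ : ∀ {n} c (w x : Vecℚ n) → ⟨ w , (λ i → c ℚ.* x i) ⟩ ≡ c ℚ.* ⟨ w , x ⟩
⟨,⟩-*ʳ c w x = trans (∑ℚ-cong (λ i → solve 3 (λ c w x → w :* (c :* x) := c :* (w :* x)) refl c (w i) (x i))) (∑ℚ-*ˡ c (λ i → w i ℚ.* x i))

⟨,⟩-*ˡ : ∀ {n} c (w x : Vecℚ n) → ⟨ (λ i → c ℚ.* w i) , x ⟩ ≡ c ℚ.* ⟨ w , x ⟩
⟨,⟩-*ˡ c w x = trans (∑ℚ-cong (λ i → ℚP.*-assoc c (w i) (x i))) (∑ℚ-*ˡ c (λ i → w i ℚ.* x i))

⟨,⟩-zeroˡ : ∀ {n} (x : Vecℚ n) → ⟨ (λ _ → 0ℚ) , x ⟩ ≡ 0ℚ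
⟨,⟩-zeroˡ {n} x = trans (∑ℚ-cong (λ i → ℚP.*-zeroˡ (x i))) (∑ℚ-zero n)

⟨,⟩-zeroʳ : ∀ {n} (x : Vecℚ n) → ⟨ x , (λ _ → 0ℚ) ⟩ ≡ 0ℚ
⟨,⟩-zeroʳ {n} x = trans (∑ℚ-cong (λ i → ℚP.*-zeroʳ (x i))) (∑ℚ-zero n)

⟨,⟩-congʳ : ∀ {n} (w : Vecℚ n) {x y} → (∀ i → x i ≡ y i) → ⟨ w , x ⟩ ≡ ⟨ w , y ⟩
⟨,⟩-congʳ w e = ∑ℚ-cong (λ i → cong (w i ℚ.*_) (e i))

⟨,⟩-negˡ : ∀ {n} (w x : Vecℚ n) → ⟨ (λ i → ℚ.- w i) , x ⟩ ≡ ℚ.- ⟨ w , x ⟩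
⟨,⟩-negˡ w x = begin
  ⟨ (λ i → ℚ.- w i) , x ⟩          ≡⟨ ∑ℚ-cong (λ i → solve 2 (λ w x → (:- w) :* x := con (ℚ.- 1ℚ) :* (w :* x)) refl (w i) (x i)) ⟩
  ∑ℚ (λ i → ℚ.- 1ℚ ℚ.* (w i ℚ.* x i)) ≡⟨ ∑ℚ-*ˡ (ℚ.- 1ℚ) (λ i → w i ℚ.* x i) ⟩
  ℚ.- 1ℚ ℚ.* ⟨ w , x ⟩             ≡⟨ solve 1 (λ a → con (ℚ.- 1ℚ) :* a := :- a) refl ⟨ w , x ⟩ ⟩
  ℚ.- ⟨ w , x ⟩                    ∎
  where open ≡-Reasoning

-- Base polyhedra and the greedy algorithm

sumOnℤ : ∀ {n} → Vecℤ n → Subset n → ℤ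
sumOnℤ x X = ∑ℤ (λ i → if lookup X i then x i else + 0)

sumOnℤ-cong : ∀ {n} {x y : Vecℤ n} → (∀ i → x i ≡ y i) → ∀ X → sumOnℤ x X ≡ sumOnℤ y X
sumOnℤ-cong e X = ∑ℤ-cong (λ i → cong (if lookup X i then_else + 0) (e i))

sumOnℤ-⊤ : ∀ {n} (x : Vecℤ n) → sumOnℤ x ⊤ ≡ ∑ℤ x
sumOnℤ-⊤ {zero}  x = refl
sumOnℤ-⊤ {suc n} x = cong (ℤ._+_ (x Fin.zero)) (sumOnℤ-⊤ (x ∘ Fin.suc))

sumOnℤ-⊥ : ∀ {n} (x : Vecℤ n) → sumOnℤ x ⊥ ≡ + 0
sumOnℤ-⊥ {zero}  x = refl
sumOnℤ-⊥ {suc n} x = trans (ℤP.+-identityˡ _) (sumOnℤ-⊥ (x ∘ Fin.suc))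

sumOnℤ-modular : ∀ {n} (x : Vecℤ n) X Y → sumOnℤ x (X ∪ Y) ℤ.+ sumOnℤ x (X ∩ Y) ≡ sumOnℤ x X ℤ.+ sumOnℤ x Y
sumOnℤ-modular x X Y = trans (sym (∑ℤ-+ (mask (X ∪ Y)) (mask (X ∩ Y)))) (trans (∑ℤ-cong pw) (∑ℤ-+ (mask X) (mask Y)))
  where
  mask : Subset _ → Fin _ → ℤ
  mask Z i = if lookup Z i then x i else + 0
  bool : ∀ a b (z : ℤ) → (if a ∨ b then z else + 0) ℤ.+ (if a ∧ b then z else + 0)
                       ≡ (if a then z else + 0) ℤ.+ (if b then z else + 0)
  bool true  b     z = refl
  bool false b     z = ℤP.+-comm (if b then z else + 0) (+ 0)
  pw : ∀ i → mask (X ∪ Y) i ℤ.+ mask (X ∩ Y) i ≡ mask X i ℤ.+ mask Y i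
  pw i rewrite VecP.lookup-zipWith _∨_ i X Y | VecP.lookup-zipWith _∧_ i X Y = bool (lookup X i) (lookup Y i) (x i)

sumOnℤ-∁ : ∀ {n} (x : Vecℤ n) X → sumOnℤ x X ℤ.+ sumOnℤ x (∁ X) ≡ ∑ℤ x
sumOnℤ-∁ x X = trans (sym (sumOnℤ-modular x X (∁ X)))
  (trans (cong₂ (λ Y Z → sumOnℤ x Y ℤ.+ sumOnℤ x Z) (SubP.∪-inverseʳ X) (SubP.∩-inverseʳ X))
    (trans (cong₂ ℤ._+_ (sumOnℤ-⊤ x) (sumOnℤ-⊥ x)) (ℤP.+-identityʳ _)))

sumOnℤ-∑ : ∀ {k n} (x : Fin k → Vecℤ n) X → sumOnℤ (λ i → ∑ℤ (λ α → x α i)) X ≡ ∑ℤ (λ α → sumOnℤ (x α) X)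
sumOnℤ-∑ {k} {n} x X = trans (∑ℤ-cong (λ i → dist (lookup X i) (λ α → x α i)))
  (∑ℤ-comm (λ i α → if lookup X i then x α i else + 0))
  where
  dist : ∀ b (f : Fin k → ℤ) → (if b then ∑ℤ f else + 0) ≡ ∑ℤ (λ α → if b then f α else + 0)
  dist true  f = refl
  dist false f = sym (∑ℤ-zero k)

sumOnℤ-- : ∀ {n} (x y : Vecℤ n) X → sumOnℤ (λ i → x i ℤ.- y i) X ≡ sumOnℤ x X ℤ.- sumOnℤ y X
sumOnℤ-- {n} x y X = trans (∑ℤ-cong (λ i → dist (lookup X i) (x i) (y i)))
  (∑ℤ-- (λ i → if lookup X i then x i else + 0) (λ i → if lookup X i then y i else + 0))
  where
  dist : ∀ b u v → (if b then u ℤ.- v else + 0) ≡ (if b then u else + 0) ℤ.- (if b then v else + 0)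
  dist true  u v = refl
  dist false u v = refl

sumOn-ι : ∀ {n} (x : Vecℤ n) X → sumOn (ιv x) X ≡ ι (sumOnℤ x X)
sumOn-ι x X = trans (∑ℚ-cong (λ i → dist (lookup X i) (x i))) (sym (∑ℤ-ι (λ i → if lookup X i then x i else + 0)))
  where
  dist : ∀ b z → (if b then ι z else 0ℚ) ≡ ι (if b then z else + 0)
  dist true  z = refl
  dist false z = refl

sumOn-⟨,⟩ : ∀ {n} (x : Vecℚ n) X → sumOn x X ≡ ⟨ ιv (χ X) , x ⟩
sumOn-⟨,⟩ x X = ∑ℚ-cong (λ i → dist (lookup X i) (x i))
  where
  dist : ∀ b z → (if b then z else 0ℚ) ≡ ι (if b then + 1 else + 0) ℚ.* z
  dist true  z = sym (ℚP.*-identityˡ z)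
  dist false z = sym (ℚP.*-zeroˡ z)

sumOn-cong : ∀ {n} {x y : Vecℚ n} → (∀ i → x i ≡ y i) → ∀ X → sumOn x X ≡ sumOn y X
sumOn-cong e X = ∑ℚ-cong (λ i → cong (if lookup X i then_else 0ℚ) (e i))

sumOn-⊤ : ∀ {n} (x : Vecℚ n) → sumOn x ⊤ ≡ ∑ℚ x
sumOn-⊤ {zero}  x = refl
sumOn-⊤ {suc n} x = cong (x Fin.zero ℚ.+_) (sumOn-⊤ (x ∘ Fin.suc))

sumOn-⊥ : ∀ {n} (x : Vecℚ n) → sumOn x ⊥ ≡ 0ℚ
sumOn-⊥ {zero}  x = refl
sumOn-⊥ {suc n} x = trans (ℚP.+-identityˡ _) (sumOn-⊥ (x ∘ Fin.suc))

sumOn-∁ : ∀ {n} (x : Vecℚ n) X → sumOn x X ℚ.+ sumOn x (∁ X) ≡ ∑ℚ x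
sumOn-∁ x X = trans (sym (∑ℚ-+ (λ i → if lookup X i then x i else 0ℚ) (λ i → if lookup (∁ X) i then x i else 0ℚ))) (∑ℚ-cong pw)
  where
  bool : ∀ a z → (if a then z else 0ℚ) ℚ.+ (if not a then z else 0ℚ) ≡ z
  bool true  z = ℚP.+-identityʳ z
  bool false z = ℚP.+-identityˡ z
  pw : ∀ i → (if lookup X i then x i else 0ℚ) ℚ.+ (if lookup (∁ X) i then x i else 0ℚ) ≡ x i
  pw i rewrite VecP.lookup-map i not X = bool (lookup X i) (x i)

∑ℤ-χ : ∀ {n} (Y : Subset n) → ∑ℤ (χ Y) ≡ + ∣ Y ∣
∑ℤ-χ []            = refl
∑ℤ-χ (outside ∷ Y) = trans (ℤP.+-identityˡ _) (∑ℤ-χ Y)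
∑ℤ-χ (inside  ∷ Y) = cong (ℤ._+_ (+ 1)) (∑ℤ-χ Y)

lookup-ext : ∀ {n} {X Y : Subset n} → (∀ i → lookup X i ≡ lookup Y i) → X ≡ Y
lookup-ext {X = X} {Y} e = trans (sym (VecP.tabulate∘lookup X)) (trans (VecP.tabulate-cong e) (VecP.tabulate∘lookup Y))

Submodularℤ : ∀ {n} → (Subset n → ℤ) → Set
Submodularℤ h = ∀ X Y → h (X ∪ Y) ℤ.+ h (X ∩ Y) ℤ.≤ h X ℤ.+ h Y

record BaseFunction {n} (h : Subset n → ℤ) : Set where
  field
    submodular : Submodularℤ h
    h⊥≡0       : h ⊥ ≡ + 0

open BaseFunction

Baseℤ : ∀ {n} → (Subset n → ℤ) → Pred (Vecℤ n) 0ℓ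
Baseℤ h x = (∀ X → sumOnℤ x X ℤ.≤ h X) × ∑ℤ x ≡ h ⊤

Baseℚ : ∀ {n} → (Subset n → ℤ) → Pred (Vecℚ n) 0ℓ
Baseℚ h x = (∀ X → sumOn x X ℚ.≤ ι (h X)) × ∑ℚ x ≡ ι (h ⊤)

Baseℤ-cong : ∀ {n} {h : Subset n → ℤ} {x y} → (∀ i → x i ≡ y i) → Baseℤ h x → Baseℤ h y
Baseℤ-cong e (le , eq) = (λ X → subst (ℤ._≤ _) (sumOnℤ-cong e X) (le X)) , trans (sym (∑ℤ-cong e)) eq

Baseℤ⇒Baseℚ : ∀ {n} {h : Subset n → ℤ} {x} → Baseℤ h x → Baseℚ h (ιv x)
Baseℤ⇒Baseℚ {x = x} (le , eq) =
  (λ X → subst (ℚ._≤ _) (sym (sumOn-ι x X)) (ι-mono (le X))) , trans (sym (∑ℤ-ι x)) (cong ι eq)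

Baseℚ⇒Baseℤ : ∀ {n} {h : Subset n → ℤ} {x} → Baseℚ h (ιv x) → Baseℤ h x
Baseℚ⇒Baseℤ {x = x} (le , eq) =
  (λ X → ι-cancel-≤ (subst (ℚ._≤ _) (sumOn-ι x X) (le X))) , ι-injective (trans (∑ℤ-ι x) eq)

-- The matroid-style contraction of the first element: its bases are the tails of those bases of `h`
-- whose first coordinate has the maximal value `h (inside ∷ ⊥)`.
contract : ∀ {n} → (Subset (suc n) → ℤ) → Subset n → ℤ
contract h X = h (inside ∷ X) ℤ.- h (inside ∷ ⊥)

contract-base : ∀ {n} {h : Subset (suc n) → ℤ} → BaseFunction h → BaseFunction (contract h)
contract-base {h = h} B = record
  { submodular = λ X Y → ≤-diffℤ _ _ (submodular B (inside ∷ X) (inside ∷ Y))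
      (lem (h (inside ∷ X)) (h (inside ∷ Y)) (h (inside ∷ X ∪ Y)) (h (inside ∷ X ∩ Y)) (h (inside ∷ ⊥)))
  ; h⊥≡0 = ℤP.+-inverseʳ (h (inside ∷ ⊥))
  }
  where
  lem : ∀ x y u i c → x ℤ.+ y ℤ.- (u ℤ.+ i) ≡ (x ℤ.- c ℤ.+ (y ℤ.- c)) ℤ.- (u ℤ.- c ℤ.+ (i ℤ.- c))
  lem = solve-∀

-- The vertex of the base polyhedron for the order 0 < 1 < … of the ground set: its sum on each initial segment is maximal.
greedy : ∀ {n} → (Subset n → ℤ) → Vecℤ n
greedy h Fin.zero    = h (inside ∷ ⊥)
greedy h (Fin.suc i) = greedy (contract h) i

greedy-total : ∀ {n} {h : Subset n → ℤ} → BaseFunction h → ∑ℤ (greedy h) ≡ h ⊤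
greedy-total {zero}      B = sym (h⊥≡0 B)
greedy-total {suc n} {h} B = trans (cong (ℤ._+_ (h (inside ∷ ⊥))) (greedy-total (contract-base B)))
  (lem (h (inside ∷ ⊥)) (h (inside ∷ ⊤)))
  where
  lem : ∀ a b → a ℤ.+ (b ℤ.- a) ≡ b
  lem = solve-∀

greedy-≤ : ∀ {n} {h : Subset n → ℤ} → BaseFunction h → ∀ X → sumOnℤ (greedy h) X ℤ.≤ h X
greedy-≤ {zero}      B []            = ℤP.≤-reflexive (sym (h⊥≡0 B))
greedy-≤ {suc n} {h} B (inside  ∷ X) = ≤-diffℤ _ _ (greedy-≤ (contract-base B) X)
  (lem (h (inside ∷ X)) (h (inside ∷ ⊥)) _)
  where
  lem : ∀ x c s → x ℤ.- c ℤ.- s ≡ x ℤ.- (c ℤ.+ s)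
  lem = solve-∀
greedy-≤ {suc n} {h} B (outside ∷ X) = begin
  + 0 ℤ.+ sumOnℤ (greedy (contract h)) X ≡⟨ ℤP.+-identityˡ _ ⟩
  sumOnℤ (greedy (contract h)) X         ≤⟨ greedy-≤ (contract-base B) X ⟩
  -- Diminishing returns: `X` adds to the first element at most what it adds to the empty set.
  h (inside ∷ X) ℤ.- h (inside ∷ ⊥)      ≤⟨ ≤-diffℤ _ _ sub (lem (h (outside ∷ X)) (h (inside ∷ ⊥)) (h (inside ∷ X))) ⟩
  h (outside ∷ X)                        ∎
  where
  open ℤP.≤-Reasoning
  lem : ∀ x c y → x ℤ.+ c ℤ.- (y ℤ.+ + 0) ≡ x ℤ.- (y ℤ.- c)
  lem = solve-∀
  sub : h (inside ∷ X) ℤ.+ + 0 ℤ.≤ h (outside ∷ X) ℤ.+ h (inside ∷ ⊥)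
  sub = subst₂ (λ Y Z → Y ℤ.+ Z ℤ.≤ h (outside ∷ X) ℤ.+ h (inside ∷ ⊥))
    (cong (h ∘ (inside ∷_)) (SubP.∪-identityʳ X)) (trans (cong (h ∘ (outside ∷_)) (SubP.∩-zeroʳ X)) (h⊥≡0 B))
    (submodular B (outside ∷ X) (inside ∷ ⊥))

greedy-base : ∀ {n} {h : Subset n → ℤ} → BaseFunction h → Baseℤ h (greedy h)
greedy-base B = greedy-≤ B , greedy-total B

Decreasing : ∀ {n} → Vecℚ n → Set
Decreasing u = ∀ i j → toℕ i ℕ.≤ toℕ j → u j ℚ.≤ u i

-- The first coordinate of `y` may fall short of its maximum, and then the tail of `y` exceeds the
-- bounds of the contraction by the shortfall. The induction therefore carries a uniform excess `s`,
-- charged at a rate `c` above all weights. In the recursive call the rate is `u₀`, which is exactly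
-- what the shortfall has saved (summation by parts).
greedy-optimal-slack : ∀ {n} {h : Subset n → ℤ} → BaseFunction h → (u y : Vecℚ n) → Decreasing u →
  ∀ s c → (∀ X → sumOn y X ℚ.≤ ι (h X) ℚ.+ s) → ∑ℚ y ≡ ι (h ⊤) ℚ.+ s → 0ℚ ℚ.≤ s → (∀ i → u i ℚ.≤ c) →
  ⟨ u , y ⟩ ℚ.≤ ⟨ u , ιv (greedy h) ⟩ ℚ.+ c ℚ.* s
greedy-optimal-slack {zero}  {h} B u y dec s c le eq 0≤s u≤c = ℚP.≤-reflexive (begin
  0ℚ              ≡⟨ ℚP.*-zeroʳ c ⟨
  c ℚ.* 0ℚ        ≡⟨ cong (c ℚ.*_) (trans eq (trans (cong (λ z → ι z ℚ.+ s) (h⊥≡0 B)) (ℚP.+-identityˡ s))) ⟩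
  c ℚ.* s         ≡⟨ ℚP.+-identityˡ _ ⟨
  0ℚ ℚ.+ c ℚ.* s  ∎)
  where open ≡-Reasoning
greedy-optimal-slack {suc n} {h} B u y dec s c le eq 0≤s u≤c = begin
  u₀ ℚ.* y₀ ℚ.+ ⟨ u′ , y′ ⟩                       ≤⟨ ℚP.+-monoʳ-≤ (u₀ ℚ.* y₀) ih ⟩
  u₀ ℚ.* y₀ ℚ.+ (G ℚ.+ u₀ ℚ.* (v₀ ℚ.+ s ℚ.- y₀))  ≡⟨ solve 5 (λ u y g v s → u :* y :+ (g :+ u :* (v :+ s :- y)) := u :* v :+ g :+ u :* s) refl u₀ y₀ G v₀ s ⟩
  u₀ ℚ.* v₀ ℚ.+ G ℚ.+ u₀ ℚ.* s                    ≤⟨ ℚP.+-monoʳ-≤ (u₀ ℚ.* v₀ ℚ.+ G) (ℚP.*-monoʳ-≤-nonNeg s {{ℚ.nonNegative 0≤s}} (u≤c Fin.zero)) ⟩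
  u₀ ℚ.* v₀ ℚ.+ G ℚ.+ c ℚ.* s                     ∎
  where
  open ℚP.≤-Reasoning
  u₀ = u Fin.zero
  y₀ = y Fin.zero
  u′ = u ∘ Fin.suc
  y′ = y ∘ Fin.suc
  v₀ = ι (h (inside ∷ ⊥))
  G  = ⟨ u′ , ιv (greedy (contract h)) ⟩
  shift : ∀ X → ι (h (inside ∷ X)) ℚ.+ s ℚ.- y₀ ≡ ι (contract h X) ℚ.+ (v₀ ℚ.+ s ℚ.- y₀)
  shift X = trans (solve 4 (λ a s y v → a :+ s :- y := (a :- v) :+ (v :+ s :- y)) refl (ι (h (inside ∷ X))) s y₀ v₀)
    (cong (ℚ._+ (v₀ ℚ.+ s ℚ.- y₀)) (sym (ι-- (h (inside ∷ X)) (h (inside ∷ ⊥)))))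
  cancel : ∀ {a b} → y₀ ℚ.+ a ℚ.≤ b → a ℚ.≤ b ℚ.- y₀
  cancel {a} {b} p = ≤-diffℚ _ _ p (solve 3 (λ y a b → b :- (y :+ a) := b :- y :- a) refl y₀ a b)
  le′ : ∀ X → sumOn y′ X ℚ.≤ ι (contract h X) ℚ.+ (v₀ ℚ.+ s ℚ.- y₀)
  le′ X = subst (sumOn y′ X ℚ.≤_) (shift X) (cancel (le (inside ∷ X)))
  eq′ : ∑ℚ y′ ≡ ι (contract h ⊤) ℚ.+ (v₀ ℚ.+ s ℚ.- y₀)
  eq′ = trans (solve 2 (λ y a → a := y :+ a :- y) refl y₀ (∑ℚ y′)) (trans (cong (ℚ._- y₀) eq) (shift ⊤))
  ih = greedy-optimal-slack (contract-base B) u′ y′ (λ i j i≤j → dec (Fin.suc i) (Fin.suc j) (ℕ.s≤s i≤j))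
    (v₀ ℚ.+ s ℚ.- y₀) u₀ le′ eq′
    (subst (ℚ._≤ v₀ ℚ.+ s ℚ.- y₀) (sumOn-⊥ y′) (cancel (le (inside ∷ ⊥))))
    (λ i → dec Fin.zero (Fin.suc i) ℕ.z≤n)

upper-bound : ∀ {n} (u : Vecℚ n) → ∃ λ c → ∀ i → u i ℚ.≤ c
upper-bound {zero}  u = 0ℚ , λ ()
upper-bound {suc n} u with upper-bound (u ∘ Fin.suc)
... | c , le = u Fin.zero ℚ.⊔ c , λ where
  Fin.zero    → ℚP.p≤p⊔q (u Fin.zero) c
  (Fin.suc i) → ℚP.≤-trans (le i) (ℚP.p≤q⊔p (u Fin.zero) c)

greedy-optimal : ∀ {n} {h : Subset n → ℤ} → BaseFunction h → (u y : Vecℚ n) → Decreasing u → Baseℚ h y →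
  ⟨ u , y ⟩ ℚ.≤ ⟨ u , ιv (greedy h) ⟩
greedy-optimal {h = h} B u y dec (le , eq) with upper-bound u
... | c , u≤c = subst (⟨ u , y ⟩ ℚ.≤_) (solve 2 (λ g c → g :+ c :* con 0ℚ := g) refl ⟨ u , ιv (greedy h) ⟩ c)
  (greedy-optimal-slack B u y dec 0ℚ c (λ X → subst (sumOn y X ℚ.≤_) (sym (ℚP.+-identityʳ _)) (le X))
    (trans eq (sym (ℚP.+-identityʳ _))) ℚP.≤-refl u≤c)

-- Greedy vertices for arbitrary orders

argmax : ∀ {n} (u : Vecℚ (suc n)) → ∃ λ i → ∀ j → u j ℚ.≤ u i
argmax {zero}  u = Fin.zero , λ { Fin.zero → ℚP.≤-refl }
argmax {suc n} u with argmax (u ∘ Fin.suc)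
... | i , max with ℚP.≤-total (u Fin.zero) (u (Fin.suc i))
...   | inj₁ le = Fin.suc i , λ { Fin.zero → le ; (Fin.suc j) → max j }
...   | inj₂ ge = Fin.zero , λ { Fin.zero → ℚP.≤-refl ; (Fin.suc j) → ℚP.≤-trans (max j) ge }

sort : ∀ {n} (u : Vecℚ n) → ∃ λ (π : Permutation n n) → Decreasing (λ i → u (π ⟨$⟩ʳ i))
sort {zero}  u = Perm.id , λ ()
sort {suc n} u with argmax u
... | i , max with sort (λ j → u (transpose Fin.zero i ⟨$⟩ʳ Fin.suc j))
...   | π , dec = lift₀ π ∘ₚ transpose Fin.zero i , λ where
  Fin.zero    k           _           → max (transpose Fin.zero i ⟨$⟩ʳ (lift₀ π ⟨$⟩ʳ k))
  (Fin.suc j) (Fin.suc k) (ℕ.s≤s j≤k) → dec j k j≤k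

module _ {n} (π : Permutation n n) where

  -- The image of a set under `π`, so that `h ∘ act` is `h` with the element `π ⟨$⟩ʳ j` renamed to
  -- `j`.
  act : Subset n → Subset n
  act X = tabulate (λ i → lookup X (π ⟨$⟩ˡ i))

  act⁻¹ : Subset n → Subset n
  act⁻¹ X = tabulate (λ i → lookup X (π ⟨$⟩ʳ i))

  act-act⁻¹ : ∀ X → act (act⁻¹ X) ≡ X
  act-act⁻¹ X = lookup-ext λ i → trans (VecP.lookup∘tabulate _ i)
    (trans (VecP.lookup∘tabulate _ (π ⟨$⟩ˡ i)) (cong (lookup X) (Perm.inverseʳ π)))

  act-zipWith : ∀ f X Y → act (Vec.zipWith f X Y) ≡ Vec.zipWith f (act X) (act Y)
  act-zipWith f X Y = lookup-ext λ i → trans (VecP.lookup∘tabulate _ i) (trans (VecP.lookup-zipWith f _ X Y)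
    (sym (trans (VecP.lookup-zipWith f i (act X) (act Y)) (cong₂ f (VecP.lookup∘tabulate _ i) (VecP.lookup∘tabulate _ i)))))

  act-replicate : ∀ b → act (Vec.replicate n b) ≡ Vec.replicate n b
  act-replicate b = lookup-ext λ i → trans (VecP.lookup∘tabulate _ i)
    (trans (VecP.lookup-replicate (π ⟨$⟩ˡ i) b) (sym (VecP.lookup-replicate i b)))

  act-base : ∀ {h : Subset n → ℤ} → BaseFunction h → BaseFunction (h ∘ act)
  act-base {h} B = record
    { submodular = λ X Y → subst₂ (λ U I → h U ℤ.+ h I ℤ.≤ h (act X) ℤ.+ h (act Y))
        (sym (act-zipWith _∨_ X Y)) (sym (act-zipWith _∧_ X Y)) (submodular B (act X) (act Y))
    ; h⊥≡0 = trans (cong h (act-replicate outside)) (h⊥≡0 B)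
    }

  -- The greedy vertex for the order `π 0`, `π 1`, ..., carried back to the original names.
  greedyAlong : (Subset n → ℤ) → Vecℤ n
  greedyAlong h i = greedy (h ∘ act) (π ⟨$⟩ˡ i)

  greedyAlong-ʳ : ∀ h j → greedyAlong h (π ⟨$⟩ʳ j) ≡ greedy (h ∘ act) j
  greedyAlong-ʳ h j = cong (greedy (h ∘ act)) (Perm.inverseˡ π)

  lookup-act⁻¹ : ∀ X j → lookup X (π ⟨$⟩ʳ j) ≡ lookup (act⁻¹ X) j
  lookup-act⁻¹ X j = sym (VecP.lookup∘tabulate (λ i → lookup X (π ⟨$⟩ʳ i)) j)

  greedyAlong-base : ∀ {h : Subset n → ℤ} → BaseFunction h → Baseℤ h (greedyAlong h)
  greedyAlong-base {h} B = le , trans (∑ℤ-permute (greedyAlong h) π)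
    (trans (∑ℤ-cong (greedyAlong-ʳ h))
      (trans (greedy-total (act-base B)) (cong h (act-replicate inside))))
    where
    pull : ∀ X → sumOnℤ (greedyAlong h) X ≡ sumOnℤ (greedy (h ∘ act)) (act⁻¹ X)
    pull X = trans (∑ℤ-permute (λ i → if lookup X i then greedyAlong h i else + 0) π)
      (∑ℤ-cong (λ i → cong₂ (if_then_else + 0) (lookup-act⁻¹ X i) (greedyAlong-ʳ h i)))
    le : ∀ X → sumOnℤ (greedyAlong h) X ℤ.≤ h X
    le X = subst₂ ℤ._≤_ (sym (pull X)) (cong h (act-act⁻¹ X)) (greedy-≤ (act-base B) (act⁻¹ X))

  greedyAlong-optimal : ∀ {h : Subset n → ℤ} → BaseFunction h → (u y : Vecℚ n) →
    Decreasing (λ i → u (π ⟨$⟩ʳ i)) → Baseℚ h y → ⟨ u , y ⟩ ℚ.≤ ⟨ u , ιv (greedyAlong h) ⟩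
  greedyAlong-optimal {h} B u y dec (le , eq) = subst₂ ℚ._≤_ (sym (∑ℚ-permute (λ i → u i ℚ.* y i) π)) (sym unpull)
    (greedy-optimal (act-base B) (λ i → u (π ⟨$⟩ʳ i)) (λ i → y (π ⟨$⟩ʳ i)) dec (le′ , eq′))
    where
    pull : ∀ X → sumOn y (act X) ≡ sumOn (λ i → y (π ⟨$⟩ʳ i)) X
    pull X = trans (∑ℚ-permute (λ i → if lookup (act X) i then y i else 0ℚ) π)
      (∑ℚ-cong (λ i → cong (if_then y (π ⟨$⟩ʳ i) else 0ℚ)
        (trans (VecP.lookup∘tabulate _ (π ⟨$⟩ʳ i)) (cong (lookup X) (Perm.inverseˡ π)))))
    le′ : ∀ X → sumOn (λ i → y (π ⟨$⟩ʳ i)) X ℚ.≤ ι (h (act X))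
    le′ X = subst (ℚ._≤ _) (pull X) (le (act X))
    eq′ : ∑ℚ (λ i → y (π ⟨$⟩ʳ i)) ≡ ι (h (act ⊤))
    eq′ = trans (sym (∑ℚ-permute y π)) (trans eq (cong (ι ∘ h) (sym (act-replicate inside))))
    unpull : ⟨ u , ιv (greedyAlong h) ⟩ ≡ ⟨ (λ i → u (π ⟨$⟩ʳ i)) , ιv (greedy (h ∘ act)) ⟩
    unpull = trans (∑ℚ-permute (λ i → u i ℚ.* ι (greedyAlong h i)) π)
      (∑ℚ-cong (λ i → cong (λ j → u (π ⟨$⟩ʳ i) ℚ.* ι (greedy (h ∘ act) j)) (Perm.inverseˡ π)))

-- The discrete sandwich theorem and integer decomposition

subset-min : ∀ {V : Set} {_≼_ : V → V → Set} → (∀ u v → u ≼ v ⊎ v ≼ u) → (∀ {u v w} → u ≼ v → v ≼ w → u ≼ w) →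
  ∀ {n} (g : Subset n → V) → ∃ λ X → ∀ Y → g X ≼ g Y
subset-min total tr {zero}  g = [] , λ { [] → reflexive (total (g []) (g [])) }
  where
  reflexive : ∀ {A : Set} → A ⊎ A → A
  reflexive (inj₁ a) = a
  reflexive (inj₂ a) = a
subset-min total tr {suc n} g with subset-min total tr (g ∘ (inside ∷_)) | subset-min total tr (g ∘ (outside ∷_))
... | X , minX | Y , minY with total (g (inside ∷ X)) (g (outside ∷ Y))
...   | inj₁ le = inside ∷ X , λ { (inside ∷ Z) → minX Z ; (outside ∷ Z) → tr le (minY Z) }
...   | inj₂ ge = outside ∷ Y , λ { (inside ∷ Z) → tr ge (minX Z) ; (outside ∷ Z) → minY Z }

-- The upper bounds left for the other coordinates once the first one is `m`: a set is bounded
-- directly, and also through its union with the first element.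
fix : ∀ {n} → (Subset (suc n) → ℤ) → ℤ → Subset n → ℤ
fix b m X = b (outside ∷ X) ℤ.⊓ (b (inside ∷ X) ℤ.- m)

-- A minimum of two submodular functions need not be submodular, but here both come from one `b`. In
-- the mixed cases submodularity of `b` puts the first element into the union and leaves it out of
-- the intersection, so one `m` appears on each side.
fix-submodular : ∀ {n} {b : Subset (suc n) → ℤ} → Submodularℤ b → ∀ m → Submodularℤ (fix b m)
fix-submodular {n} {b} sub m X Y
  with ℤP.⊓-sel (b (outside ∷ X)) (b (inside ∷ X) ℤ.- m) | ℤP.⊓-sel (b (outside ∷ Y)) (b (inside ∷ Y) ℤ.- m)
... | inj₁ eX | inj₁ eY rewrite eX | eY =
  ℤP.≤-trans (ℤP.+-mono-≤ (ℤP.i⊓j≤i (b (outside ∷ X ∪ Y)) _) (ℤP.i⊓j≤i (b (outside ∷ X ∩ Y)) _)) (sub (outside ∷ X) (outside ∷ Y))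
... | inj₂ eX | inj₂ eY rewrite eX | eY =
  ℤP.≤-trans (ℤP.+-mono-≤ (ℤP.i⊓j≤j (b (outside ∷ X ∪ Y)) _) (ℤP.i⊓j≤j (b (outside ∷ X ∩ Y)) _))
    (≤-diffℤ _ _ (sub (inside ∷ X) (inside ∷ Y)) (lem (b (inside ∷ X)) (b (inside ∷ Y)) (b (inside ∷ X ∪ Y)) (b (inside ∷ X ∩ Y)) m))
  where
  lem : ∀ x y u i m → x ℤ.+ y ℤ.- (u ℤ.+ i) ≡ (x ℤ.- m ℤ.+ (y ℤ.- m)) ℤ.- (u ℤ.- m ℤ.+ (i ℤ.- m))
  lem = solve-∀
... | inj₁ eX | inj₂ eY rewrite eX | eY =
  ℤP.≤-trans (ℤP.+-mono-≤ (ℤP.i⊓j≤j (b (outside ∷ X ∪ Y)) _) (ℤP.i⊓j≤i _ _))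
    (≤-diffℤ _ _ (sub (outside ∷ X) (inside ∷ Y)) (lem (b (outside ∷ X)) (b (inside ∷ Y)) (b (inside ∷ X ∪ Y)) (b (outside ∷ X ∩ Y)) m))
  where
  lem : ∀ x y u i m → x ℤ.+ y ℤ.- (u ℤ.+ i) ≡ (x ℤ.+ (y ℤ.- m)) ℤ.- (u ℤ.- m ℤ.+ i)
  lem = solve-∀
... | inj₂ eX | inj₁ eY rewrite eX | eY =
  ℤP.≤-trans (ℤP.+-mono-≤ (ℤP.i⊓j≤j (b (outside ∷ X ∪ Y)) _) (ℤP.i⊓j≤i _ _))
    (≤-diffℤ _ _ (sub (inside ∷ X) (outside ∷ Y)) (lem (b (inside ∷ X)) (b (outside ∷ Y)) (b (inside ∷ X ∪ Y)) (b (outside ∷ X ∩ Y)) m))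
  where
  lem : ∀ x y u i m → x ℤ.+ y ℤ.- (u ℤ.+ i) ≡ (x ℤ.- m ℤ.+ y) ℤ.- (u ℤ.- m ℤ.+ i)
  lem = solve-∀

fix-base : ∀ {n} {b : Subset (suc n) → ℤ} → BaseFunction b → ∀ {m} → m ℤ.≤ b (inside ∷ ⊥) → BaseFunction (fix b m)
fix-base {b = b} B {m} le = record
  { submodular = fix-submodular {b = b} (submodular B) m
  ; h⊥≡0 = trans (ℤP.i≤j⇒i⊓j≡i (subst (ℤ._≤ b (inside ∷ ⊥) ℤ.- m) (sym (h⊥≡0 B)) (ℤP.i≤j⇒0≤j-i le))) (h⊥≡0 B)
  }

-- Frank's discrete sandwich theorem for b and the supermodular function − q.  The value m₀ at the first element is
-- chosen so that the two functions obtained by fixing it are still sandwiched.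
sandwich : ∀ {n} {b q : Subset n → ℤ} → BaseFunction b → BaseFunction q → (∀ X → + 0 ℤ.≤ b X ℤ.+ q X) →
  ∃ λ (m : Vecℤ n) → ∀ X → sumOnℤ m X ℤ.≤ b X × ℤ.- sumOnℤ m X ℤ.≤ q X
sandwich {zero}      B Q 0≤b+q = (λ ()) , λ
  { [] → ℤP.≤-reflexive (sym (h⊥≡0 B)) , ℤP.≤-reflexive (sym (h⊥≡0 Q)) }
sandwich {suc n} {b} {q} B Q 0≤b+q with subset-min ℤP.≤-total ℤP.≤-trans (λ Y → b (inside ∷ Y) ℤ.+ q (outside ∷ Y))
... | Y₀ , min = m , λ { (inside ∷ X) → in-b X , in-q X ; (outside ∷ X) → out-b X , out-q X }
  where
  -- The largest value that keeps `b` with the first element above `q` without it. The opposite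
  -- mixed pair gives a lower bound on the value, and `cross` shows by uncrossing, in `b` and in `q`
  -- separately, that `m₀` respects it.
  m₀ = b (inside ∷ Y₀) ℤ.+ q (outside ∷ Y₀)

  cross : ∀ X Y → + 0 ℤ.≤ (b (outside ∷ X) ℤ.+ q (inside ∷ X)) ℤ.+ (b (inside ∷ Y) ℤ.+ q (outside ∷ Y))
  cross X Y = begin
    + 0 ≤⟨ ℤP.+-mono-≤ (0≤b+q (inside ∷ X ∪ Y)) (0≤b+q (outside ∷ X ∩ Y)) ⟩
    (b (inside ∷ X ∪ Y) ℤ.+ q (inside ∷ X ∪ Y)) ℤ.+ (b (outside ∷ X ∩ Y) ℤ.+ q (outside ∷ X ∩ Y))
      ≡⟨ lem₁ (b (inside ∷ X ∪ Y)) (q (inside ∷ X ∪ Y)) (b (outside ∷ X ∩ Y)) (q (outside ∷ X ∩ Y)) ⟩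
    (b (inside ∷ X ∪ Y) ℤ.+ b (outside ∷ X ∩ Y)) ℤ.+ (q (inside ∷ X ∪ Y) ℤ.+ q (outside ∷ X ∩ Y))
      ≤⟨ ℤP.+-mono-≤ (submodular B (outside ∷ X) (inside ∷ Y)) (submodular Q (inside ∷ X) (outside ∷ Y)) ⟩
    (b (outside ∷ X) ℤ.+ b (inside ∷ Y)) ℤ.+ (q (inside ∷ X) ℤ.+ q (outside ∷ Y))
      ≡⟨ lem₁ (b (outside ∷ X)) (b (inside ∷ Y)) (q (inside ∷ X)) (q (outside ∷ Y)) ⟩
    (b (outside ∷ X) ℤ.+ q (inside ∷ X)) ℤ.+ (b (inside ∷ Y) ℤ.+ q (outside ∷ Y)) ∎
    where
    open ℤP.≤-Reasoning
    lem₁ : ∀ a c d e → (a ℤ.+ c) ℤ.+ (d ℤ.+ e) ≡ (a ℤ.+ d) ℤ.+ (c ℤ.+ e)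
    lem₁ = solve-∀

  m₀≤b⊥ : m₀ ℤ.≤ b (inside ∷ ⊥)
  m₀≤b⊥ = subst (m₀ ℤ.≤_) (trans (cong (ℤ._+_ (b (inside ∷ ⊥))) (h⊥≡0 Q)) (ℤP.+-identityʳ _)) (min ⊥)

  -m₀≤q⊥ : ℤ.- m₀ ℤ.≤ q (inside ∷ ⊥)
  -m₀≤q⊥ = ≤-diffℤ _ _ (cross ⊥ Y₀) (trans (cong (λ z → z ℤ.+ q (inside ∷ ⊥) ℤ.+ m₀ ℤ.- + 0) (h⊥≡0 B)) (lem (q (inside ∷ ⊥)) m₀))
    where
    lem : ∀ q m → + 0 ℤ.+ q ℤ.+ m ℤ.- + 0 ≡ q ℤ.- ℤ.- m
    lem = solve-∀

  0≤fixed : ∀ X → + 0 ℤ.≤ fix b m₀ X ℤ.+ fix q (ℤ.- m₀) X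
  0≤fixed X with ℤP.⊓-sel (b (outside ∷ X)) (b (inside ∷ X) ℤ.- m₀) | ℤP.⊓-sel (q (outside ∷ X)) (q (inside ∷ X) ℤ.- ℤ.- m₀)
  ... | inj₁ e | inj₁ e′ rewrite e | e′ = 0≤b+q (outside ∷ X)
  ... | inj₂ e | inj₂ e′ rewrite e | e′ = subst (+ 0 ℤ.≤_) (lem (b (inside ∷ X)) (q (inside ∷ X)) m₀) (0≤b+q (inside ∷ X))
    where
    lem : ∀ b q m → b ℤ.+ q ≡ b ℤ.- m ℤ.+ (q ℤ.- ℤ.- m)
    lem = solve-∀
  ... | inj₁ e | inj₂ e′ rewrite e | e′ = subst (+ 0 ℤ.≤_) (lem (b (outside ∷ X)) (q (inside ∷ X)) m₀) (cross X Y₀)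
    where
    lem : ∀ b q m → b ℤ.+ q ℤ.+ m ≡ b ℤ.+ (q ℤ.- ℤ.- m)
    lem = solve-∀
  ... | inj₂ e | inj₁ e′ rewrite e | e′ = subst (+ 0 ℤ.≤_) (lem (b (inside ∷ X)) (q (outside ∷ X)) m₀) (ℤP.i≤j⇒0≤j-i (min X))
    where
    lem : ∀ b q m → b ℤ.+ q ℤ.- m ≡ b ℤ.- m ℤ.+ q
    lem = solve-∀

  rec = sandwich (fix-base B m₀≤b⊥) (fix-base Q -m₀≤q⊥) 0≤fixed

  m : Vecℤ (suc n)
  m Fin.zero    = m₀
  m (Fin.suc i) = proj₁ rec i

  out-b : ∀ X → + 0 ℤ.+ sumOnℤ (proj₁ rec) X ℤ.≤ b (outside ∷ X)
  out-b X = ℤP.≤-trans (ℤP.≤-reflexive (ℤP.+-identityˡ _)) (ℤP.≤-trans (proj₁ (proj₂ rec X)) (ℤP.i⊓j≤i _ _))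
  out-q : ∀ X → ℤ.- (+ 0 ℤ.+ sumOnℤ (proj₁ rec) X) ℤ.≤ q (outside ∷ X)
  out-q X = ℤP.≤-trans (ℤP.≤-reflexive (cong ℤ.-_ (ℤP.+-identityˡ _))) (ℤP.≤-trans (proj₂ (proj₂ rec X)) (ℤP.i⊓j≤i _ _))
  in-b : ∀ X → m₀ ℤ.+ sumOnℤ (proj₁ rec) X ℤ.≤ b (inside ∷ X)
  in-b X = ≤-diffℤ _ _ (ℤP.≤-trans (proj₁ (proj₂ rec X)) (ℤP.i⊓j≤j (b (outside ∷ X)) _)) (lem (b (inside ∷ X)) m₀ _)
    where
    lem : ∀ b m s → b ℤ.- m ℤ.- s ≡ b ℤ.- (m ℤ.+ s)
    lem = solve-∀
  in-q : ∀ X → ℤ.- (m₀ ℤ.+ sumOnℤ (proj₁ rec) X) ℤ.≤ q (inside ∷ X)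
  in-q X = ≤-diffℤ _ _ (ℤP.≤-trans (proj₂ (proj₂ rec X)) (ℤP.i⊓j≤j (q (outside ∷ X)) _)) (lem (q (inside ∷ X)) m₀ _)
    where
    lem : ∀ q m s → q ℤ.- ℤ.- m ℤ.- ℤ.- s ≡ q ℤ.- ℤ.- (m ℤ.+ s)
    lem = solve-∀

sumOnℤ-⁅⁆ : ∀ {n} (x : Vecℤ n) i → sumOnℤ x ⁅ i ⁆ ≡ x i
sumOnℤ-⁅⁆ {suc n} x Fin.zero    = trans (cong (ℤ._+_ (x Fin.zero)) (sumOnℤ-⊥ (x ∘ Fin.suc))) (ℤP.+-identityʳ _)
sumOnℤ-⁅⁆ {suc n} x (Fin.suc i) = trans (ℤP.+-identityˡ _) (sumOnℤ-⁅⁆ (x ∘ Fin.suc) i)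

∑-base : ∀ {k n} {r : Fin k → Subset n → ℤ} → (∀ α → BaseFunction (r α)) → BaseFunction (λ X → ∑ℤ (λ α → r α X))
∑-base {k} {n} {r} B = record
  { submodular = λ X Y → subst₂ ℤ._≤_ (∑ℤ-+ (λ α → r α (X ∪ Y)) (λ α → r α (X ∩ Y))) (∑ℤ-+ (λ α → r α X) (λ α → r α Y))
      (∑ℤ-mono (λ α → submodular (B α) X Y))
  ; h⊥≡0 = trans (∑ℤ-cong (λ α → h⊥≡0 (B α))) (∑ℤ-zero k)
  }

∑-points : ∀ {k n} {r : Fin k → Subset n → ℤ} (y : Fin k → Vecℤ n) → (∀ α → Baseℤ (r α) (y α)) →
  Baseℤ (λ X → ∑ℤ (λ α → r α X)) (λ i → ∑ℤ (λ α → y α i))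
∑-points {r = r} y b =
  (λ X → subst (ℤ._≤ _) (sym (sumOnℤ-∑ y X)) (∑ℤ-mono (λ α → proj₁ (b α) X))) ,
  trans (∑ℤ-comm (λ i α → y α i)) (∑ℤ-cong (λ α → proj₂ (b α)))

minus-base : ∀ {n} {h : Subset n → ℤ} → BaseFunction h → ∀ x → BaseFunction (λ X → h X ℤ.- sumOnℤ x X)
minus-base {h = h} B x = record
  { submodular = λ X Y → ≤-diffℤ _ _ (submodular B X Y) (trans
      (lem (h X) (h Y) (h (X ∪ Y)) (h (X ∩ Y)) (sumOnℤ x (X ∪ Y)) (sumOnℤ x (X ∩ Y)))
      (trans (cong (λ s → h X ℤ.+ h Y ℤ.- s ℤ.- (h (X ∪ Y) ℤ.- sumOnℤ x (X ∪ Y) ℤ.+ (h (X ∩ Y) ℤ.- sumOnℤ x (X ∩ Y))))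
        (sumOnℤ-modular x X Y))
        (lem′ (h X) (h Y) (sumOnℤ x X) (sumOnℤ x Y) _)))
  ; h⊥≡0 = cong₂ ℤ._-_ (h⊥≡0 B) (sumOnℤ-⊥ x)
  }
  where
  lem : ∀ a b u i su si → a ℤ.+ b ℤ.- (u ℤ.+ i) ≡ a ℤ.+ b ℤ.- (su ℤ.+ si) ℤ.- (u ℤ.- su ℤ.+ (i ℤ.- si))
  lem = solve-∀
  lem′ : ∀ a b s t z → a ℤ.+ b ℤ.- (s ℤ.+ t) ℤ.- z ≡ (a ℤ.- s ℤ.+ (b ℤ.- t)) ℤ.- z
  lem′ = solve-∀

-- `x ≤ r₀ + R` says that the supermodular `x − R` lies below `r₀`, where `R` is the sum of the
-- remaining functions. An integral modular function between the two is a first summand, and what is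
-- left of `x` lies below `R`.
decompose : ∀ {k n} {r : Fin k → Subset n → ℤ} → (∀ α → BaseFunction (r α)) →
  ∀ {x} → Baseℤ (λ X → ∑ℤ (λ α → r α X)) x →
  ∃ λ (y : Fin k → Vecℤ n) → (∀ α → Baseℤ (r α) (y α)) × (∀ i → x i ≡ ∑ℤ (λ α → y α i))
decompose {zero}  {n} B {x} (le , eq) = (λ ()) , (λ ()) , λ i → ℤP.≤-antisym (le′ i) (ge′ i)
  where
  le′ : ∀ i → x i ℤ.≤ + 0
  le′ i = subst (ℤ._≤ + 0) (sumOnℤ-⁅⁆ x i) (le ⁅ i ⁆)
  -- The total is zero, so the bound on the complement of `i` bounds `x i` from below.
  ge′ : ∀ i → + 0 ℤ.≤ x i
  ge′ i = ≤-diffℤ _ _ (le (∁ ⁅ i ⁆)) (trans (lem (sumOnℤ x (∁ ⁅ i ⁆)) (x i))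
    (trans (cong (λ s → x i ℤ.- (s ℤ.+ sumOnℤ x (∁ ⁅ i ⁆))) (sym (sumOnℤ-⁅⁆ x i)))
      (cong (ℤ._-_ (x i)) (trans (sumOnℤ-∁ x ⁅ i ⁆) eq))))
    where
    lem : ∀ s y → + 0 ℤ.- s ≡ y ℤ.- (y ℤ.+ s)
    lem = solve-∀
decompose {suc k} {n} {r} B {x} (le , eq) = y , y-base , y-sum
  where
  R : Subset n → ℤ
  R X = ∑ℤ (λ α → r (Fin.suc α) X)
  split = sandwich (B Fin.zero) (minus-base (∑-base (B ∘ Fin.suc)) x)
    (λ X → subst (+ 0 ℤ.≤_) (lem (r Fin.zero X) (R X) (sumOnℤ x X)) (ℤP.i≤j⇒0≤j-i (le X)))
    where
    lem : ∀ a b c → a ℤ.+ b ℤ.- c ≡ a ℤ.+ (b ℤ.- c)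
    lem = solve-∀
  m = proj₁ split
  x′ : Vecℤ n
  x′ i = x i ℤ.- m i
  le′ : ∀ X → sumOnℤ x′ X ℤ.≤ R X
  le′ X = ≤-diffℤ _ _ (proj₂ (proj₂ split X)) (trans (lem (R X) (sumOnℤ x X) (sumOnℤ m X)) (cong (ℤ._-_ (R X)) (sym (sumOnℤ-- x m X))))
    where
    lem : ∀ a b c → a ℤ.- b ℤ.- ℤ.- c ≡ a ℤ.- (b ℤ.- c)
    lem = solve-∀
  ∑x′ : ∑ℤ x′ ≡ ∑ℤ x ℤ.- ∑ℤ m
  ∑x′ = ∑ℤ-- x m
  m≤ : ∑ℤ m ℤ.≤ r Fin.zero ⊤
  m≤ = subst (ℤ._≤ r Fin.zero ⊤) (sumOnℤ-⊤ m) (proj₁ (proj₂ split ⊤))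
  x′≤ : ∑ℤ x′ ℤ.≤ R ⊤
  x′≤ = subst (ℤ._≤ R ⊤) (sumOnℤ-⊤ x′) (le′ ⊤)
  -- The totals of `m` and `x′` obey one upper bound each and add up to the sum of the two bounds,
  -- so both are attained.
  m≡ : ∑ℤ m ≡ r Fin.zero ⊤
  m≡ = ℤP.≤-antisym m≤ (≤-diffℤ _ _ x′≤ (trans (cong (ℤ._-_ (R ⊤)) ∑x′)
    (trans (cong (λ z → R ⊤ ℤ.- (z ℤ.- ∑ℤ m)) eq) (lem (R ⊤) (r Fin.zero ⊤) (∑ℤ m)))))
    where
    lem : ∀ a b c → a ℤ.- (b ℤ.+ a ℤ.- c) ≡ c ℤ.- b
    lem = solve-∀
  x′≡ : ∑ℤ x′ ≡ R ⊤
  x′≡ = ℤP.≤-antisym x′≤ (≤-diffℤ _ _ m≤ (trans (lem (r Fin.zero ⊤) (∑ℤ m) (R ⊤))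
    (cong (ℤ._- R ⊤) (trans (cong (ℤ._- ∑ℤ m) (sym eq)) (sym ∑x′)))))
    where
    lem : ∀ b c a → b ℤ.- c ≡ b ℤ.+ a ℤ.- c ℤ.- a
    lem = solve-∀
  rest = decompose (B ∘ Fin.suc) {x′} (le′ , x′≡)
  y : Fin (suc k) → Vecℤ n
  y Fin.zero    = m
  y (Fin.suc α) = proj₁ rest α
  y-base : ∀ α → Baseℤ (r α) (y α)
  y-base Fin.zero    = (λ X → proj₁ (proj₂ split X)) , m≡
  y-base (Fin.suc α) = proj₁ (proj₂ rest) α
  y-sum : ∀ i → x i ≡ ∑ℤ (λ α → y α i)
  y-sum i = trans (lem (x i) (m i)) (cong (ℤ._+_ (m i)) (proj₂ (proj₂ rest) i))
    where
    lem : ∀ a b → a ≡ b ℤ.+ (a ℤ.- b)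
    lem = solve-∀

∩-distribʳ-∩ : ∀ {n} (X Z W : Subset n) → (Z ∩ W) ∩ X ≡ (Z ∩ X) ∩ (W ∩ X)
∩-distribʳ-∩ [] [] [] = refl
∩-distribʳ-∩ (a ∷ X) (b ∷ Z) (c ∷ W) = cong₂ _∷_ (bool a b c) (∩-distribʳ-∩ X Z W)
  where
  bool : ∀ a b c → (b ∧ c) ∧ a ≡ (b ∧ a) ∧ (c ∧ a)
  bool true  true  c     = refl
  bool true  false c     = refl
  bool false true  true  = refl
  bool false true  false = refl
  bool false false c     = refl

∪-distribʳ-∪ : ∀ {n} (X Z W : Subset n) → (Z ∪ W) ∪ X ≡ (Z ∪ X) ∪ (W ∪ X)
∪-distribʳ-∪ [] [] [] = refl
∪-distribʳ-∪ (a ∷ X) (b ∷ Z) (c ∷ W) = cong₂ _∷_ (bool a b c) (∪-distribʳ-∪ X Z W)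
  where
  bool : ∀ a b c → (b ∨ c) ∨ a ≡ (b ∨ a) ∨ (c ∨ a)
  bool a     true  c     = refl
  bool true  false true  = refl
  bool true  false false = refl
  bool false false c     = refl

-- The direct sum of the restriction to X and the contraction of X describes the face of the base polyhedron on which X is tight.
tight-point : ∀ {n} {r : Subset n → ℤ} → BaseFunction r → ∀ X → ∃ λ v → Baseℤ r v × sumOnℤ v X ≡ r X
tight-point {n} {r} B X = v , v∈ , ℤP.≤-antisym (proj₁ v∈ X) ge
  where
  r′ : Subset n → ℤ
  r′ Z = r (Z ∩ X) ℤ.+ r (Z ∪ X) ℤ.- r X
  r′-submodular : Submodularℤ r′
  r′-submodular Z W = ≤-diffℤ _ _
    (ℤP.+-mono-≤ (submodular B (Z ∩ X) (W ∩ X)) (submodular B (Z ∪ X) (W ∪ X)))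
    (trans (cong₂ (λ a b → r (Z ∩ X) ℤ.+ r (W ∩ X) ℤ.+ (r (Z ∪ X) ℤ.+ r (W ∪ X)) ℤ.- (a ℤ.+ b))
      (cong₂ (λ S T → r S ℤ.+ r T) (sym (SubP.∩-distribʳ-∪ X Z W)) (sym (∩-distribʳ-∩ X Z W)))
      (cong₂ (λ S T → r S ℤ.+ r T) (sym (∪-distribʳ-∪ X Z W)) (sym (SubP.∪-distribʳ-∩ X Z W))))
      (lem (r (Z ∩ X)) (r (W ∩ X)) (r (Z ∪ X)) (r (W ∪ X)) (r ((Z ∪ W) ∩ X)) (r ((Z ∩ W) ∩ X)) (r ((Z ∪ W) ∪ X)) (r ((Z ∩ W) ∪ X)) (r X)))
    where
    lem : ∀ a b c d e f g h x → a ℤ.+ b ℤ.+ (c ℤ.+ d) ℤ.- (e ℤ.+ f ℤ.+ (g ℤ.+ h))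
      ≡ a ℤ.+ c ℤ.- x ℤ.+ (b ℤ.+ d ℤ.- x) ℤ.- (e ℤ.+ g ℤ.- x ℤ.+ (f ℤ.+ h ℤ.- x))
    lem = solve-∀
  cancel : ∀ a x → a ℤ.+ x ℤ.- x ≡ a
  cancel = solve-∀
  cancel′ : ∀ a x → x ℤ.+ a ℤ.- x ≡ a
  cancel′ = solve-∀
  B′ : BaseFunction r′
  B′ = record
    { submodular = r′-submodular
    ; h⊥≡0 = trans (cong₂ (λ S T → r S ℤ.+ r T ℤ.- r X) (SubP.∩-zeroˡ X) (SubP.∪-identityˡ X))
        (trans (cancel (r ⊥) (r X)) (h⊥≡0 B))
    }
  v = greedy r′
  v∈ : Baseℤ r v
  v∈ = (λ Z → ℤP.≤-trans (greedy-≤ B′ Z) (≤-diffℤ _ _ (submodular B Z X) (lem (r Z) (r X) (r (Z ∪ X)) (r (Z ∩ X))))) ,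
    trans (greedy-total B′) (trans (cong₂ (λ S T → r S ℤ.+ r T ℤ.- r X) (SubP.∩-identityˡ X) (SubP.∪-zeroˡ X)) (cancel′ (r ⊤) (r X)))
    where
    lem : ∀ z x u i → z ℤ.+ x ℤ.- (u ℤ.+ i) ≡ z ℤ.- (i ℤ.+ u ℤ.- x)
    lem = solve-∀
  r′∁X : r′ (∁ X) ≡ r ⊤ ℤ.- r X
  r′∁X = trans (cong₂ (λ S T → r S ℤ.+ r T ℤ.- r X) (SubP.∩-inverseˡ X) (SubP.∪-inverseˡ X))
    (trans (cong (λ z → z ℤ.+ r ⊤ ℤ.- r X) (h⊥≡0 B)) (cong (ℤ._- r X) (ℤP.+-identityˡ (r ⊤))))
  -- `r′` allows at most `r ⊤ − r X` outside `X`, so at least `r X` of the total remains on `X`.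
  ge : r X ℤ.≤ sumOnℤ v X
  ge = ≤-diffℤ _ _ (greedy-≤ B′ (∁ X)) (trans (cong (ℤ._- sumOnℤ v (∁ X)) r′∁X)
    (trans (lem (r ⊤) (r X) (sumOnℤ v X) (sumOnℤ v (∁ X)))
      (trans (cong (λ z → r ⊤ ℤ.- z ℤ.+ (sumOnℤ v X ℤ.- r X)) (trans (sumOnℤ-∁ v X) (proj₂ v∈))) (lem′ (r ⊤) _))))
    where
    lem : ∀ t x a b → t ℤ.- x ℤ.- b ≡ t ℤ.- (a ℤ.+ b) ℤ.+ (a ℤ.- x)
    lem = solve-∀
    lem′ : ∀ t z → t ℤ.- t ℤ.+ z ≡ z
    lem′ = solve-∀

-- Rank functions

-- `A` is the family of bases of a matroid and `r` its rank function, expressed through the integral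
-- points of the base polyhedron.
record IsRank {n} (A : Pred (Subset n) 0ℓ) (r : Subset n → ℤ) : Set where
  field
    isBase   : BaseFunction r
    sound    : ∀ {x} → Baseℤ r x → ∃ λ Y → A Y × (∀ i → x i ≡ χ Y i)
    complete : ∀ {Y} → A Y → Baseℤ r (χ Y)

open IsRank

-- `tight-point` attains `r X` at a member of `A`, so `r X` is the largest intersection of a member
-- with `X` and depends on `A` alone. This identifies rank functions that were obtained from
-- different slopes.
rank-≤ : ∀ {n} {A : Pred (Subset n) 0ℓ} {r r′} → IsRank A r → IsRank A r′ → ∀ X → r X ℤ.≤ r′ X
rank-≤ R R′ X with tight-point (isBase R) X
... | v , v∈ , eq with sound R v∈
...   | Y , AY , v≗χ = subst (ℤ._≤ _) (trans (sym (sumOnℤ-cong v≗χ X)) eq) (proj₁ (complete R′ AY) X)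

rank-unique : ∀ {n} {A : Pred (Subset n) 0ℓ} {r r′} → IsRank A r → IsRank A r′ → ∀ X → r X ≡ r′ X
rank-unique R R′ X = ℤP.≤-antisym (rank-≤ R R′ X) (rank-≤ R′ R X)

-- Marginal values of `h` are at most those of `k`. For rank functions: the matroid of `h` is a
-- quotient of the matroid of `k`.
Nested : ∀ {n} → (Subset n → ℤ) → (Subset n → ℤ) → Set
Nested h k = ∀ X Z → h (X ∪ Z) ℤ.- h X ℤ.≤ k (X ∪ Z) ℤ.- k X

-- Each coordinate of a greedy vertex is a marginal value over an initial segment.
greedy-nested : ∀ {n} {h k : Subset n → ℤ} → BaseFunction h → BaseFunction k → Nested h k → ∀ i → greedy h i ℤ.≤ greedy k i
greedy-nested {suc n} {h} {k} H K nest Fin.zero = subst₂ ℤ._≤_ (simp h (h⊥≡0 H)) (simp k (h⊥≡0 K)) (nest ⊥ (inside ∷ ⊥))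
  where
  simp : ∀ (g : Subset (suc n) → ℤ) → g ⊥ ≡ + 0 → g (⊥ ∪ (inside ∷ ⊥)) ℤ.- g ⊥ ≡ g (inside ∷ ⊥)
  simp g e = trans (cong₂ ℤ._-_ (cong g (SubP.∪-identityˡ (inside ∷ ⊥))) e) (ℤP.+-identityʳ _)
greedy-nested {suc n} {h} {k} H K nest (Fin.suc i) = greedy-nested (contract-base H) (contract-base K)
  (λ X Z → subst₂ ℤ._≤_ (lem (h (inside ∷ X ∪ Z)) (h (inside ∷ X)) (h (inside ∷ ⊥))) (lem (k (inside ∷ X ∪ Z)) (k (inside ∷ X)) (k (inside ∷ ⊥)))
    (nest (inside ∷ X) (outside ∷ Z))) i
  where
  lem : ∀ a b c → a ℤ.- b ≡ a ℤ.- c ℤ.- (b ℤ.- c)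
  lem = solve-∀

greedyAlong-nested : ∀ {n} (π : Permutation n n) {h k : Subset n → ℤ} → BaseFunction h → BaseFunction k →
  Nested h k → ∀ i → greedyAlong π h i ℤ.≤ greedyAlong π k i
greedyAlong-nested π {h} {k} H K nest i = greedy-nested (act-base π H) (act-base π K)
  (λ X Z → subst (λ S → h S ℤ.- h (act π X) ℤ.≤ k S ℤ.- k (act π X)) (sym (act-zipWith π _∨_ X Z)) (nest (act π X) (act π Z)))
  (π ⟨$⟩ˡ i)

greedy-cong : ∀ {n} {h k : Subset n → ℤ} → (∀ X → h X ≡ k X) → ∀ i → greedy h i ≡ greedy k i
greedy-cong e Fin.zero    = e (inside ∷ ⊥)
greedy-cong e (Fin.suc i) = greedy-cong (λ X → cong₂ ℤ._-_ (e (inside ∷ X)) (e (inside ∷ ⊥))) i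

-- For a fixed order the greedy vertex is linear in the function, so the vertex of a sum of rank
-- functions is the sum of their vertices.
greedy-∑ : ∀ {k n} (r : Fin k → Subset n → ℤ) i → greedy (λ X → ∑ℤ (λ α → r α X)) i ≡ ∑ℤ (λ α → greedy (r α) i)
greedy-∑ r Fin.zero    = refl
greedy-∑ r (Fin.suc i) = trans
  (greedy-cong (λ X → sym (∑ℤ-- (λ α → r α (inside ∷ X)) (λ α → r α (inside ∷ ⊥)))) i)
  (greedy-∑ (λ α → contract (r α)) i)

-- Base polyhedra as integral generalized polymatroids

─-∁ : ∀ {n} (X Y : Subset n) → X ∩ ∁ Y ≡ X ─ Y
─-∁ []            []            = refl
─-∁ (true  ∷ X) (true  ∷ Y) = cong (false ∷_) (─-∁ X Y)
─-∁ (true  ∷ X) (false ∷ Y) = cong (true ∷_) (─-∁ X Y)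
─-∁ (false ∷ X) (true  ∷ Y) = cong (false ∷_) (─-∁ X Y)
─-∁ (false ∷ X) (false ∷ Y) = cong (false ∷_) (─-∁ X Y)

∁-─ : ∀ {n} (X Y : Subset n) → X ∪ ∁ Y ≡ ∁ (Y ─ X)
∁-─ []            []            = refl
∁-─ (true  ∷ X) (true  ∷ Y) = cong (true ∷_) (∁-─ X Y)
∁-─ (true  ∷ X) (false ∷ Y) = cong (true ∷_) (∁-─ X Y)
∁-─ (false ∷ X) (true  ∷ Y) = cong (false ∷_) (∁-─ X Y)
∁-─ (false ∷ X) (false ∷ Y) = cong (true ∷_) (∁-─ X Y)

∁-∪ : ∀ {n} (X Y : Subset n) → ∁ (X ∪ Y) ≡ ∁ X ∩ ∁ Y
∁-∪ []          []      = refl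
∁-∪ (true  ∷ X) (b ∷ Y) = cong (false ∷_) (∁-∪ X Y)
∁-∪ (false ∷ X) (b ∷ Y) = cong (not b ∷_) (∁-∪ X Y)

∁-∩ : ∀ {n} (X Y : Subset n) → ∁ (X ∩ Y) ≡ ∁ X ∪ ∁ Y
∁-∩ []          []      = refl
∁-∩ (true  ∷ X) (b ∷ Y) = cong (not b ∷_) (∁-∩ X Y)
∁-∩ (false ∷ X) (b ∷ Y) = cong (true ∷_) (∁-∩ X Y)

∁-⊥ : ∀ n → ∁ {n} ⊥ ≡ ⊤
∁-⊥ zero    = refl
∁-⊥ (suc n) = cong (true ∷_) (∁-⊥ n)

∁-involutive : ∀ {n} (X : Subset n) → ∁ (∁ X) ≡ X
∁-involutive []          = refl
∁-involutive (true  ∷ X) = cong (true ∷_) (∁-involutive X)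
∁-involutive (false ∷ X) = cong (false ∷_) (∁-involutive X)

module _ {n} {h : Subset n → ℤ} (B : BaseFunction h) where

  private
    -- The lower bound that the fixed total forces on a set through its complement. At `⊤` it equals
    -- `h ⊤`, so the two bounds together give back the fixed total.
    lower : Subset n → ℤ
    lower X = h ⊤ ℤ.- h (∁ X)

  base-polymatroid : ∀ {P} → P ≐ Baseℚ h → IsIntGPolymatroid P
  base-polymatroid {P} P≐B = (ι ∘ h) , (ι ∘ lower) ,
    ((λ X Y → subst₂ ℚ._≤_ (ι-+ (h (X ∪ Y)) (h (X ∩ Y))) (ι-+ (h X) (h Y)) (ι-mono (submodular B X Y))) ,
     (λ X Y → subst₂ ℚ._≤_ (ι-+ (lower X) (lower Y)) (ι-+ (lower (X ∪ Y)) (lower (X ∩ Y))) (ι-mono (super X Y))) ,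
     cong ι (h⊥≡0 B) , cong ι lower⊥ ,
     (λ X Y → subst₂ ℚ._≤_ (ι-- (h (X ─ Y)) (lower (Y ─ X))) (ι-- (h X) (lower Y)) (ι-mono (cross X Y))) ,
     λ x → to x , from x) ,
    λ X → (h X , refl) , (lower X , refl)
    where
    lower⊥ : lower ⊥ ≡ + 0
    lower⊥ = trans (cong (λ S → h ⊤ ℤ.- h S) (∁-⊥ n)) (ℤP.+-inverseʳ (h ⊤))
    super : ∀ X Y → lower X ℤ.+ lower Y ℤ.≤ lower (X ∪ Y) ℤ.+ lower (X ∩ Y)
    super X Y = ≤-diffℤ _ _ (submodular B (∁ X) (∁ Y)) (trans
      (cong₂ (λ S T → h (∁ X) ℤ.+ h (∁ Y) ℤ.- (h S ℤ.+ h T)) (sym (∁-∩ X Y)) (sym (∁-∪ X Y)))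
      (lem (h (∁ X)) (h (∁ Y)) (h (∁ (X ∩ Y))) (h (∁ (X ∪ Y))) (h ⊤)))
      where
      lem : ∀ a b u i t → a ℤ.+ b ℤ.- (u ℤ.+ i) ≡ (t ℤ.- i ℤ.+ (t ℤ.- u)) ℤ.- (t ℤ.- a ℤ.+ (t ℤ.- b))
      lem = solve-∀
    cross : ∀ X Y → h (X ─ Y) ℤ.- lower (Y ─ X) ℤ.≤ h X ℤ.- lower Y
    cross X Y = ≤-diffℤ _ _ (submodular B X (∁ Y)) (trans
      (cong₂ (λ S T → h X ℤ.+ h (∁ Y) ℤ.- (h S ℤ.+ h T)) (∁-─ X Y) (─-∁ X Y))
      (lem (h X) (h (∁ Y)) (h (∁ (Y ─ X))) (h (X ─ Y)) (h ⊤)))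
      where
      lem : ∀ a b u i t → a ℤ.+ b ℤ.- (u ℤ.+ i) ≡ a ℤ.- (t ℤ.- b) ℤ.- (i ℤ.- (t ℤ.- u))
      lem = solve-∀
    to : ∀ x → P x → ∀ X → ι (lower X) ℚ.≤ sumOn x X × sumOn x X ℚ.≤ ι (h X)
    to x Px X with proj₁ (P≐B x) Px
    ... | le , eq = ≤-diffℚ _ _ (le (∁ X)) (begin
      ι (h (∁ X)) ℚ.- sumOn x (∁ X)
        ≡⟨ solve 3 (λ c s z → c :- z := s :- ((s :+ z) :- c)) refl (ι (h (∁ X))) (sumOn x X) (sumOn x (∁ X)) ⟩
      sumOn x X ℚ.- ((sumOn x X ℚ.+ sumOn x (∁ X)) ℚ.- ι (h (∁ X)))
        ≡⟨ cong (λ z → sumOn x X ℚ.- (z ℚ.- ι (h (∁ X)))) (trans (sumOn-∁ x X) eq) ⟩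
      sumOn x X ℚ.- (ι (h ⊤) ℚ.- ι (h (∁ X)))
        ≡⟨ cong (ℚ._-_ (sumOn x X)) (ι-- (h ⊤) (h (∁ X))) ⟨
      sumOn x X ℚ.- ι (lower X) ∎) , le X
      where open ≡-Reasoning
    from : ∀ x → (∀ X → ι (lower X) ℚ.≤ sumOn x X × sumOn x X ℚ.≤ ι (h X)) → P x
    from x le = proj₂ (P≐B x) ((λ X → proj₂ (le X)) ,
      trans (sym (sumOn-⊤ x)) (ℚP.≤-antisym (proj₂ (le ⊤)) (subst (ℚ._≤ sumOn x ⊤) (cong ι lower⊤) (proj₁ (le ⊤)))))
      where
      lower⊤ : lower ⊤ ≡ h ⊤
      lower⊤ = trans (cong (λ S → h ⊤ ℤ.- h S) (trans (cong ∁ (sym (∁-⊥ n))) (∁-involutive ⊥)))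
        (trans (cong (ℤ._-_ (h ⊤)) (h⊥≡0 B)) (ℤP.+-identityʳ _))

  base-basePolyhedron : ∀ {P} → P ≐ Baseℚ h → IsBasePolyhedron P
  base-basePolyhedron {P} P≐B = (proj₁ G , proj₁ (proj₂ G) , proj₁ (proj₂ (proj₂ G))) ,
    ι (h ⊤) , λ x Px → proj₂ (proj₁ (P≐B x) Px)
    where
    G : IsIntGPolymatroid P
    G = base-polymatroid P≐B

sumOn-⁅⁆ : ∀ {n} (x : Vecℚ n) i → sumOn x ⁅ i ⁆ ≡ x i
sumOn-⁅⁆ {suc n} x Fin.zero    = trans (cong (x Fin.zero ℚ.+_) (sumOn-⊥ (x ∘ Fin.suc))) (ℚP.+-identityʳ _)
sumOn-⁅⁆ {suc n} x (Fin.suc i) = trans (ℚP.+-identityˡ _) (sumOn-⁅⁆ (x ∘ Fin.suc) i)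

-- Finitely generated cones are polyhedral

-- The coefficients are quantified one after the other, each multiple being subtracted from the
-- point, so that passing from `r ∷ G` to `G` is the elimination of a single variable.
InCone : ∀ {m} → List (Vecℚ m) → Pred (Vecℚ m) 0ℓ
InCone []      x = ∀ i → x i ≡ 0ℚ
InCone (r ∷ G) x = Σ ℚ λ μ → 0ℚ ℚ.≤ μ × InCone G (λ i → x i ℚ.- μ ℚ.* r i)

Satisfies : ∀ {m} → List (Vecℚ m) → Pred (Vecℚ m) 0ℓ
Satisfies C x = ∀ {c} → c ∈ C → ⟨ c , x ⟩ ℚ.≤ 0ℚ

⟨,⟩-subʳ : ∀ {m} (c x r : Vecℚ m) μ → ⟨ c , (λ i → x i ℚ.- μ ℚ.* r i) ⟩ ≡ ⟨ c , x ⟩ ℚ.- μ ℚ.* ⟨ c , r ⟩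
⟨,⟩-subʳ c x r μ = begin
  ⟨ c , (λ i → x i ℚ.- μ ℚ.* r i) ⟩               ≡⟨ ⟨,⟩-congʳ c (λ i → cong (ℚ._+_ (x i)) (ℚP.neg-distribˡ-* μ (r i))) ⟩
  ⟨ c , (λ i → x i ℚ.+ (ℚ.- μ) ℚ.* r i) ⟩         ≡⟨ ⟨,⟩-+ʳ c x (λ i → (ℚ.- μ) ℚ.* r i) ⟩
  ⟨ c , x ⟩ ℚ.+ ⟨ c , (λ i → (ℚ.- μ) ℚ.* r i) ⟩   ≡⟨ cong (ℚ._+_ ⟨ c , x ⟩) (⟨,⟩-*ʳ (ℚ.- μ) c r) ⟩
  ⟨ c , x ⟩ ℚ.+ (ℚ.- μ) ℚ.* ⟨ c , r ⟩             ≡⟨ cong (ℚ._+_ ⟨ c , x ⟩) (ℚP.neg-distribˡ-* μ ⟨ c , r ⟩) ⟨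
  ⟨ c , x ⟩ ℚ.- μ ℚ.* ⟨ c , r ⟩                   ∎
  where open ≡-Reasoning

-- One Fourier–Motzkin step, eliminating μ from the conditions  a c ≤ μ * b c  and 0 ≤ μ.
module FourierMotzkin {I : Set} (a b : I → ℚ) where

  combine : I → I → ℚ
  combine j k = b j ℚ.* a k ℚ.- b k ℚ.* a j

  -- The witness is the maximum of 0 and the ratios `a j / b j` over `P`. The bounds from `N` hold
  -- for 0 by `aN` and for each ratio by the combined conditions.
  eliminate : ∀ (P N : List I) → (∀ {j} → j ∈ P → 0ℚ ℚ.< b j) → (∀ {k} → k ∈ N → b k ℚ.≤ 0ℚ) →
    (∀ {k} → k ∈ N → a k ℚ.≤ 0ℚ) → (∀ {j k} → j ∈ P → k ∈ N → combine j k ℚ.≤ 0ℚ) →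
    Σ ℚ λ μ → 0ℚ ℚ.≤ μ × (∀ {j} → j ∈ P → a j ℚ.≤ μ ℚ.* b j) × (∀ {k} → k ∈ N → a k ℚ.≤ μ ℚ.* b k)
  eliminate []      N pos neg aN comb = 0ℚ , ℚP.≤-refl , (λ ()) , λ {k} k∈N → subst (a k ℚ.≤_) (sym (ℚP.*-zeroˡ (b k))) (aN k∈N)
  eliminate (j ∷ P) N pos neg aN comb with eliminate P N (pos ∘ there) neg aN (λ i∈P → comb (there i∈P))
  ... | μ , 0≤μ , onP , onN with a j ℚP.≤? μ ℚ.* b j
  ...   | yes le = μ , 0≤μ , (λ { (here refl) → le ; (there i∈P) → onP i∈P }) , onN
  ...   | no ¬le = μ′ , ℚP.≤-trans 0≤μ μ≤μ′ ,
          (λ { (here refl) → ℚP.≤-reflexive (sym μ′b) ; {i} (there i∈P) → ℚP.≤-trans (onP i∈P)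
            (ℚP.*-monoʳ-≤-nonNeg (b i) {{ℚ.nonNegative (ℚP.<⇒≤ (pos (there i∈P)))}} μ≤μ′) }) , onN′
    where
    bj>0 : 0ℚ ℚ.< b j
    bj>0 = pos (here refl)
    instance
      b-pos : ℚ.Positive (b j)
      b-pos = ℚ.positive bj>0
      b-nonZero : ℚ.NonZero (b j)
      b-nonZero = ℚP.pos⇒nonZero (b j)
    μ′ : ℚ
    μ′ = a j ℚ.* ℚ.1/ (b j)
    μ′b : μ′ ℚ.* b j ≡ a j
    μ′b = trans (ℚP.*-assoc (a j) (ℚ.1/ (b j)) (b j)) (trans (cong (a j ℚ.*_) (ℚP.*-inverseˡ (b j))) (ℚP.*-identityʳ (a j)))
    μ≤μ′ : μ ℚ.≤ μ′
    μ≤μ′ = ℚP.*-cancelʳ-≤-pos (b j) (subst (μ ℚ.* b j ℚ.≤_) (sym μ′b) (ℚP.<⇒≤ (ℚP.≰⇒> ¬le)))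
    onN′ : ∀ {k} → k ∈ N → a k ℚ.≤ μ′ ℚ.* b k
    onN′ {k} k∈N = ℚP.*-cancelˡ-≤-pos (b j) (≤-diffℚ _ _ (comb (here refl) k∈N) (begin
      0ℚ ℚ.- (b j ℚ.* a k ℚ.- b k ℚ.* a j)              ≡⟨ cong (λ z → 0ℚ ℚ.- (b j ℚ.* a k ℚ.- b k ℚ.* z)) μ′b ⟨
      0ℚ ℚ.- (b j ℚ.* a k ℚ.- b k ℚ.* (μ′ ℚ.* b j))     ≡⟨ solve 4 (λ β α κ m → con 0ℚ :- (β :* α :- κ :* (m :* β)) := β :* (m :* κ) :- β :* α) refl (b j) (a k) (b k) μ′ ⟩
      b j ℚ.* (μ′ ℚ.* b k) ℚ.- b j ℚ.* a k              ∎))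
      where open ≡-Reasoning

-- `x` lies in the larger cone if some `μ ≥ 0` satisfies `⟨ c , x ⟩ ≤ μ * ⟨ c , r ⟩` for all
-- inequalities `c` of the smaller cone. Eliminating `μ` keeps those that are nonpositive on `r` and
-- pairs them with the positive ones.
minkowski-weyl : ∀ {m} (G : List (Vecℚ m)) → ∃ λ C → ∀ x → (InCone G x → Satisfies C x) × (Satisfies C x → InCone G x)
minkowski-weyl {m} [] = C , λ x → to x , from x
  where
  e : Fin m → Vecℚ m
  e i = ιv (χ ⁅ i ⁆)
  ⟨e,⟩ : ∀ i x → ⟨ e i , x ⟩ ≡ x i
  ⟨e,⟩ i x = trans (sym (sumOn-⟨,⟩ x ⁅ i ⁆)) (sumOn-⁅⁆ x i)
  ⟨-e,⟩ : ∀ i x → ⟨ (λ j → ℚ.- e i j) , x ⟩ ≡ ℚ.- x i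
  ⟨-e,⟩ i x = trans (⟨,⟩-negˡ (e i) x) (cong ℚ.-_ (⟨e,⟩ i x))
  C : List (Vecℚ m)
  C = List.tabulate e ++ List.tabulate (λ i j → ℚ.- e i j)
  to : ∀ x → InCone [] x → Satisfies C x
  to x x≡0 = All.lookup {P = λ c → ⟨ c , x ⟩ ℚ.≤ 0ℚ} (AllP.++⁺
    (AllP.tabulate⁺ (λ i → ℚP.≤-reflexive (trans (⟨e,⟩ i x) (x≡0 i))))
    (AllP.tabulate⁺ (λ i → ℚP.≤-reflexive (trans (⟨-e,⟩ i x) (cong ℚ.-_ (x≡0 i))))))
  from : ∀ x → Satisfies C x → InCone [] x
  from x sat i = ℚP.≤-antisym (subst (ℚ._≤ 0ℚ) (⟨e,⟩ i x) (AllP.tabulate⁻ (AllP.++⁻ˡ (List.tabulate e) (All.tabulate sat)) i))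
    (≤-diffℚ _ _ (subst (ℚ._≤ 0ℚ) (⟨-e,⟩ i x) (AllP.tabulate⁻ (AllP.++⁻ʳ (List.tabulate e) (All.tabulate sat)) i))
      (solve 1 (λ z → con 0ℚ :- (:- z) := z :- con 0ℚ) refl (x i)))
minkowski-weyl {m} (r ∷ G) with minkowski-weyl G
... | C , equiv = N ++ cartesianProductWith comb P N , λ x → to x , from x
  where
  b : Vecℚ m → ℚ
  b c = ⟨ c , r ⟩
  N P : List (Vecℚ m)
  N = filter (λ c → b c ℚP.≤? 0ℚ) C
  P = filter (λ c → 0ℚ ℚP.<? b c) C
  -- The nonnegative combination of `j` and `k` that vanishes on `r`.
  comb : Vecℚ m → Vecℚ m → Vecℚ m
  comb j k i = b j ℚ.* k i ℚ.+ (ℚ.- b k) ℚ.* j i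
  ⟨comb,⟩ : ∀ j k x → ⟨ comb j k , x ⟩ ≡ b j ℚ.* ⟨ k , x ⟩ ℚ.- b k ℚ.* ⟨ j , x ⟩
  ⟨comb,⟩ j k x = trans (⟨,⟩-+ˡ (λ i → b j ℚ.* k i) (λ i → (ℚ.- b k) ℚ.* j i) x)
    (trans (cong₂ ℚ._+_ (⟨,⟩-*ˡ (b j) k x) (⟨,⟩-*ˡ (ℚ.- b k) j x))
      (cong (ℚ._+_ (b j ℚ.* ⟨ k , x ⟩)) (sym (ℚP.neg-distribˡ-* (b k) ⟨ j , x ⟩))))
  N⁻ : ∀ {k} → k ∈ N → k ∈ C × b k ℚ.≤ 0ℚ
  N⁻ = ∈-filter⁻ (λ c → b c ℚP.≤? 0ℚ) {xs = C}
  P⁻ : ∀ {j} → j ∈ P → j ∈ C × 0ℚ ℚ.< b j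
  P⁻ = ∈-filter⁻ (λ c → 0ℚ ℚP.<? b c) {xs = C}
  to : ∀ x → InCone (r ∷ G) x → Satisfies (N ++ cartesianProductWith comb P N) x
  to x (μ , 0≤μ , inG) {c} c∈ = cases (∈-++⁻ N c∈)
    where
    bound : ∀ {c} → c ∈ C → ⟨ c , x ⟩ ℚ.≤ μ ℚ.* b c
    bound {c} c∈C = ≤-diffℚ _ _ (subst (ℚ._≤ 0ℚ) (⟨,⟩-subʳ c x r μ) (proj₁ (equiv _) inG c∈C))
      (solve 2 (λ a z → con 0ℚ :- (a :- z) := z :- a) refl ⟨ c , x ⟩ (μ ℚ.* b c))
    cases : c ∈ N ⊎ c ∈ cartesianProductWith comb P N → ⟨ c , x ⟩ ℚ.≤ 0ℚ
    cases (inj₁ c∈N) = ℚP.≤-trans (bound (proj₁ (N⁻ c∈N)))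
      (subst (μ ℚ.* b c ℚ.≤_) (ℚP.*-zeroʳ μ) (*-monoˡ-≤ 0≤μ (proj₂ (N⁻ c∈N))))
    cases (inj₂ c∈PN) with ∈-cartesianProductWith⁻ comb P N c∈PN
    ... | j , k , j∈P , k∈N , refl = subst (ℚ._≤ 0ℚ) (sym (⟨comb,⟩ j k x)) (begin
      b j ℚ.* ⟨ k , x ⟩ ℚ.- b k ℚ.* ⟨ j , x ⟩
        ≡⟨ solve 4 (λ β α κ γ → β :* α :- κ :* γ := β :* α :+ (:- κ) :* γ) refl (b j) ⟨ k , x ⟩ (b k) ⟨ j , x ⟩ ⟩
      b j ℚ.* ⟨ k , x ⟩ ℚ.+ (ℚ.- b k) ℚ.* ⟨ j , x ⟩
        ≤⟨ ℚP.+-mono-≤ (*-monoˡ-≤ (ℚP.<⇒≤ (proj₂ (P⁻ j∈P))) (bound (proj₁ (N⁻ k∈N))))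
             (*-monoˡ-≤ (ℚP.neg-antimono-≤ (proj₂ (N⁻ k∈N))) (bound (proj₁ (P⁻ j∈P)))) ⟩
      b j ℚ.* (μ ℚ.* b k) ℚ.+ (ℚ.- b k) ℚ.* (μ ℚ.* b j)
        ≡⟨ solve 3 (λ β κ m → β :* (m :* κ) :+ (:- κ) :* (m :* β) := con 0ℚ) refl (b j) (b k) μ ⟩
      0ℚ ∎)
      where open ℚP.≤-Reasoning
  from : ∀ x → Satisfies (N ++ cartesianProductWith comb P N) x → InCone (r ∷ G) x
  from x sat with eliminate P N (λ j∈P → proj₂ (P⁻ j∈P)) (λ k∈N → proj₂ (N⁻ k∈N)) (λ k∈N → sat (∈-++⁺ˡ k∈N))
      (λ {j} {k} j∈P k∈N → subst (ℚ._≤ 0ℚ) (⟨comb,⟩ j k x) (sat (∈-++⁺ʳ N (∈-cartesianProductWith⁺ comb j∈P k∈N))))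
    where open FourierMotzkin (λ c → ⟨ c , x ⟩) b
  ... | μ , 0≤μ , onP , onN = μ , 0≤μ , proj₂ (equiv _) λ {c} c∈C → subst (ℚ._≤ 0ℚ) (sym (⟨,⟩-subʳ c x r μ))
      (≤-diffℚ _ _ (bound c∈C) (solve 2 (λ a z → z :- a := con 0ℚ :- (a :- z)) refl ⟨ c , x ⟩ (μ ℚ.* b c)))
    where
    bound : ∀ {c} → c ∈ C → ⟨ c , x ⟩ ℚ.≤ μ ℚ.* b c
    bound {c} c∈C with b c ℚP.≤? 0ℚ
    ... | yes le = onN (∈-filter⁺ (λ c → b c ℚP.≤? 0ℚ) c∈C le)
    ... | no ¬le = onP (∈-filter⁺ (λ c → 0ℚ ℚP.<? b c) c∈C (ℚP.≰⇒> ¬le))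

InCone-zero : ∀ {m} (G : List (Vecℚ m)) {x} → (∀ i → x i ≡ 0ℚ) → InCone G x
InCone-zero []      x≡0 = x≡0
InCone-zero (r ∷ G) x≡0 = 0ℚ , ℚP.≤-refl , InCone-zero G (λ i →
  trans (cong (ℚ._- 0ℚ ℚ.* r i) (x≡0 i)) (solve 1 (λ r → con 0ℚ :- con 0ℚ :* r := con 0ℚ) refl (r i)))

InCone-cong : ∀ {m} (G : List (Vecℚ m)) {x y} → (∀ i → x i ≡ y i) → InCone G x → InCone G y
InCone-cong []      e x≡0            = λ i → trans (sym (e i)) (x≡0 i)
InCone-cong (r ∷ G) e (μ , 0≤μ , inG) = μ , 0≤μ , InCone-cong G (λ i → cong (ℚ._- μ ℚ.* r i) (e i)) inG

InCone-generator : ∀ {m} (G : List (Vecℚ m)) {r} → r ∈ G → InCone G r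
InCone-generator (r ∷ G) (here refl) = 1ℚ , ℚP.nonNegative⁻¹ 1ℚ ,
  InCone-zero G (λ i → solve 1 (λ r → r :- con 1ℚ :* r := con 0ℚ) refl (r i))
InCone-generator (s ∷ G) {r} (there r∈G) = 0ℚ , ℚP.≤-refl ,
  InCone-cong G (λ i → solve 2 (λ r s → r := r :- con 0ℚ :* s) refl (r i) (s i)) (InCone-generator G r∈G)

-- Convex combinations and convex envelopes

Weights : Set → Set
Weights A = List (ℚ × A)

-- The integral of `φ` against a finitely supported measure; total mass, barycentre and mean height
-- are all instances.
wsum : ∀ {A : Set} → Weights A → (A → ℚ) → ℚ
wsum M φ = sumL (List.map (λ p → proj₁ p ℚ.* φ (proj₂ p)) M)

Supported : ∀ {A : Set} → Pred A 0ℓ → Weights A → Set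
Supported P = All (λ p → 0ℚ ℚ.≤ proj₁ p × P (proj₂ p))

wsum-+ : ∀ {A : Set} (M : Weights A) φ ψ → wsum M (λ a → φ a ℚ.+ ψ a) ≡ wsum M φ ℚ.+ wsum M ψ
wsum-+ []            φ ψ = refl
wsum-+ ((μ , a) ∷ M) φ ψ = trans (cong (ℚ._+_ (μ ℚ.* (φ a ℚ.+ ψ a))) (wsum-+ M φ ψ))
  (solve 5 (λ m f g F G → m :* (f :+ g) :+ (F :+ G) := (m :* f :+ F) :+ (m :* g :+ G)) refl μ (φ a) (ψ a) (wsum M φ) (wsum M ψ))

wsum-*ˡ : ∀ {A : Set} (M : Weights A) c φ → wsum M (λ a → c ℚ.* φ a) ≡ c ℚ.* wsum M φ
wsum-*ˡ []            c φ = sym (ℚP.*-zeroʳ c)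
wsum-*ˡ ((μ , a) ∷ M) c φ = trans (cong (ℚ._+_ (μ ℚ.* (c ℚ.* φ a))) (wsum-*ˡ M c φ))
  (solve 4 (λ m c f F → m :* (c :* f) :+ c :* F := c :* (m :* f :+ F)) refl μ c (φ a) (wsum M φ))

wsum-cong : ∀ {A : Set} (M : Weights A) {φ ψ} → (∀ a → φ a ≡ ψ a) → wsum M φ ≡ wsum M ψ
wsum-cong []            e = refl
wsum-cong ((μ , a) ∷ M) e = cong₂ ℚ._+_ (cong (μ ℚ.*_) (e a)) (wsum-cong M e)

wsum-- : ∀ {A : Set} (M : Weights A) φ ψ → wsum M (λ a → φ a ℚ.- ψ a) ≡ wsum M φ ℚ.- wsum M ψ
wsum-- M φ ψ = trans (wsum-cong M (λ a → solve 2 (λ f g → f :- g := f :+ con (ℚ.- 1ℚ) :* g) refl (φ a) (ψ a)))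
  (trans (wsum-+ M φ (λ a → ℚ.- 1ℚ ℚ.* ψ a)) (trans (cong (ℚ._+_ (wsum M φ)) (wsum-*ˡ M (ℚ.- 1ℚ) ψ))
    (solve 2 (λ f g → f :+ con (ℚ.- 1ℚ) :* g := f :- g) refl (wsum M φ) (wsum M ψ))))

wsum-const : ∀ {A : Set} (M : Weights A) → wsum M (λ _ → 1ℚ) ≡ 1ℚ → ∀ c → wsum M (λ _ → c) ≡ c
wsum-const M one c = trans (wsum-cong M (λ _ → sym (ℚP.*-identityʳ c)))
  (trans (wsum-*ˡ M c (λ _ → 1ℚ)) (trans (cong (c ℚ.*_) one) (ℚP.*-identityʳ c)))

wsum-mono : ∀ {A : Set} {P : Pred A 0ℓ} {M : Weights A} {φ ψ} → Supported P M → (∀ {a} → P a → φ a ℚ.≤ ψ a) → wsum M φ ℚ.≤ wsum M ψ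
wsum-mono []               le = ℚP.≤-refl
wsum-mono ((0≤μ , Pa) ∷ s) le = ℚP.+-mono-≤ (*-monoˡ-≤ 0≤μ (le Pa)) (wsum-mono s le)

wsum-∑ : ∀ {A : Set} {n} (M : Weights A) (φ : Fin n → A → ℚ) → ∑ℚ (λ i → wsum M (φ i)) ≡ wsum M (λ a → ∑ℚ (λ i → φ i a))
wsum-∑ {n = zero}  M φ = sym (trans (wsum-cong M (λ _ → sym (ℚP.*-zeroˡ 0ℚ))) (trans (wsum-*ˡ M 0ℚ (λ _ → 0ℚ)) (ℚP.*-zeroˡ (wsum M (λ _ → 0ℚ)))))
wsum-∑ {n = suc n} M φ = trans (cong (ℚ._+_ (wsum M (φ Fin.zero))) (wsum-∑ M (φ ∘ Fin.suc)))
  (sym (wsum-+ M (φ Fin.zero) (λ a → ∑ℚ (λ i → φ (Fin.suc i) a))))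

wsum-⟨,⟩ : ∀ {A : Set} {n} (M : Weights A) (u : Vecℚ n) (x : A → Vecℚ n) → ⟨ u , (λ i → wsum M (λ a → x a i)) ⟩ ≡ wsum M (λ a → ⟨ u , x a ⟩)
wsum-⟨,⟩ M u x = trans (∑ℚ-cong (λ i → sym (wsum-*ˡ M (u i) (λ a → x a i)))) (wsum-∑ M (λ i a → u i ℚ.* x a i))

wsum-strip : ∀ {A : Set} {P : Pred A 0ℓ} (δ : A → ℚ) → (∀ {a} → P a → 0ℚ ℚ.≤ δ a) →
  ∀ {M : Weights A} → Supported P M → wsum M δ ℚ.≤ 0ℚ →
  ∃ λ M′ → Supported (λ a → P a × δ a ≡ 0ℚ) M′ × (∀ φ → wsum M′ φ ≡ wsum M φ)
wsum-strip δ 0≤δ []                              le = [] , [] , λ _ → refl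
wsum-strip {P = P} δ 0≤δ {(μ , a) ∷ M} ((0≤μ , Pa) ∷ s) le = go (wsum-strip δ 0≤δ s le-rest)
  where
  0≤μδ : 0ℚ ℚ.≤ μ ℚ.* δ a
  0≤μδ = *-nonNeg 0≤μ (0≤δ Pa)
  0≤rest : 0ℚ ℚ.≤ wsum M δ
  0≤rest = subst (ℚ._≤ wsum M δ) (trans (wsum-*ˡ M 0ℚ (λ _ → 1ℚ)) (ℚP.*-zeroˡ (wsum M (λ _ → 1ℚ)))) (wsum-mono s (λ Pb → 0≤δ Pb))
  le-rest : wsum M δ ℚ.≤ 0ℚ
  le-rest = ℚP.≤-trans (subst (ℚ._≤ μ ℚ.* δ a ℚ.+ wsum M δ) (ℚP.+-identityˡ _) (ℚP.+-monoˡ-≤ (wsum M δ) 0≤μδ)) le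
  μδ≤0 : μ ℚ.* δ a ℚ.≤ 0ℚ
  μδ≤0 = ℚP.≤-trans (subst (ℚ._≤ μ ℚ.* δ a ℚ.+ wsum M δ) (ℚP.+-identityʳ _) (ℚP.+-monoʳ-≤ (μ ℚ.* δ a) 0≤rest)) le
  go : (∃ λ M′ → Supported (λ a → P a × δ a ≡ 0ℚ) M′ × (∀ φ → wsum M′ φ ≡ wsum M φ)) →
    ∃ λ M′ → Supported (λ a → P a × δ a ≡ 0ℚ) M′ × (∀ φ → wsum M′ φ ≡ wsum ((μ , a) ∷ M) φ)
  go (M′ , s′ , e) with 0ℚ ℚP.<? μ
  ... | yes 0<μ = (μ , a) ∷ M′ , (0≤μ , Pa , ℚP.≤-antisym
          (ℚP.*-cancelˡ-≤-pos μ {{ℚ.positive 0<μ}} (ℚP.≤-trans μδ≤0 (ℚP.≤-reflexive (sym (ℚP.*-zeroʳ μ))))) (0≤δ Pa)) ∷ s′ ,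
          λ φ → cong (ℚ._+_ (μ ℚ.* φ a)) (e φ)
  ... | no ¬0<μ = M′ , s′ , λ φ → trans (e φ) (sym (trans
          (cong (λ m → m ℚ.* φ a ℚ.+ wsum M φ) (ℚP.≤-antisym (ℚP.≮⇒≥ ¬0<μ) 0≤μ))
          (solve 2 (λ f F → con 0ℚ :* f :+ F := F) refl (φ a) (wsum M φ))))

InCone-wsum : ∀ {A : Set} {m} (g : A → Vecℚ m) (L : List A) {y} → InCone (List.map g L) y →
  ∃ λ M → Supported (_∈ L) M × (∀ i → y i ≡ wsum M (λ a → g a i))
InCone-wsum g []      y≡0 = [] , [] , y≡0
InCone-wsum g (a ∷ L) {y} (μ , 0≤μ , inG) with InCone-wsum g L inG
... | M , s , e = (μ , a) ∷ M , (0≤μ , here refl) ∷ All.map (λ (0≤ν , b∈L) → 0≤ν , there b∈L) s ,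
  λ i → trans (solve 2 (λ y z → y := z :+ (y :- z)) refl (y i) (μ ℚ.* g a i)) (cong (ℚ._+_ (μ ℚ.* g a i)) (e i))

max-upper : ∀ {B : Set} (φ : B → ℚ) p ps {q} → q ∈ p ∷ ps → φ q ℚ.≤ foldr₁ ℚ._⊔_ (List⁺.map φ (p ∷ ps))
max-upper φ p []       (here refl) = ℚP.≤-refl
max-upper φ p (q ∷ ps) (here refl) = ℚP.p≤p⊔q (φ p) _
max-upper φ p (q ∷ ps) (there i)   = ℚP.≤-trans (max-upper φ q ps i) (ℚP.p≤q⊔p (φ p) _)

max-attained : ∀ {B : Set} (φ : B → ℚ) p ps → ∃ λ q → q ∈ p ∷ ps × foldr₁ ℚ._⊔_ (List⁺.map φ (p ∷ ps)) ≡ φ q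
max-attained φ p []       = p , here refl , refl
max-attained φ p (q ∷ ps) with max-attained φ q ps | ℚP.⊔-sel (φ p) (foldr₁ ℚ._⊔_ (List⁺.map φ (q ∷ ps)))
... | _             | inj₁ e = p , here refl , e
... | r , r∈ , r-max | inj₂ e = r , there r∈ , trans e r-max

module _ {n} (F : PolyConvFn n) where
  open PolyConvFn F

  piece : Vecℚ n → Vecℚ n × ℚ → ℚ
  piece y p = ⟨ proj₁ p , y ⟩ ℚ.+ proj₂ p

  val-upper : ∀ y {p} → p ∈ List⁺.toList pieces → piece y p ℚ.≤ val y
  val-upper y = max-upper (piece y) (List⁺.head pieces) (List⁺.tail pieces)

  val-attained : ∀ y → ∃ λ p → p ∈ List⁺.toList pieces × val y ≡ piece y p
  val-attained y = max-attained (piece y) (List⁺.head pieces) (List⁺.tail pieces)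

record IsConvex {A : Set} (P : Pred A 0ℓ) (M : Weights A) : Set where
  constructor convex
  field
    supported : Supported P M
    total     : wsum M (λ _ → 1ℚ) ≡ 1ℚ

open IsConvex using (total)

wsum-affine : ∀ {A : Set} {n} (a : Vecℚ n) b (x : A → Vecℚ n) (M : Weights A) → wsum M (λ _ → 1ℚ) ≡ 1ℚ →
  ∀ {y} → (∀ i → y i ≡ wsum M (λ k → x k i)) → wsum M (λ k → ⟨ a , x k ⟩ ℚ.+ b) ≡ ⟨ a , y ⟩ ℚ.+ b
wsum-affine a b x M one e = trans (wsum-+ M (λ k → ⟨ a , x k ⟩) (λ _ → b))
  (cong₂ ℚ._+_ (trans (sym (wsum-⟨,⟩ M a x)) (⟨,⟩-congʳ a (sym ∘ e))) (wsum-const M one b))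

p-q≡0⇒p≡q : ∀ {p q} → p ℚ.- q ≡ 0ℚ → p ≡ q
p-q≡0⇒p≡q {p} {q} h = trans (solve 2 (λ p q → p := (p :- q) :+ q) refl p q) (trans (cong (ℚ._+ q) h) (ℚP.+-identityˡ q))

p≤q⇒p-q≤0 : ∀ {p q} → p ℚ.≤ q → p ℚ.- q ℚ.≤ 0ℚ
p≤q⇒p-q≤0 {p} {q} le = ≤-diffℚ p q le (solve 2 (λ p q → q :- p := con 0ℚ :- (p :- q)) refl p q)

-- Complementary slackness for the gap between `v` and an affine minorant: the mean gap is not
-- positive, so only atoms where the minorant is exact need be kept.
tight-support : ∀ {A : Set} {n} {P : Pred A 0ℓ} {x : A → Vecℚ n} {v : A → ℚ} a b → (∀ {k} → P k → ⟨ a , x k ⟩ ℚ.+ b ℚ.≤ v k) →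
  ∀ {y} M → IsConvex P M → (∀ i → y i ≡ wsum M (λ k → x k i)) → wsum M v ℚ.≤ ⟨ a , y ⟩ ℚ.+ b →
  ∃ λ M′ → IsConvex (λ k → P k × v k ≡ ⟨ a , x k ⟩ ℚ.+ b) M′ × (∀ i → y i ≡ wsum M′ (λ k → x k i))
tight-support {A} {P = P} {x} {v} a b valid {y} M (convex s one) e le = finish (wsum-strip δ (λ Pk → p≤q⇒0≤q-p (valid Pk)) s small)
  where
  δ : A → ℚ
  δ k = v k ℚ.- (⟨ a , x k ⟩ ℚ.+ b)
  small : wsum M δ ℚ.≤ 0ℚ
  small = subst (ℚ._≤ 0ℚ) (sym (trans (wsum-- M v (λ k → ⟨ a , x k ⟩ ℚ.+ b)) (cong (ℚ._-_ (wsum M v)) (wsum-affine a b x M one e))))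
    (p≤q⇒p-q≤0 le)
  finish : (∃ λ M′ → Supported (λ k → P k × δ k ≡ 0ℚ) M′ × (∀ φ → wsum M′ φ ≡ wsum M φ)) → _
  finish (M′ , s′ , same) = M′ ,
    convex (All.map (λ (0≤μ , Pk , δ≡0) → 0≤μ , Pk , p-q≡0⇒p≡q δ≡0) s′) (trans (same (λ _ → 1ℚ)) one) ,
    λ i → trans (e i) (sym (same (λ k → x k i)))

-- Characterises the lower convex hull of the points `(x a , v a)`. Validity keeps the function
-- below the hull, and `represent` keeps it above, so the fields determine it.
record Envelope {A : Set} {n} (L : List A) (x : A → Vecℚ n) (v : A → ℚ) : Set where
  field
    F                : PolyConvFn n
    constraint-valid : ∀ {c} → c ∈ PolyConvFn.constraints F → ∀ {a} → a ∈ L → ⟨ proj₁ c , x a ⟩ ℚ.≤ proj₂ c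
    piece-valid      : ∀ {p} → p ∈ List⁺.toList (PolyConvFn.pieces F) → ∀ {a} → a ∈ L → piece F (x a) p ℚ.≤ v a
    represent        : ∀ {y} → PolyConvFn.domF F y →
      ∃ λ M → IsConvex (_∈ L) M × (∀ i → y i ≡ wsum M (λ a → x a i)) × wsum M v ℚ.≤ PolyConvFn.val F y

-- A total inverse with default value 0 off the positive numbers, so that `mkPiece` can be formed
-- for every inequality before the steep ones are selected.
reciprocal : ∀ q → ∃ λ ρ → 0ℚ ℚ.≤ ρ × (0ℚ ℚ.< q → ρ ℚ.* q ≡ 1ℚ)
reciprocal q with 0ℚ ℚP.<? q
... | no ¬0<q = 0ℚ , ℚP.≤-refl , λ 0<q → contradiction 0<q ¬0<q
... | yes 0<q = (ℚ.1/ q) , ℚP.<⇒≤ (ℚP.positive⁻¹ (ℚ.1/ q) {{ℚP.1/pos⇒pos q}}) , λ _ → ℚP.*-inverseˡ q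
  where
  instance
    q-pos : ℚ.Positive q
    q-pos = ℚ.positive 0<q
    q-nonZero : ℚ.NonZero q
    q-nonZero = ℚP.pos⇒nonZero q

lower-bound : ∀ {A : Set} (v : A → ℚ) (L : List A) → ∃ λ l → ∀ {a} → a ∈ L → l ℚ.≤ v a
lower-bound v []      = 0ℚ , λ ()
lower-bound v (b ∷ L) with lower-bound v L
... | l , le = v b ℚ.⊓ l , λ { (here refl) → ℚP.p⊓q≤p (v b) l ; (there a∈L) → ℚP.≤-trans (ℚP.p⊓q≤q (v b) l) (le a∈L) }

-- The epigraph of the convex envelope, homogenised: coordinate 0 is the scale and coordinate 1 the height.
module Epigraph {A : Set} {n} (L : List A) (x : A → Vecℚ n) (v : A → ℚ) where

  hom : ℚ → ℚ → Vecℚ n → Vecℚ (suc (suc n))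
  hom s t y Fin.zero              = s
  hom s t y (Fin.suc Fin.zero)    = t
  hom s t y (Fin.suc (Fin.suc i)) = y i

  gen : A → Vecℚ (suc (suc n))
  gen a = hom 1ℚ (v a) (x a)

  -- The vertical ray makes the cone an epigraph and forces every inequality to have a nonpositive
  -- height coefficient `ct`.
  up : Vecℚ (suc (suc n))
  up = hom 0ℚ 1ℚ (λ _ → 0ℚ)

  G : List (Vecℚ (suc (suc n)))
  G = up ∷ List.map gen L

  module _ {C} (mw : ∀ y → (InCone G y → Satisfies C y) × (Satisfies C y → InCone G y))
           {l} (l≤v : ∀ {a} → a ∈ L → l ℚ.≤ v a) where

    cs ct : Vecℚ (suc (suc n)) → ℚ
    cs c = c Fin.zero
    ct c = c (Fin.suc Fin.zero)
    cx : Vecℚ (suc (suc n)) → Vecℚ n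
    cx c i = c (Fin.suc (Fin.suc i))
    ρ : Vecℚ (suc (suc n)) → ℚ
    ρ c = proj₁ (reciprocal (ℚ.- ct c))
    -- At scale 1 an inequality reads `cs + ct * t + ⟨ cx , y ⟩ ≤ 0`. With `ct` zero it restricts
    -- the domain; with `ct` negative, division by `− ct` turns it into a lower bound on the height
    -- `t`.
    mkConstraint mkPiece : Vecℚ (suc (suc n)) → Vecℚ n × ℚ
    mkConstraint c = cx c , ℚ.- cs c
    mkPiece c = (λ i → ρ c ℚ.* cx c i) , ρ c ℚ.* cs c
    flat? = λ c → 0ℚ ℚP.≤? ct c
    steep? = λ c → ct c ℚP.<? 0ℚ
    F : PolyConvFn n
    F = record
      -- A list of pieces must be nonempty; the constant `l` lies below all values and is a valid
      -- piece even if no inequality is steep.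
      { pieces = ((λ _ → 0ℚ) , l) ∷ List.map mkPiece (filter steep? C)
      ; constraints = List.map mkConstraint (filter flat? C)
      }
    open PolyConvFn F
    ct≤0 : ∀ {c} → c ∈ C → ct c ℚ.≤ 0ℚ
    ct≤0 {c} c∈C = subst (ℚ._≤ 0ℚ)
      (trans (cong (λ z → cs c ℚ.* 0ℚ ℚ.+ (ct c ℚ.* 1ℚ ℚ.+ z)) (⟨,⟩-zeroʳ (cx c)))
        (solve 2 (λ s t → s :* con 0ℚ :+ (t :* con 1ℚ :+ con 0ℚ) := t) refl (cs c) (ct c)))
      (proj₁ (mw up) (InCone-generator G (here refl)) c∈C)
    on-gen : ∀ {c} → c ∈ C → ∀ {a} → a ∈ L → cs c ℚ.* 1ℚ ℚ.+ (ct c ℚ.* v a ℚ.+ ⟨ cx c , x a ⟩) ℚ.≤ 0ℚ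
    on-gen c∈C {a} a∈L = proj₁ (mw (gen a)) (InCone-generator G (there (∈-map⁺ gen a∈L))) c∈C
    flat-ct : ∀ {c} → c ∈ C → 0ℚ ℚ.≤ ct c → ct c ≡ 0ℚ
    flat-ct c∈C le = ℚP.≤-antisym (ct≤0 c∈C) le
    steep-ρ : ∀ {c} → ct c ℚ.< 0ℚ → ρ c ℚ.* (ℚ.- ct c) ≡ 1ℚ
    steep-ρ {c} lt = proj₂ (proj₂ (reciprocal (ℚ.- ct c))) (ℚP.neg-antimono-< lt)
    constraint-valid′ : ∀ {p} → (∃ λ c → c ∈ filter flat? C × p ≡ mkConstraint c) → ∀ {a} → a ∈ L → ⟨ proj₁ p , x a ⟩ ℚ.≤ proj₂ p
    constraint-valid′ (c , c∈ , refl) {a} a∈L with ∈-filter⁻ flat? {xs = C} c∈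
    ... | c∈C , flat = ≤-diffℚ _ _ (on-gen c∈C a∈L)
      (trans (cong (λ z → 0ℚ ℚ.- (cs c ℚ.* 1ℚ ℚ.+ (z ℚ.* v a ℚ.+ ⟨ cx c , x a ⟩))) (flat-ct c∈C flat))
        (solve 3 (λ s v d → con 0ℚ :- (s :* con 1ℚ :+ (con 0ℚ :* v :+ d)) := (:- s) :- d) refl (cs c) (v a) ⟨ cx c , x a ⟩))
    piece-valid′ : ∀ {p} → (∃ λ c → c ∈ filter steep? C × p ≡ mkPiece c) → ∀ {a} → a ∈ L → piece F (x a) p ℚ.≤ v a
    piece-valid′ (c , c∈ , refl) {a} a∈L with ∈-filter⁻ steep? {xs = C} c∈
    ... | c∈C , steep = ≤-diffℚ _ _ (*-monoˡ-≤ (proj₁ (proj₂ (reciprocal (ℚ.- ct c)))) (on-gen c∈C a∈L)) (begin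
      ρ c ℚ.* 0ℚ ℚ.- ρ c ℚ.* (cs c ℚ.* 1ℚ ℚ.+ (ct c ℚ.* v a ℚ.+ ⟨ cx c , x a ⟩))
        ≡⟨ solve 5 (λ r s t v d → r :* con 0ℚ :- r :* (s :* con 1ℚ :+ (t :* v :+ d)) := (r :* (:- t)) :* v :- (r :* d :+ r :* s)) refl (ρ c) (cs c) (ct c) (v a) ⟨ cx c , x a ⟩ ⟩
      (ρ c ℚ.* (ℚ.- ct c)) ℚ.* v a ℚ.- (ρ c ℚ.* ⟨ cx c , x a ⟩ ℚ.+ ρ c ℚ.* cs c)
        ≡⟨ cong₂ ℚ._-_ (trans (cong (ℚ._* v a) (steep-ρ {c} steep)) (ℚP.*-identityˡ (v a))) (cong (ℚ._+ ρ c ℚ.* cs c) (sym (⟨,⟩-*ˡ (ρ c) (cx c) (x a)))) ⟩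
      v a ℚ.- piece F (x a) (mkPiece c) ∎)
      where open ≡-Reasoning
    satisfied : ∀ {y} → domF y → Satisfies C (hom 1ℚ (val y) y)
    satisfied {y} dom {c} c∈C with 0ℚ ℚP.≤? ct c
    ... | yes flat = ≤-diffℚ _ _ (All.lookup dom (∈-map⁺ mkConstraint (∈-filter⁺ flat? c∈C flat)))
      (sym (trans (cong (λ z → 0ℚ ℚ.- (cs c ℚ.* 1ℚ ℚ.+ (z ℚ.* val y ℚ.+ ⟨ cx c , y ⟩))) (flat-ct c∈C flat))
        (solve 3 (λ s v d → con 0ℚ :- (s :* con 1ℚ :+ (con 0ℚ :* v :+ d)) := (:- s) :- d) refl (cs c) (val y) ⟨ cx c , y ⟩)))
    ... | no ¬flat = ℚP.*-cancelˡ-≤-pos (ρ c) {{ρ-pos}} (≤-diffℚ _ _ (val-upper F y (there (∈-map⁺ mkPiece (∈-filter⁺ steep? c∈C steep))))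
      (sym (begin
      ρ c ℚ.* 0ℚ ℚ.- ρ c ℚ.* (cs c ℚ.* 1ℚ ℚ.+ (ct c ℚ.* val y ℚ.+ ⟨ cx c , y ⟩))
        ≡⟨ solve 5 (λ r s t v d → r :* con 0ℚ :- r :* (s :* con 1ℚ :+ (t :* v :+ d)) := (r :* (:- t)) :* v :- (r :* d :+ r :* s)) refl (ρ c) (cs c) (ct c) (val y) ⟨ cx c , y ⟩ ⟩
      (ρ c ℚ.* (ℚ.- ct c)) ℚ.* val y ℚ.- (ρ c ℚ.* ⟨ cx c , y ⟩ ℚ.+ ρ c ℚ.* cs c)
        ≡⟨ cong₂ ℚ._-_ (trans (cong (ℚ._* val y) (steep-ρ {c} steep)) (ℚP.*-identityˡ (val y))) (cong (ℚ._+ ρ c ℚ.* cs c) (sym (⟨,⟩-*ˡ (ρ c) (cx c) y))) ⟩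
      val y ℚ.- piece F y (mkPiece c) ∎)))
      where
      open ≡-Reasoning
      steep : ct c ℚ.< 0ℚ
      steep = ℚP.≰⇒> ¬flat
      ρ-pos : ℚ.Positive (ρ c)
      ρ-pos = ℚP.nonNeg∧nonZero⇒pos (ρ c) {{ℚ.nonNegative {ρ c} (proj₁ (proj₂ (reciprocal (ℚ.- ct c))))}} {{ℚ.≢-nonZero {ρ c} λ ρ≡0 →
        contradiction (trans (sym (steep-ρ {c} steep)) (trans (cong (ℚ._* (ℚ.- ct c)) ρ≡0) (ℚP.*-zeroˡ (ℚ.- ct c)))) λ ()}}
    represent′ : ∀ {y} → domF y → ∃ λ M → IsConvex (_∈ L) M × (∀ i → y i ≡ wsum M (λ a → x a i)) × wsum M v ℚ.≤ val y
    represent′ {y} dom = from-cone (proj₂ (mw (hom 1ℚ (val y) y)) (satisfied dom))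
      where
      from-cone : InCone G (hom 1ℚ (val y) y) → ∃ λ M → IsConvex (_∈ L) M × (∀ i → y i ≡ wsum M (λ a → x a i)) × wsum M v ℚ.≤ val y
      from-cone (μ , 0≤μ , inG) with InCone-wsum gen L inG
      ... | M , s , e = M , convex s (sym (trans (solve 1 (λ m → con 1ℚ := con 1ℚ :- m :* con 0ℚ) refl μ) (e Fin.zero))) ,
        (λ i → trans (solve 2 (λ y m → y := y :- m :* con 0ℚ) refl (y i) μ) (e (Fin.suc (Fin.suc i)))) ,
        ≤-diffℚ _ _ 0≤μ (trans (solve 2 (λ m v → m :- con 0ℚ := v :- (v :- m :* con 1ℚ)) refl μ (val y))
          (cong (ℚ._-_ (val y)) (e (Fin.suc Fin.zero))))

    epigraph-envelope : Envelope L x v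
    epigraph-envelope = record
      { F = F
      ; constraint-valid = λ c∈ → constraint-valid′ (∈-map⁻ mkConstraint c∈)
      ; piece-valid = λ { (here refl) a∈L → subst (ℚ._≤ _) (sym (trans (cong (ℚ._+ l) (⟨,⟩-zeroˡ (x _))) (ℚP.+-identityˡ l))) (l≤v a∈L)
                        ; (there p∈) → piece-valid′ (∈-map⁻ mkPiece p∈) }
      ; represent = represent′
      }

envelope : ∀ {A : Set} {n} (L : List A) (x : A → Vecℚ n) (v : A → ℚ) → Envelope L x v
envelope L x v = epigraph-envelope (proj₂ (minkowski-weyl G)) (proj₂ (lower-bound v L))
  where open Epigraph L x v

module _ {A : Set} {n} {L : List A} {x : A → Vecℚ n} {v : A → ℚ} (E : Envelope L x v) where
  open Envelope E
  open PolyConvFn F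

  val-wsum : ∀ {y} M → IsConvex (_∈ L) M → (∀ i → y i ≡ wsum M (λ a → x a i)) → val y ℚ.≤ wsum M v
  val-wsum {y} M (convex s one) e with val-attained F y
  ... | (a , b) , p∈ , eq = subst (ℚ._≤ wsum M v) (trans (wsum-affine a b x M one e) (sym eq)) (wsum-mono s (piece-valid p∈))

  domF-farkas : ∀ {y} → (∀ c d → (∀ {a} → a ∈ L → ⟨ c , x a ⟩ ℚ.≤ d) → ⟨ c , y ⟩ ℚ.≤ d) → domF y
  domF-farkas h = All.tabulate (λ {c} c∈ → h (proj₁ c) (proj₂ c) (constraint-valid c∈))

  domF-wsum : ∀ {y} M → IsConvex (_∈ L) M → (∀ i → y i ≡ wsum M (λ a → x a i)) → domF y
  domF-wsum M (convex s one) e = domF-farkas λ c d le → subst₂ ℚ._≤_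
    (trans (sym (wsum-⟨,⟩ M c x)) (⟨,⟩-congʳ c (sym ∘ e))) (wsum-const M one d) (wsum-mono s le)

  domF-point : ∀ {a} → a ∈ L → domF (x a)
  domF-point a∈L = domF-farkas λ c d le → le a∈L

  val-point : ∀ {a} → a ∈ L → val (x a) ℚ.≤ v a
  val-point {a} a∈L with val-attained F (x a)
  ... | p , p∈ , eq = subst (ℚ._≤ v a) (sym eq) (piece-valid p∈ a∈L)

  -- A primal and dual optimal pair at `y`: a subgradient `a` with intercept `b`, and a convex
  -- combination of points at which the affine function is exact.
  TightRepresentation : Vecℚ n → Set
  TightRepresentation y = Σ (Vecℚ n) λ a → Σ ℚ λ b →
    (∀ k → k ∈ L → ⟨ a , x k ⟩ ℚ.+ b ℚ.≤ v k) × val y ≡ ⟨ a , y ⟩ ℚ.+ b ×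
    ∃ λ M → IsConvex (λ k → k ∈ L × v k ≡ ⟨ a , x k ⟩ ℚ.+ b) M × (∀ i → y i ≡ wsum M (λ k → x k i))

  tight-represent : ∀ {y} → domF y → TightRepresentation y
  tight-represent {y} dom = from-piece (val-attained F y) (represent dom)
    where
    from-piece : (∃ λ p → p ∈ List⁺.toList pieces × val y ≡ piece F y p) →
      (∃ λ M → IsConvex (_∈ L) M × (∀ i → y i ≡ wsum M (λ a → x a i)) × wsum M v ℚ.≤ val y) → TightRepresentation y
    from-piece ((a , b) , p∈ , eq) (M , cvx , e , le) =
      a , b , (λ k → piece-valid p∈) , eq , tight-support {P = _∈ L} {x} {v} a b (λ {k} → piece-valid p∈ {k}) {y} M cvx e (subst (wsum M v ℚ.≤_) eq le)

  farkas-envelope : ∀ {y} → (∀ c d → (∀ {a} → a ∈ L → ⟨ c , x a ⟩ ℚ.≤ d) → ⟨ c , y ⟩ ℚ.≤ d) →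
    ∃ λ M → IsConvex (_∈ L) M × (∀ i → y i ≡ wsum M (λ a → x a i))
  farkas-envelope {y} h = drop (represent (domF-farkas h))
    where
    drop : (∃ λ M → IsConvex (_∈ L) M × (∀ i → y i ≡ wsum M (λ a → x a i)) × wsum M v ℚ.≤ val y) →
      ∃ λ M → IsConvex (_∈ L) M × (∀ i → y i ≡ wsum M (λ a → x a i))
    drop (M , cvx , e , _) = M , cvx , e

-- The constraints of an envelope are themselves valid inequalities, so a point obeying all valid
-- inequalities lies in its domain and is represented. The heights do not matter and are set to 0.
farkas-convex : ∀ {A : Set} {n} (L : List A) (x : A → Vecℚ n) {y} →
  (∀ c d → (∀ {a} → a ∈ L → ⟨ c , x a ⟩ ℚ.≤ d) → ⟨ c , y ⟩ ℚ.≤ d) →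
  ∃ λ M → IsConvex (_∈ L) M × (∀ i → y i ≡ wsum M (λ a → x a i))
farkas-convex L x {y} = farkas-envelope (envelope L x (λ _ → 0ℚ)) {y}

-- Integral generalized polymatroids and their layers

record IntBounds {n} (b p : Subset n → ℤ) : Set where
  field
    b-submodular   : Submodularℤ b
    p-supermodular : ∀ X Y → p X ℤ.+ p Y ℤ.≤ p (X ∪ Y) ℤ.+ p (X ∩ Y)
    b⊥≡0           : b ⊥ ≡ + 0
    p⊥≡0           : p ⊥ ≡ + 0
    cross          : ∀ X Y → b (X ─ Y) ℤ.- p (Y ─ X) ℤ.≤ b X ℤ.- p Y

open IntBounds

∁-⊤ : ∀ n → ∁ {n} ⊤ ≡ ⊥
∁-⊤ n = trans (cong ∁ (sym (∁-⊥ n))) (∁-involutive ⊥)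

-- A generalized polymatroid is the projection of a base polyhedron along an additional element (here the first one).
lift : ∀ {n} → (Subset n → ℤ) → (Subset n → ℤ) → Subset (suc n) → ℤ
lift b p (outside ∷ X) = b X
lift b p (inside  ∷ X) = ℤ.- p (∁ X)

-- Submodularity between a set with and a set without the additional element is the cross
-- inequality, applied to a complement.
lift-base : ∀ {n} {b p : Subset n → ℤ} → IntBounds b p → BaseFunction (lift b p)
lift-base {n} {b} {p} I = record { submodular = sub ; h⊥≡0 = b⊥≡0 I }
  where
  mixed : ∀ X Y → ℤ.- p (∁ (X ∪ Y)) ℤ.+ b (X ∩ Y) ℤ.≤ b X ℤ.- p (∁ Y)
  mixed X Y = subst (ℤ._≤ b X ℤ.- p (∁ Y))
    (trans (cong₂ (λ S T → b S ℤ.- p T)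
      (trans (sym (─-∁ X (∁ Y))) (cong (X ∩_) (∁-involutive Y)))
      (trans (sym (─-∁ (∁ Y) X)) (trans (SubP.∩-comm (∁ Y) (∁ X)) (sym (∁-∪ X Y)))))
      (ℤP.+-comm (b (X ∩ Y)) _))
    (cross I X (∁ Y))
  sub : Submodularℤ (lift b p)
  sub (outside ∷ X) (outside ∷ Y) = b-submodular I X Y
  sub (outside ∷ X) (inside  ∷ Y) = mixed X Y
  sub (inside  ∷ X) (outside ∷ Y) = subst₂ ℤ._≤_
    (cong₂ (λ S T → ℤ.- p (∁ S) ℤ.+ b T) (SubP.∪-comm Y X) (SubP.∩-comm Y X)) (ℤP.+-comm (b Y) _) (mixed Y X)
  sub (inside  ∷ X) (inside  ∷ Y) = subst₂ ℤ._≤_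
    (trans (neg+ (p (∁ X ∪ ∁ Y)) (p (∁ X ∩ ∁ Y))) (cong₂ (λ S T → ℤ.- p S ℤ.+ ℤ.- p T) (sym (∁-∪ X Y)) (sym (∁-∩ X Y))))
    (ℤP.neg-distrib-+ (p (∁ X)) (p (∁ Y)))
    (ℤP.neg-mono-≤ (p-supermodular I (∁ X) (∁ Y)))
    where
    neg+ : ∀ u i → ℤ.- (u ℤ.+ i) ≡ ℤ.- i ℤ.+ ℤ.- u
    neg+ = solve-∀

Between : ∀ {n} → (Subset n → ℤ) → (Subset n → ℤ) → Pred (Vecℤ n) 0ℓ
Between p b x = ∀ X → p X ℤ.≤ sumOnℤ x X × sumOnℤ x X ℤ.≤ b X

complement-bound : ∀ {s s′ t p k} → s ℤ.+ s′ ≡ t → t ≡ k → s ℤ.≤ ℤ.- p ℤ.+ k → p ℤ.≤ s′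
complement-bound {s} {s′} {p = p} refl refl le = ≤-diffℤ _ _ le (lem s s′ p)
  where
  lem : ∀ s s′ p → ℤ.- p ℤ.+ (s ℤ.+ s′) ℤ.- s ≡ s′ ℤ.- p
  lem = solve-∀

complement-bound⁻ : ∀ {s s′ t p k} → s ℤ.+ s′ ≡ t → t ≡ k → p ℤ.≤ s′ → s ℤ.≤ ℤ.- p ℤ.+ k
complement-bound⁻ {s} {s′} {p = p} refl refl le = ≤-diffℤ _ _ le (lem s s′ p)
  where
  lem : ∀ s s′ p → s′ ℤ.- p ≡ ℤ.- p ℤ.+ (s ℤ.+ s′) ℤ.- s
  lem = solve-∀

-- Minimising `u` is maximising `− u` on the lifted base polyhedron with weight 0 on the additional
-- coordinate, and greedy vertices are integral.
integral-optimum : ∀ {n} {b p : Subset n → ℤ} → IntBounds b p → ∀ (u y : Vecℚ n) →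
  (∀ X → ι (p X) ℚ.≤ sumOn y X × sumOn y X ℚ.≤ ι (b X)) →
  ∃ λ x → Between p b x × ⟨ u , ιv x ⟩ ℚ.≤ ⟨ u , y ⟩
integral-optimum {n} {b} {p} I u y btw = x , between , ≤-diffℚ _ _ opt′ (simp ⟨ u , y ⟩ ⟨ u , ιv x ⟩)
  where
  B = lift-base I
  u⁺ y⁺ : Vecℚ (suc n)
  u⁺ Fin.zero    = 0ℚ
  u⁺ (Fin.suc i) = ℚ.- u i
  -- The lift vanishes at `⊤`, so the additional coordinate is minus the total.
  y⁺ Fin.zero    = ℚ.- ∑ℚ y
  y⁺ (Fin.suc i) = y i
  y⁺∈ : Baseℚ (lift b p) y⁺
  y⁺∈ = le , trans (ℚP.+-inverseˡ (∑ℚ y)) (sym (cong ι (trans (cong (ℤ.-_ ∘ p) (∁-⊤ n)) (cong ℤ.-_ (p⊥≡0 I)))))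
    where
    le : ∀ X → sumOn y⁺ X ℚ.≤ ι (lift b p X)
    le (outside ∷ X) = subst (ℚ._≤ ι (b X)) (sym (ℚP.+-identityˡ _)) (proj₂ (btw X))
    le (inside  ∷ X) = subst₂ ℚ._≤_ (trans (solve 2 (λ s t → :- t := (:- (s :+ t)) :+ s) refl (sumOn y X) (sumOn y (∁ X)))
      (cong (λ z → ℚ.- z ℚ.+ sumOn y X) (sumOn-∁ y X))) (sym (ι-neg (p (∁ X)))) (ℚP.neg-antimono-≤ (proj₁ (btw (∁ X))))
  sorted = sort u⁺
  v : Vecℤ (suc n)
  v = greedyAlong (proj₁ sorted) (lift b p)
  x : Vecℤ n
  x i = v (Fin.suc i)
  v∈ : Baseℤ (lift b p) v
  v∈ = greedyAlong-base (proj₁ sorted) B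
  opt′ : 0ℚ ℚ.* (ℚ.- ∑ℚ y) ℚ.+ ℚ.- ⟨ u , y ⟩ ℚ.≤ 0ℚ ℚ.* ι (v Fin.zero) ℚ.+ ℚ.- ⟨ u , ιv x ⟩
  opt′ = subst₂ (λ S T → 0ℚ ℚ.* (ℚ.- ∑ℚ y) ℚ.+ S ℚ.≤ 0ℚ ℚ.* ι (v Fin.zero) ℚ.+ T) (⟨,⟩-negˡ u y) (⟨,⟩-negˡ u (ιv x))
    (greedyAlong-optimal (proj₁ sorted) B u⁺ y⁺ (proj₂ sorted) y⁺∈)
  simp : ∀ a c → 0ℚ ℚ.* ι (v Fin.zero) ℚ.+ ℚ.- c ℚ.- (0ℚ ℚ.* (ℚ.- ∑ℚ y) ℚ.+ ℚ.- a) ≡ a ℚ.- c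
  simp a c = solve 4 (λ a c v s → con 0ℚ :* v :+ :- c :- (con 0ℚ :* s :+ :- a) := a :- c) refl a c (ι (v Fin.zero)) (ℚ.- ∑ℚ y)
  x-total : ∑ℤ x ≡ ℤ.- v Fin.zero
  x-total = trans (lem (v Fin.zero) (∑ℤ x)) (trans (cong (ℤ._+ ℤ.- v Fin.zero)
    (trans (proj₂ v∈) (trans (cong (ℤ.-_ ∘ p) (∁-⊤ n)) (cong ℤ.-_ (p⊥≡0 I))))) (ℤP.+-identityˡ _))
    where
    lem : ∀ a s → s ≡ (a ℤ.+ s) ℤ.+ ℤ.- a
    lem = solve-∀
  between : Between p b x
  between X = subst (λ S → p S ℤ.≤ sumOnℤ x S) (∁-involutive X)
      (complement-bound {k = ℤ.- v Fin.zero} (sumOnℤ-∁ x (∁ X)) x-total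
        (≤-diffℤ _ _ (proj₁ v∈ (inside ∷ ∁ X)) (lem (v Fin.zero) (sumOnℤ x (∁ X)) (ℤ.- p (∁ (∁ X)))))) ,
    ℤP.≤-trans (ℤP.≤-reflexive (sym (ℤP.+-identityˡ _))) (proj₁ v∈ (outside ∷ X))
    where
    lem : ∀ v s q → q ℤ.- (v ℤ.+ s) ≡ q ℤ.+ ℤ.- v ℤ.- s
    lem = solve-∀

record GenMatroid {n} (D : Pred (Subset n) 0ℓ) : Set where
  field
    b p        : Subset n → ℤ
    bounds     : IntBounds b p
    D-sound    : ∀ {x} → Between p b x → ∃ λ Y → D Y × (∀ i → x i ≡ χ Y i)
    D-complete : ∀ {Y} → D Y → Between p b (χ Y)

int-gpolymatroid : ∀ {n} {P : Pred (Vecℚ n) 0ℓ} → IsIntGPolymatroid P →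
  ∃ λ b → ∃ λ p → IntBounds b p × (P ≐ λ x → ∀ X → ι (p X) ℚ.≤ sumOn x X × sumOn x X ℚ.≤ ι (b X))
int-gpolymatroid {n} {P} (f , g , (f-sub , g-sup , f⊥ , g⊥ , fg , P≐) , int) = b , p , I , P≐′
  where
  b p : Subset n → ℤ
  b X = proj₁ (proj₁ (int X))
  p X = proj₁ (proj₂ (int X))
  f≡ : ∀ X → f X ≡ ι (b X)
  f≡ X = proj₂ (proj₁ (int X))
  g≡ : ∀ X → g X ≡ ι (p X)
  g≡ X = proj₂ (proj₂ (int X))
  f+ : ∀ X Y → f X ℚ.+ f Y ≡ ι (b X ℤ.+ b Y)
  f+ X Y = trans (cong₂ ℚ._+_ (f≡ X) (f≡ Y)) (sym (ι-+ (b X) (b Y)))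
  g+ : ∀ X Y → g X ℚ.+ g Y ≡ ι (p X ℤ.+ p Y)
  g+ X Y = trans (cong₂ ℚ._+_ (g≡ X) (g≡ Y)) (sym (ι-+ (p X) (p Y)))
  f-g : ∀ X Y → f X ℚ.- g Y ≡ ι (b X ℤ.- p Y)
  f-g X Y = trans (cong₂ ℚ._-_ (f≡ X) (g≡ Y)) (sym (ι-- (b X) (p Y)))
  I : IntBounds b p
  I = record
    { b-submodular   = λ X Y → ι-cancel-≤ (subst₂ ℚ._≤_ (f+ (X ∪ Y) (X ∩ Y)) (f+ X Y) (f-sub X Y))
    ; p-supermodular = λ X Y → ι-cancel-≤ (subst₂ ℚ._≤_ (g+ X Y) (g+ (X ∪ Y) (X ∩ Y)) (g-sup X Y))
    ; b⊥≡0           = ι-injective (trans (sym (f≡ ⊥)) f⊥)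
    ; p⊥≡0           = ι-injective (trans (sym (g≡ ⊥)) g⊥)
    ; cross          = λ X Y → ι-cancel-≤ (subst₂ ℚ._≤_ (f-g (X ─ Y) (Y ─ X)) (f-g X Y) (fg X Y))
    }
  P≐′ : P ≐ λ x → ∀ X → ι (p X) ℚ.≤ sumOn x X × sumOn x X ℚ.≤ ι (b X)
  P≐′ x = (λ Px X → subst₂ (λ S T → S ℚ.≤ sumOn x X × sumOn x X ℚ.≤ T) (g≡ X) (f≡ X) (proj₁ (P≐ x) Px X)) ,
          (λ btw → proj₂ (P≐ x) (λ X → subst₂ (λ S T → S ℚ.≤ sumOn x X × sumOn x X ℚ.≤ T) (sym (g≡ X)) (sym (f≡ X)) (btw X)))

gen-matroid : ∀ {n} {P : Pred (Vecℚ n) 0ℓ} {D : Pred (Subset n) 0ℓ} → IsIntGPolymatroid P →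
  (∀ {x} → P (ιv x) → ∃ λ Y → D Y × (∀ i → x i ≡ χ Y i)) → (∀ {Y} → D Y → P (ιv (χ Y))) → GenMatroid D
gen-matroid {n} {P} {D} int snd cpl = from (int-gpolymatroid int)
  where
  from : (∃ λ b → ∃ λ p → IntBounds b p × (P ≐ λ x → ∀ X → ι (p X) ℚ.≤ sumOn x X × sumOn x X ℚ.≤ ι (b X))) → GenMatroid D
  from (b , p , I , P≐) = record
    { b = b ; p = p ; bounds = I
    ; D-sound = λ {x} btw → snd (proj₂ (P≐ (ιv x)) λ X →
        subst (ι (p X) ℚ.≤_) (sym (sumOn-ι x X)) (ι-mono (proj₁ (btw X))) ,
        subst (ℚ._≤ ι (b X)) (sym (sumOn-ι x X)) (ι-mono (proj₂ (btw X))))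
    ; D-complete = λ {Y} DY X →
        ι-cancel-≤ (subst (ι (p X) ℚ.≤_) (sumOn-ι (χ Y) X) (proj₁ (proj₁ (P≐ (ιv (χ Y))) (cpl DY) X))) ,
        ι-cancel-≤ (subst (ℚ._≤ ι (b X)) (sumOn-ι (χ Y) X) (proj₂ (proj₁ (P≐ (ιv (χ Y))) (cpl DY) X)))
    }

-- Integrality is used here: from q + k < b one gets q + k + 1 ≤ b, and hence q′ + k + 1 ≤ b′.
min-exchange : ∀ {b q b′ q′} k → q′ ℤ.+ b ℤ.≤ q ℤ.+ b′ →
  (b′ ℤ.⊓ (q′ ℤ.+ k)) ℤ.+ (b ℤ.⊓ (q ℤ.+ (+ 1 ℤ.+ k))) ℤ.≤ (b′ ℤ.⊓ (q′ ℤ.+ (+ 1 ℤ.+ k))) ℤ.+ (b ℤ.⊓ (q ℤ.+ k))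
min-exchange {b} {q} {b′} {q′} k mono
  with ℤP.⊓-sel b′ (q′ ℤ.+ (+ 1 ℤ.+ k)) | ℤP.⊓-sel b (q ℤ.+ k)
... | inj₁ e | inj₁ e′ rewrite e | e′ = ℤP.+-mono-≤ (ℤP.i⊓j≤i b′ _) (ℤP.i⊓j≤i b _)
... | inj₂ e | inj₁ e′ rewrite e | e′ = ℤP.+-mono-≤
  (ℤP.≤-trans (ℤP.i⊓j≤j b′ _) (ℤP.+-monoʳ-≤ q′ (ℤP.i≤j+i k (+ 1)))) (ℤP.i⊓j≤i b _)
... | inj₂ e | inj₂ e′ rewrite e | e′ = ℤP.≤-trans (ℤP.+-mono-≤ (ℤP.i⊓j≤j b′ _) (ℤP.i⊓j≤j b _)) (ℤP.≤-reflexive (lem q q′ k))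
  where
  lem : ∀ q q′ k → q′ ℤ.+ k ℤ.+ (q ℤ.+ (+ 1 ℤ.+ k)) ≡ q′ ℤ.+ (+ 1 ℤ.+ k) ℤ.+ (q ℤ.+ k)
  lem = solve-∀
... | inj₁ e | inj₂ e′ with b ℤP.≤? q ℤ.+ k
...   | yes le rewrite e | ℤP.i≤j⇒i⊓j≡i le = ℤP.+-mono-≤ (ℤP.i⊓j≤i b′ _) (ℤP.i⊓j≤i b _)
...   | no ¬le rewrite e | e′ = ℤP.≤-trans (ℤP.+-mono-≤ (ℤP.i⊓j≤j b′ _) (ℤP.i⊓j≤j b _))
          (≤-diffℤ _ _ (ℤP.+-mono-≤ mono (ℤP.i<j⇒suc[i]≤j (ℤP.≰⇒> ¬le))) (lem b q b′ q′ k))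
  where
  lem : ∀ b q b′ q′ k → q ℤ.+ b′ ℤ.+ b ℤ.- (q′ ℤ.+ b ℤ.+ (+ 1 ℤ.+ (q ℤ.+ k))) ≡ b′ ℤ.+ (q ℤ.+ k) ℤ.- (q′ ℤ.+ k ℤ.+ (q ℤ.+ (+ 1 ℤ.+ k)))
  lem = solve-∀

module Layers {n} {D : Pred (Subset n) 0ℓ} (G : GenMatroid D) where
  open GenMatroid G

  -- The slice by total `k`: `x(X)` is at most `b X`, and also at most `k − p (∁ X)` because the
  -- complement takes at least `p (∁ X)`. Equivalently, the additional coordinate of the lift is
  -- fixed at `− k`.
  layer : ℕ → Subset n → ℤ
  layer k X = b X ℤ.⊓ (ℤ.- p (∁ X) ℤ.+ + k)

  layer≡fix : ∀ k X → layer k X ≡ fix (lift b p) (ℤ.- + k) X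
  layer≡fix k X = cong (λ z → b X ℤ.⊓ (ℤ.- p (∁ X) ℤ.+ z)) (sym (ℤP.neg-involutive (+ k)))

  -- Members on both sides of size `k` give `p ⊤ ≤ k ≤ b ⊤`. The first inequality makes the layer
  -- vanish at `⊥`, the second gives it the value `k` at `⊤`.
  layer-rank : ∀ {k} → (∃ λ Y → D Y × ∣ Y ∣ ℕ.≤ k) → (∃ λ Y → D Y × k ℕ.≤ ∣ Y ∣) → IsRank (λ Y → D Y × ∣ Y ∣ ≡ k) (layer k)
  layer-rank {k} (Y₁ , D₁ , small) (Y₂ , D₂ , large) = record
    { isBase   = base
    ; sound    = λ {x} x∈ → attach x∈ (D-sound (between x∈))
    ; complete = λ {Y} (DY , ∣Y∣≡k) →
        (λ X → ℤP.⊓-glb (proj₂ (D-complete DY X))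
          (complement-bound⁻ (sumOnℤ-∁ (χ Y) X) (trans (∑ℤ-χ Y) (cong +_ ∣Y∣≡k)) (proj₁ (D-complete DY (∁ X))))) ,
        trans (∑ℤ-χ Y) (trans (cong +_ ∣Y∣≡k) (sym layer⊤))
    }
    where
    p⊤≤k : p ⊤ ℤ.≤ + k
    p⊤≤k = ℤP.≤-trans (proj₁ (D-complete D₁ ⊤)) (ℤP.≤-trans (ℤP.≤-reflexive (trans (sumOnℤ-⊤ (χ Y₁)) (∑ℤ-χ Y₁))) (ℤ.+≤+ small))
    k≤b⊤ : + k ℤ.≤ b ⊤
    k≤b⊤ = ℤP.≤-trans (ℤ.+≤+ large) (ℤP.≤-trans (ℤP.≤-reflexive (sym (trans (sumOnℤ-⊤ (χ Y₂)) (∑ℤ-χ Y₂)))) (proj₂ (D-complete D₂ ⊤)))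
    layer⊤ : layer k ⊤ ≡ + k
    layer⊤ = trans (cong (λ S → b ⊤ ℤ.⊓ (ℤ.- p S ℤ.+ + k)) (∁-⊤ n))
      (trans (cong (λ z → b ⊤ ℤ.⊓ (ℤ.- z ℤ.+ + k)) (p⊥≡0 bounds)) (trans (cong (b ⊤ ℤ.⊓_) (ℤP.+-identityˡ (+ k))) (ℤP.i≥j⇒i⊓j≡j k≤b⊤)))
    fixed : BaseFunction (fix (lift b p) (ℤ.- + k))
    fixed = fix-base (lift-base bounds) (ℤP.≤-trans (ℤP.neg-mono-≤ p⊤≤k) (ℤP.≤-reflexive (cong (ℤ.-_ ∘ p) (sym (∁-⊥ n)))))
    base : BaseFunction (layer k)
    base = record
      { submodular = λ X Y → subst₂ ℤ._≤_
          (cong₂ ℤ._+_ (sym (layer≡fix k (X ∪ Y))) (sym (layer≡fix k (X ∩ Y))))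
          (cong₂ ℤ._+_ (sym (layer≡fix k X)) (sym (layer≡fix k Y))) (submodular fixed X Y)
      ; h⊥≡0 = trans (layer≡fix k ⊥) (h⊥≡0 fixed)
      }
    between : ∀ {x} → Baseℤ (layer k) x → Between p b x
    between {x} (le , eq) X = subst (λ S → p S ℤ.≤ sumOnℤ x S) (∁-involutive X)
        (complement-bound (sumOnℤ-∁ x (∁ X)) (trans eq layer⊤) (ℤP.≤-trans (le (∁ X)) (ℤP.i⊓j≤j (b (∁ X)) _))) ,
      ℤP.≤-trans (le X) (ℤP.i⊓j≤i (b X) _)
    attach : ∀ {x} → Baseℤ (layer k) x → (∃ λ Y → D Y × (∀ i → x i ≡ χ Y i)) → ∃ λ Y → (D Y × ∣ Y ∣ ≡ k) × (∀ i → x i ≡ χ Y i)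
    attach (le , eq) (Y , DY , e) = Y , (DY , ℤP.+-injective (trans (sym (∑ℤ-χ Y)) (trans (sym (∑ℤ-cong e)) (trans eq layer⊤)))) , e

  -- From `k` to `suc k` the layer grows at `X` by 1 if `b X + p (∁ X)` exceeds `k`, and by 0
  -- otherwise. Submodularity of the lift makes `b X + p (∁ X)` monotone in `X`, hence the increment
  -- too.
  layer-nested : ∀ k → Nested (layer k) (layer (suc k))
  layer-nested k X Z = ≤-diffℤ _ _
    (min-exchange {b X} {ℤ.- p (∁ X)} {b (X ∪ Z)} {ℤ.- p (∁ (X ∪ Z))} (+ k)
      (subst₂ ℤ._≤_ (cong₂ (λ S T → ℤ.- p (∁ S) ℤ.+ b T) ∪-absorb ∩-absorb) refl
        (submodular (lift-base bounds) (inside ∷ X) (outside ∷ X ∪ Z))))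
    (lem (layer k X) (layer k (X ∪ Z)) (layer (suc k) X) (layer (suc k) (X ∪ Z)))
    where
    ∪-absorb : X ∪ (X ∪ Z) ≡ X ∪ Z
    ∪-absorb = trans (sym (SubP.∪-assoc X X Z)) (cong (_∪ Z) (SubP.∪-idem X))
    ∩-absorb : X ∩ (X ∪ Z) ≡ X
    ∩-absorb = SubP.∩-abs-∪ X Z
    lem : ∀ a a′ c c′ → c′ ℤ.+ a ℤ.- (a′ ℤ.+ c) ≡ c′ ℤ.- c ℤ.- (a′ ℤ.- a)
    lem = solve-∀

-- Minimisers of a convex function on the cube

val-cong : ∀ {n} (F : PolyConvFn n) {x y} → (∀ i → x i ≡ y i) → PolyConvFn.val F x ≡ PolyConvFn.val F y
val-cong F e = ℚP.≤-antisym (val-≤ e) (val-≤ (sym ∘ e))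
  where
  open PolyConvFn F
  val-≤ : ∀ {x y} → (∀ i → x i ≡ y i) → val x ℚ.≤ val y
  val-≤ {x} {y} e with val-attained F x
  ... | p , p∈ , eq = subst (ℚ._≤ val y) (sym (trans eq (cong (ℚ._+ proj₂ p) (⟨,⟩-congʳ (proj₁ p) e)))) (val-upper F y p∈)

-- `Agree` is local to `RestrictsTo` and computes only once `f x` is abstracted; the two cases are
-- exported here.
restriction : ∀ {n} {F : PolyConvFn n} {f : Vecℤ n → ℤ∞} → RestrictsTo F f → ∀ x →
  (∃ λ v → f x ≡ fin v × PolyConvFn.domF F (ιv x) × PolyConvFn.val F (ιv x) ≡ ι v)
  ⊎ (f x ≡ ∞ × (PolyConvFn.domF F (ιv x) → Empty))
restriction {f = f} R x with f x | R x
... | fin v | d , e = inj₁ (v , refl , d , e)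
... | ∞     | ¬d    = inj₂ (refl , ¬d)

fin-injective : ∀ {a b} → fin a ≡ fin b → a ≡ b
fin-injective refl = refl

χ-01 : ∀ {n} (Y : Subset n) i → (χ Y i ≡ + 0) ⊎ (χ Y i ≡ + 1)
χ-01 Y i with lookup Y i
... | true  = inj₂ refl
... | false = inj₁ refl

01-χ : ∀ {n} {x : Vecℤ n} → (∀ i → (x i ≡ + 0) ⊎ (x i ≡ + 1)) → ∃ λ Y → ∀ i → x i ≡ χ Y i
01-χ {x = x} h = tabulate (side ∘ h) , λ i → trans (side-χ (h i)) (cong (if_then + 1 else + 0) (sym (VecP.lookup∘tabulate (side ∘ h) i)))
  where
  side : ∀ {z} → (z ≡ + 0) ⊎ (z ≡ + 1) → Bool
  side (inj₁ _) = false
  side (inj₂ _) = true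
  side-χ : ∀ {z} (s : (z ≡ + 0) ⊎ (z ≡ + 1)) → z ≡ (if side s then + 1 else + 0)
  side-χ (inj₁ e) = e
  side-χ (inj₂ e) = e

allSubsets : ∀ n → List (Subset n)
allSubsets zero    = [] ∷ []
allSubsets (suc n) = List.map (inside ∷_) (allSubsets n) ++ List.map (outside ∷_) (allSubsets n)

∈-allSubsets : ∀ {n} (Y : Subset n) → Y ∈ allSubsets n
∈-allSubsets []            = here refl
∈-allSubsets (inside ∷ Y)  = ∈-++⁺ˡ (∈-map⁺ (inside ∷_) (∈-allSubsets Y))
∈-allSubsets (outside ∷ Y) = ∈-++⁺ʳ _ (∈-map⁺ (outside ∷_) (∈-allSubsets Y))

subset-of-size : ∀ {n k} → k ℕ.≤ n → ∃ λ (Y : Subset n) → ∣ Y ∣ ≡ k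
subset-of-size {zero}  ℕ.z≤n      = [] , refl
subset-of-size {suc n} ℕ.z≤n      with subset-of-size {n} ℕ.z≤n
... | Y , e = outside ∷ Y , e
subset-of-size         (ℕ.s≤s le) with subset-of-size le
... | Y , e = inside ∷ Y , cong suc e

-- If all atoms were above `c`, stripping by `φ − c` would leave no atom, against the total mass 1.
average-≤ : ∀ {A : Set} {P : Pred A 0ℓ} {M : Weights A} → IsConvex P M → ∀ φ {c} → wsum M φ ℚ.≤ c → ∃ λ a → P a × φ a ℚ.≤ c
average-≤ {A} {P} {M} (convex s one) φ {c} le with any? (λ q → φ (proj₂ q) ℚP.≤? c) M
... | yes some = let q , q∈ , le = find some in proj₂ q , proj₂ (All.lookup s q∈) , le
... | no none  = finish (wsum-strip (λ a → φ a ℚ.- c) proj₂ (positive s none) small)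
  where
  P⁺ : Pred A 0ℓ
  P⁺ a = P a × 0ℚ ℚ.≤ φ a ℚ.- c
  positive : ∀ {M} → Supported P M → (Any.Any (λ q → φ (proj₂ q) ℚ.≤ c) M → Empty) → Supported P⁺ M
  positive []               ¬le = []
  positive ((0≤μ , Pa) ∷ s) ¬le = (0≤μ , Pa , p≤q⇒0≤q-p (ℚP.<⇒≤ (ℚP.≰⇒> (¬le ∘ here)))) ∷ positive s (¬le ∘ there)
  small : wsum M (λ a → φ a ℚ.- c) ℚ.≤ 0ℚ
  small = subst (ℚ._≤ 0ℚ) (sym (trans (wsum-- M φ (λ _ → c)) (cong (ℚ._-_ (wsum M φ)) (wsum-const M one c)))) (p≤q⇒p-q≤0 le)
  finish : (∃ λ M′ → Supported (λ a → P⁺ a × φ a ℚ.- c ≡ 0ℚ) M′ × (∀ ψ → wsum M′ ψ ≡ wsum M ψ)) → ∃ λ a → P a × φ a ℚ.≤ c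
  finish ([] , _ , same) = contradiction (trans (same (λ _ → 1ℚ)) one) λ ()
  finish ((_ , a) ∷ _ , (_ , (Pa , _) , δ≡0) ∷ _ , _) = a , Pa , ℚP.≤-reflexive (p-q≡0⇒p≡q δ≡0)

wsum-neg : ∀ {A : Set} (M : Weights A) φ → wsum M (λ a → ℚ.- φ a) ≡ ℚ.- wsum M φ
wsum-neg []            φ = refl
wsum-neg ((μ , a) ∷ M) φ = trans (cong (ℚ._+_ (μ ℚ.* (ℚ.- φ a))) (wsum-neg M φ))
  (solve 3 (λ m f F → m :* (:- f) :+ (:- F) := :- (m :* f :+ F)) refl μ (φ a) (wsum M φ))

average-≥ : ∀ {A : Set} {P : Pred A 0ℓ} {M : Weights A} → IsConvex P M → ∀ φ {c} → c ℚ.≤ wsum M φ → ∃ λ a → P a × c ℚ.≤ φ a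
average-≥ {A} {P} {M} cvx φ {c} le = flip-sign (average-≤ cvx (λ a → ℚ.- φ a) {ℚ.- c}
  (subst (ℚ._≤ ℚ.- c) (sym (wsum-neg M φ)) (ℚP.neg-antimono-≤ le)))
  where
  flip-sign : (∃ λ a → P a × ℚ.- φ a ℚ.≤ ℚ.- c) → ∃ λ a → P a × c ℚ.≤ φ a
  flip-sign (a , Pa , le′) = a , Pa , ≤-diffℚ (ℚ.- φ a) (ℚ.- c) le′ (solve 2 (λ f c → (:- c) :- (:- f) := f :- c) refl (φ a) c)

-- Two consecutive layers come from one generalized polymatroid, but different steps may come from
-- different ones, so nestedness is recorded step by step.
record FlagStep {n} (A : ℕ → Pred (Subset n) 0ℓ) (k : ℕ) : Set where
  field
    r⁻ r⁺  : Subset n → ℤ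
    rank⁻  : IsRank (A k) r⁻
    rank⁺  : IsRank (A (suc k)) r⁺
    nested : Nested r⁻ r⁺

IsRank-resp : ∀ {n} {A B : Pred (Subset n) 0ℓ} {r} → (∀ {Y} → A Y → B Y) → (∀ {Y} → B Y → A Y) → IsRank A r → IsRank B r
IsRank-resp to from R = record
  { isBase = isBase R
  ; sound = λ x∈ → let Y , AY , e = sound R x∈ in Y , to AY , e
  ; complete = complete R ∘ from
  }

module _ {n} {D : Pred (Subset n) 0ℓ} (G : GenMatroid D) where
  open Layers G

  layer-step : ∀ {k} → (∃ λ Y → D Y × ∣ Y ∣ ℕ.≤ k) → (∃ λ Y → D Y × suc k ℕ.≤ ∣ Y ∣) → FlagStep (λ k Y → D Y × ∣ Y ∣ ≡ k) k
  layer-step {k} (Y₁ , D₁ , small) (Y₂ , D₂ , large) = record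
    { r⁻ = layer k ; r⁺ = layer (suc k)
    ; rank⁻ = layer-rank (Y₁ , D₁ , small) (Y₂ , D₂ , ℕP.<⇒≤ large)
    ; rank⁺ = layer-rank (Y₁ , D₁ , ℕP.m≤n⇒m≤1+n small) (Y₂ , D₂ , large)
    ; nested = layer-nested k
    }

module ConvexOnCube {n} (f : Vecℤ n → ℤ∞) (F : PolyConvFn n) (via : IsMNatConvexVia F f)
  (cube : ∀ x → (Dom f x → ∀ i → (x i ≡ + 0) ⊎ (x i ≡ + 1)) × ((∀ i → (x i ≡ + 0) ⊎ (x i ≡ + 1)) → Dom f x)) where
  open PolyConvFn F

  fv : Subset n → ℤ
  fv Y = proj₁ (proj₂ (cube (χ Y)) (χ-01 Y))

  f-χ : ∀ Y → f (χ Y) ≡ fin (fv Y)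
  f-χ Y = proj₂ (proj₂ (cube (χ Y)) (χ-01 Y))

  F-χ : ∀ Y → domF (ιv (χ Y)) × val (ιv (χ Y)) ≡ ι (fv Y)
  F-χ Y with restriction (proj₁ via) (χ Y)
  ... | inj₁ (v , e , d , e′) = d , trans e′ (cong ι (fin-injective (trans (sym e) (f-χ Y))))
  ... | inj₂ (e , _) = contradiction (trans (sym e) (f-χ Y)) λ ()

  integral-point : ∀ {x} → domF (ιv x) → ∃ λ Y → ∀ i → x i ≡ χ Y i
  integral-point {x} d with restriction (proj₁ via) x
  ... | inj₁ (v , e , _) = 01-χ (proj₁ (cube x) (v , e))
  ... | inj₂ (_ , ¬d)    = Empty-elim (¬d d)

  Φ : Vecℚ n → Subset n → ℚ
  Φ w Y = ι (fv Y) ℚ.- ⟨ w , ιv (χ Y) ⟩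

  Φ-val : ∀ w {x} Y → (∀ i → x i ≡ χ Y i) → Φ w Y ≡ val (ιv x) ℚ.- ⟨ w , ιv x ⟩
  Φ-val w {x} Y e = cong₂ ℚ._-_ (trans (sym (proj₂ (F-χ Y))) (val-cong F (λ i → cong ι (sym (e i)))))
    (⟨,⟩-congʳ w (λ i → cong ι (sym (e i))))

  private
    IntBoundsOf : Pred (Vecℚ n) 0ℓ → Set
    IntBoundsOf P = ∃ λ b → ∃ λ p → IntBounds b p × (P ≐ λ x → ∀ X → ι (p X) ℚ.≤ sumOn x X × sumOn x X ℚ.≤ ι (b X))

  -- A piece attaining the maximum at y is a subgradient a there, and ⟨ a − w , _ ⟩ is minimised over the linearity
  -- domain of a at an integral point.
  Φ-below : ∀ w {y} → domF y → ∃ λ Y → Φ w Y ℚ.≤ val y ℚ.- ⟨ w , y ⟩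
  Φ-below w {y} dom = from-piece (val-attained F y)
    where
    from-piece : (∃ λ p → p ∈ List⁺.toList pieces × val y ≡ piece F y p) → ∃ λ Y → Φ w Y ℚ.≤ val y ℚ.- ⟨ w , y ⟩
    from-piece ((a , b₀) , p∈ , eq) = from-bounds (int-gpolymatroid (proj₂ (proj₂ via) a (y , y∈)))
      where
      a-w : Vecℚ n
      a-w i = a i ℚ.+ ℚ.- w i
      ⟨a-w,⟩ : ∀ x → ⟨ a-w , x ⟩ ≡ ⟨ a , x ⟩ ℚ.- ⟨ w , x ⟩
      ⟨a-w,⟩ x = trans (⟨,⟩-+ˡ a (λ i → ℚ.- w i) x) (cong (ℚ._+_ ⟨ a , x ⟩) (⟨,⟩-negˡ w x))
      y∈ : LinDom a y
      y∈ = dom , λ z _ → ≤-diffℚ _ _ (val-upper F z p∈) (trans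
        (solve 3 (λ v a b → v :- (a :+ b) := v :- a :- b) refl (val z) ⟨ a , z ⟩ b₀)
        (cong (ℚ._-_ (val z ℚ.- ⟨ a , z ⟩)) (trans (solve 2 (λ a b → b := a :+ b :- a) refl ⟨ a , y ⟩ b₀) (cong (ℚ._- ⟨ a , y ⟩) (sym eq)))))
      from-bounds : IntBoundsOf (LinDom a) → ∃ λ Y → Φ w Y ℚ.≤ val y ℚ.- ⟨ w , y ⟩
      from-bounds (b , p , I , P≐) = from-optimum (integral-optimum I a-w y (proj₁ (P≐ y) y∈))
        where
        from-optimum : (∃ λ x → Between p b x × ⟨ a-w , ιv x ⟩ ℚ.≤ ⟨ a-w , y ⟩) → ∃ λ Y → Φ w Y ℚ.≤ val y ℚ.- ⟨ w , y ⟩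
        from-optimum (x , btw , le) = attach (integral-point (proj₁ x∈))
          where
          x∈ : LinDom a (ιv x)
          x∈ = proj₂ (P≐ (ιv x)) λ X → subst (ι (p X) ℚ.≤_) (sym (sumOn-ι x X)) (ι-mono (proj₁ (btw X))) ,
                                       subst (ℚ._≤ ι (b X)) (sym (sumOn-ι x X)) (ι-mono (proj₂ (btw X)))
          shift : ∀ v z → v ℚ.- ⟨ a , z ⟩ ℚ.+ ⟨ a-w , z ⟩ ≡ v ℚ.- ⟨ w , z ⟩
          shift v z = trans (cong (ℚ._+_ (v ℚ.- ⟨ a , z ⟩)) (⟨a-w,⟩ z))
            (solve 3 (λ v a w → v :- a :+ (a :- w) := v :- w) refl v ⟨ a , z ⟩ ⟨ w , z ⟩)
          attach : (∃ λ Y → ∀ i → x i ≡ χ Y i) → ∃ λ Y → Φ w Y ℚ.≤ val y ℚ.- ⟨ w , y ⟩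
          attach (Y , e) = Y , subst₂ ℚ._≤_ (trans (shift (val (ιv x)) (ιv x)) (sym (Φ-val w Y e))) (shift (val y) y)
            (ℚP.+-mono-≤ (proj₂ x∈ y dom) le)

  Minimiser : Vecℚ n → Pred (Subset n) 0ℓ
  Minimiser w Y = ∀ Z → Φ w Y ℚ.≤ Φ w Z

  minimiser : ∀ w → ∃ (Minimiser w)
  minimiser w = subset-min ℚP.≤-total ℚP.≤-trans (Φ w)

  -- By `Φ-below` no rational point of the domain does better than the best subset.
  minimiser-LinDom : ∀ w Y → Minimiser w Y → LinDom w (ιv (χ Y))
  minimiser-LinDom w Y min = proj₁ (F-χ Y) , λ y dom → let Z , le = Φ-below w dom in
    ℚP.≤-trans (ℚP.≤-reflexive (sym (Φ-val w {χ Y} Y (λ _ → refl)))) (ℚP.≤-trans (min Z) le)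

  minimiser-matroid : ∀ w → GenMatroid (Minimiser w)
  minimiser-matroid w = gen-matroid
    (proj₂ (proj₂ via) w (ιv (χ (proj₁ (minimiser w))) , minimiser-LinDom w (proj₁ (minimiser w)) (proj₂ (minimiser w))))
    from (λ {Y} → minimiser-LinDom w Y)
    where
    from : ∀ {x} → LinDom w (ιv x) → ∃ λ Y → Minimiser w Y × (∀ i → x i ≡ χ Y i)
    from {x} (d , min) with integral-point {x} d
    ... | Y , e = Y , (λ Z → subst₂ ℚ._≤_ (sym (Φ-val w Y e)) (sym (Φ-val w {χ Z} Z (λ _ → refl))) (min (ιv (χ Z)) (proj₁ (F-χ Z)))) , e

  cube-matroid : GenMatroid (λ _ → Unit)
  cube-matroid = gen-matroid (proj₁ (proj₂ via)) (λ d → let Y , e = integral-point d in Y , tt , e) (λ {Y} _ → proj₁ (F-χ Y))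

  -- The run without minimisation: the layers of the cube are the uniform matroids.
  cube-step : ∀ {k} → k ℕ.< n → FlagStep (λ k Y → ∣ Y ∣ ≡ k) k
  cube-step {k} k<n = record
    { r⁻ = r⁻ ; r⁺ = r⁺ ; rank⁻ = IsRank-resp proj₂ (tt ,_) rank⁻ ; rank⁺ = IsRank-resp proj₂ (tt ,_) rank⁺ ; nested = nested }
    where
    sized : ∀ {j} → j ℕ.≤ n → ∃ λ Y → Unit × ∣ Y ∣ ≡ j
    sized j≤n = let Y , e = subset-of-size j≤n in Y , tt , e
    small : ∃ λ Y → Unit × ∣ Y ∣ ℕ.≤ k
    small = let Y , _ , e = sized (ℕP.<⇒≤ k<n) in Y , tt , ℕP.≤-reflexive e
    large : ∃ λ Y → Unit × suc k ℕ.≤ ∣ Y ∣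
    large = let Y , _ , e = sized k<n in Y , tt , ℕP.≤-reflexive (sym e)
    open FlagStep (layer-step cube-matroid small large)

  LayerMin : Vecℚ n → ℕ → Pred (Subset n) 0ℓ
  LayerMin w k Y = ∣ Y ∣ ≡ k × (∀ Z → ∣ Z ∣ ≡ k → Φ w Y ℚ.≤ Φ w Z)

  shift : Vecℚ n → ℚ → Vecℚ n
  shift w t i = w i ℚ.+ t

  ⟨const,χ⟩ : ∀ t (Y : Subset n) → ⟨ (λ _ → t) , ιv (χ Y) ⟩ ≡ t ℚ.* ι (+ ∣ Y ∣)
  ⟨const,χ⟩ t Y = trans (∑ℚ-*ˡ t (ιv (χ Y))) (cong (t ℚ.*_) (trans (sym (∑ℤ-ι (χ Y))) (cong ι (∑ℤ-χ Y))))

  Φ-shift : ∀ w t Y → Φ (shift w t) Y ≡ Φ w Y ℚ.- t ℚ.* ι (+ ∣ Y ∣)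
  Φ-shift w t Y = trans (cong (ℚ._-_ (ι (fv Y))) (trans (⟨,⟩-+ˡ w (λ _ → t) (ιv (χ Y))) (cong (ℚ._+_ ⟨ w , ιv (χ Y) ⟩) (⟨const,χ⟩ t Y))))
    (solve 3 (λ a b c → a :- (b :+ c) := a :- b :- c) refl (ι (fv Y)) ⟨ w , ιv (χ Y) ⟩ (t ℚ.* ι (+ ∣ Y ∣)))

  -- t is a slope at k + ½ of the convex envelope of the function  ∣ Y ∣ ↦ Φ w Y  of one variable.
  module Slope (w : Vecℚ n) (E : Envelope {n = 1} (allSubsets n) (λ Y _ → ι (+ ∣ Y ∣)) (Φ w)) {k} (k<n : k ℕ.< n) where

    size : Subset n → ℚ
    size Y = ι (+ ∣ Y ∣)

    Y₁ = subset-of-size (ℕP.<⇒≤ k<n)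
    Y₂ = subset-of-size k<n

    -- The midpoint of a set of size k and one of size k + 1 shows that k + ½ lies in the domain of
    -- the envelope.
    M : Weights (Subset n)
    M = (½ , proj₁ Y₁) ∷ (½ , proj₁ Y₂) ∷ []

    M-convex : IsConvex (_∈ allSubsets n) M
    M-convex = convex ((ℚP.nonNegative⁻¹ ½ , ∈-allSubsets _) ∷ (ℚP.nonNegative⁻¹ ½ , ∈-allSubsets _) ∷ []) refl

    M-size : wsum M size ≡ ι (+ k) ℚ.+ ½
    M-size = trans (cong₂ (λ a b → ½ ℚ.* ι (+ a) ℚ.+ (½ ℚ.* ι (+ b) ℚ.+ 0ℚ)) (proj₂ Y₁) (proj₂ Y₂))
      (trans (cong (λ z → ½ ℚ.* ι (+ k) ℚ.+ (½ ℚ.* z ℚ.+ 0ℚ)) (ι-+ (+ 1) (+ k)))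
        (solve 1 (λ k → con ½ :* k :+ (con ½ :* (con 1ℚ :+ k) :+ con 0ℚ) := k :+ con ½) refl (ι (+ k))))

    half< : ι (+ k) ℚ.+ ½ ℚ.< ι (+ suc k)
    half< = subst (ι (+ k) ℚ.+ ½ ℚ.<_) (trans (ℚP.+-comm (ι (+ k)) 1ℚ) (sym (ι-+ (+ 1) (+ k)))) (ℚP.+-monoʳ-< (ι (+ k)) (ℚ.*<* (ℤ.+<+ (ℕ.s≤s (ℕ.s≤s ℕ.z≤n)))))

    <half : ι (+ k) ℚ.< ι (+ k) ℚ.+ ½
    <half = subst (ℚ._< ι (+ k) ℚ.+ ½) (ℚP.+-identityʳ (ι (+ k))) (ℚP.+-monoʳ-< (ι (+ k)) (ℚP.positive⁻¹ ½))

    size-≤ : ∀ {Y} → size Y ℚ.≤ ι (+ k) ℚ.+ ½ → ∣ Y ∣ ℕ.≤ k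
    size-≤ le = ℕP.≮⇒≥ λ lt → ℚP.<-irrefl refl (ℚP.<-≤-trans half< (ℚP.≤-trans (ι-mono (ℤ.+≤+ lt)) le))

    size-≥ : ∀ {Y} → ι (+ k) ℚ.+ ½ ℚ.≤ size Y → suc k ℕ.≤ ∣ Y ∣
    size-≥ ge = ℕP.≰⇒> λ le → ℚP.<-irrefl refl (ℚP.<-≤-trans <half (ℚP.≤-trans ge (ι-mono (ℤ.+≤+ le))))

    Straddles : ℚ → Set
    Straddles t = (∃ λ Y → Minimiser (shift w t) Y × ∣ Y ∣ ℕ.≤ k) × (∃ λ Y → Minimiser (shift w t) Y × suc k ℕ.≤ ∣ Y ∣)

    -- Atoms on which an affine minorant of slope `t` is exact minimise `Φ w − t ∣·∣`; their mean
    -- size k + ½ forces sizes on both sides.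
    straddle : ∃ Straddles
    straddle = from-tight (tight-represent E {λ _ → wsum M size} (domF-wsum E M M-convex (λ _ → refl)))
      where
      from-tight : TightRepresentation E (λ _ → wsum M size) → ∃ Straddles
      from-tight (a , b , minorant , _ , M′ , cvx , e) = t , low (average-≤ cvx size (ℚP.≤-reflexive mean)) , high (average-≥ cvx size (ℚP.≤-reflexive (sym mean)))
        where
        t = a Fin.zero
        Tight : Subset n → Set
        Tight Y = Y ∈ allSubsets n × Φ w Y ≡ ⟨ a , (λ _ → size Y) ⟩ ℚ.+ b
        ⟨a,⟩ : ∀ Y → ⟨ a , (λ _ → size Y) ⟩ ≡ t ℚ.* size Y
        ⟨a,⟩ Y = ℚP.+-identityʳ _
        minimises : ∀ {Y} → Tight Y → Minimiser (shift w t) Y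
        minimises {Y} (_ , tight) Z = subst₂ ℚ._≤_ (sym (trans (Φ-shift w t Y) (trans (cong₂ ℚ._-_ tight (sym (⟨a,⟩ Y)))
            (solve 2 (λ a b → a :+ b :- a := b) refl ⟨ a , (λ _ → size Y) ⟩ b)))) (sym (Φ-shift w t Z))
          (≤-diffℚ _ _ (minorant Z (∈-allSubsets Z)) (trans (cong (λ z → Φ w Z ℚ.- (z ℚ.+ b)) (⟨a,⟩ Z))
            (solve 3 (λ f a b → f :- (a :+ b) := f :- a :- b) refl (Φ w Z) (t ℚ.* size Z) b)))
        mean : wsum M′ size ≡ ι (+ k) ℚ.+ ½
        mean = trans (sym (e Fin.zero)) M-size
        low : (∃ λ Y → Tight Y × size Y ℚ.≤ ι (+ k) ℚ.+ ½) → ∃ λ Y → Minimiser (shift w t) Y × ∣ Y ∣ ℕ.≤ k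
        low (Y , tight , le) = Y , minimises {Y} tight , size-≤ {Y} le
        high : (∃ λ Y → Tight Y × ι (+ k) ℚ.+ ½ ℚ.≤ size Y) → ∃ λ Y → Minimiser (shift w t) Y × suc k ℕ.≤ ∣ Y ∣
        high (Y , tight , ge) = Y , minimises {Y} tight , size-≥ {Y} ge

  rank-member : ∀ {A : Pred (Subset n) 0ℓ} {r} → IsRank A r → ∃ A
  rank-member R = let Y , AY , _ = sound R (greedy-base (isBase R)) in Y , AY

  -- The shift is constant on sets of one size. Since the global minimum of the shifted function is
  -- attained at size `k`, by `Z`, minimality within the size is global minimality.
  shift-layer : ∀ w t {k} Z → Minimiser (shift w t) Z × ∣ Z ∣ ≡ k →
    ∀ Y → (Minimiser (shift w t) Y × ∣ Y ∣ ≡ k → LayerMin w k Y) × (LayerMin w k Y → Minimiser (shift w t) Y × ∣ Y ∣ ≡ k)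
  shift-layer w t {k} Z (minZ , ∣Z∣) Y = to , from
    where
    same-size : ∀ X W → ∣ X ∣ ≡ k → ∣ W ∣ ≡ k → Φ (shift w t) W ℚ.- Φ (shift w t) X ≡ Φ w W ℚ.- Φ w X
    same-size X W eX eW = trans (cong₂ ℚ._-_ (trans (Φ-shift w t W) (cong (λ m → Φ w W ℚ.- t ℚ.* ι (+ m)) eW))
        (trans (Φ-shift w t X) (cong (λ m → Φ w X ℚ.- t ℚ.* ι (+ m)) eX)))
      (solve 3 (λ f g c → (f :- c) :- (g :- c) := f :- g) refl (Φ w W) (Φ w X) (t ℚ.* ι (+ k)))
    to : Minimiser (shift w t) Y × ∣ Y ∣ ≡ k → LayerMin w k Y
    to (min , e) = e , λ W eW → ≤-diffℚ _ _ (min W) (same-size Y W e eW)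
    from : LayerMin w k Y → Minimiser (shift w t) Y × ∣ Y ∣ ≡ k
    from (e , min) = (λ W → ℚP.≤-trans (≤-diffℚ _ _ (min Z ∣Z∣) (sym (same-size Y Z e ∣Z∣))) (minZ W)) , e

  -- The slope depends on `k`, but the two families described do not depend on the slope.
  layerMin-step : ∀ w {k} → k ℕ.< n → FlagStep (LayerMin w) k
  layerMin-step w {k} k<n = from-straddle (Slope.straddle w (envelope (allSubsets n) (λ Y _ → ι (+ ∣ Y ∣)) (Φ w)) k<n)
    where
    from-straddle : (∃ λ t → (∃ λ Y → Minimiser (shift w t) Y × ∣ Y ∣ ℕ.≤ k) × (∃ λ Y → Minimiser (shift w t) Y × suc k ℕ.≤ ∣ Y ∣)) →
      FlagStep (LayerMin w) k
    from-straddle (t , small , large) = record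
      { r⁻ = r⁻ ; r⁺ = r⁺ ; rank⁻ = convert rank⁻ ; rank⁺ = convert rank⁺ ; nested = nested }
      where
      open FlagStep (layer-step (minimiser-matroid (shift w t)) small large)
      convert : ∀ {j r} → IsRank (λ Y → Minimiser (shift w t) Y × ∣ Y ∣ ≡ j) r → IsRank (LayerMin w j) r
      convert R with rank-member R
      ... | Z , Z∈ = IsRank-resp (λ {Y} → proj₁ (shift-layer w t Z Z∈ Y)) (λ {Y} → proj₂ (shift-layer w t Z Z∈ Y)) R

-- Chains of subsets and permutation vectors

injective⇒permutation : ∀ {n} (f : Fin n → Fin n) → Injective _≡_ _≡_ f → ∃ λ (π : Permutation n n) → ∀ i → π ⟨$⟩ʳ i ≡ f i
injective⇒permutation {n} f inj = permutation f (proj₁ ∘ surj) (λ j → proj₂ (surj j)) (λ i → inj (proj₂ (surj (f i)))) , λ _ → refl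
  where
  missed : ∀ {n} (f : Fin n → Fin n) → Injective _≡_ _≡_ f → ∀ j → (∀ i → f i ≢ j) → Empty
  missed {suc n} f inj j f≢j = ℕP.1+n≰n (FinP.injective⇒≤ {f = λ i → Fin.punchOut (f≢j i ∘ sym)}
    (λ {i} {i′} e → inj (FinP.punchOut-injective (f≢j i ∘ sym) (f≢j i′ ∘ sym) e)))
  surj : ∀ j → ∃ λ i → f i ≡ j
  surj j with FinP.any? (λ i → f i FinP.≟ j)
  ... | yes hit = hit
  ... | no ¬hit = Empty-elim (missed f inj j (λ i e → ¬hit (i , e)))

Upward : ∀ {m} → Subset m → Set
Upward S = ∀ α β → toℕ α ℕ.≤ toℕ β → lookup S α ≡ true → lookup S β ≡ true

-- An up-set of a finite chain is a final segment. An up-set containing the first index is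
-- everything, hence larger than any set omitting that index.
upward-unique : ∀ {m} (S T : Subset m) → Upward S → Upward T → ∣ S ∣ ≡ ∣ T ∣ → S ≡ T
upward-unique []          []          _  _  _ = refl
upward-unique (true  ∷ S) (true  ∷ T) uS uT e = cong (true ∷_)
  (upward-unique S T (λ α β le → uS (Fin.suc α) (Fin.suc β) (ℕ.s≤s le)) (λ α β le → uT (Fin.suc α) (Fin.suc β) (ℕ.s≤s le)) (ℕP.suc-injective e))
upward-unique (false ∷ S) (false ∷ T) uS uT e = cong (false ∷_)
  (upward-unique S T (λ α β le → uS (Fin.suc α) (Fin.suc β) (ℕ.s≤s le)) (λ α β le → uT (Fin.suc α) (Fin.suc β) (ℕ.s≤s le)) e)
upward-unique (true  ∷ S) (false ∷ T) uS uT e = contradiction (full {S = S} {T} uS e) ℕP.1+n≰n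
  where
  full : ∀ {m} {S T : Subset m} → Upward (true ∷ S) → suc ∣ S ∣ ≡ ∣ T ∣ → suc m ℕ.≤ m
  full {m} {S} {T} u e = subst (ℕ._≤ m) (trans (sym e) (cong suc (trans (cong ∣_∣ S≡⊤) (SubP.∣⊤∣≡n m)))) (SubP.∣p∣≤n T)
    where
    S≡⊤ : S ≡ ⊤
    S≡⊤ = lookup-ext λ i → trans (u Fin.zero (Fin.suc i) ℕ.z≤n refl) (sym (VecP.lookup-replicate i true))
upward-unique (false ∷ S) (true  ∷ T) uS uT e = sym (upward-unique (true ∷ T) (false ∷ S) uT uS (sym e))

_⊑_ : ∀ {n} → Subset n → Subset n → Set
X ⊑ Y = ∀ i → lookup X i ≡ true → lookup Y i ≡ true

⊑-size : ∀ {n} (X Y : Subset n) → X ⊑ Y → ∣ X ∣ ℕ.≤ ∣ Y ∣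
⊑-size []          []          le = ℕ.z≤n
⊑-size (true  ∷ X) (true  ∷ Y) le = ℕ.s≤s (⊑-size X Y (le ∘ Fin.suc))
⊑-size (false ∷ X) (true  ∷ Y) le = ℕP.m≤n⇒m≤1+n (⊑-size X Y (le ∘ Fin.suc))
⊑-size (false ∷ X) (false ∷ Y) le = ⊑-size X Y (le ∘ Fin.suc)
⊑-size (true  ∷ X) (false ∷ Y) le = contradiction (le Fin.zero refl) λ ()

⊑-size-1 : ∀ {n} (X Y : Subset n) → X ⊑ Y → ∀ i → lookup X i ≡ false → lookup Y i ≡ true → suc ∣ X ∣ ℕ.≤ ∣ Y ∣
⊑-size-1 (false ∷ X) (true  ∷ Y) le Fin.zero    _ _ = ℕ.s≤s (⊑-size X Y (le ∘ Fin.suc))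
⊑-size-1 (true  ∷ X) (true  ∷ Y) le (Fin.suc i) p q = ℕ.s≤s (⊑-size-1 X Y (le ∘ Fin.suc) i p q)
⊑-size-1 (false ∷ X) (true  ∷ Y) le (Fin.suc i) p q = ℕP.m≤n⇒m≤1+n (⊑-size-1 X Y (le ∘ Fin.suc) i p q)
⊑-size-1 (false ∷ X) (false ∷ Y) le (Fin.suc i) p q = ⊑-size-1 X Y (le ∘ Fin.suc) i p q
⊑-size-1 (true  ∷ X) (false ∷ Y) le (Fin.suc i) p q = contradiction (le Fin.zero refl) λ ()

⊑-size-2 : ∀ {n} (X Y : Subset n) → X ⊑ Y → ∀ i j → i ≢ j → lookup X i ≡ false → lookup X j ≡ false →
  lookup Y i ≡ true → lookup Y j ≡ true → suc (suc ∣ X ∣) ℕ.≤ ∣ Y ∣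
⊑-size-2 X           Y           le Fin.zero    Fin.zero    ne _  _  _  _  = contradiction refl ne
⊑-size-2 (false ∷ X) (true  ∷ Y) le Fin.zero    (Fin.suc j) ne _  xj _  yj = ℕ.s≤s (⊑-size-1 X Y (le ∘ Fin.suc) j xj yj)
⊑-size-2 (false ∷ X) (true  ∷ Y) le (Fin.suc i) Fin.zero    ne xi _  yi _  = ℕ.s≤s (⊑-size-1 X Y (le ∘ Fin.suc) i xi yi)
⊑-size-2 (true  ∷ X) (true  ∷ Y) le (Fin.suc i) (Fin.suc j) ne xi xj yi yj =
  ℕ.s≤s (⊑-size-2 X Y (le ∘ Fin.suc) i j (ne ∘ cong Fin.suc) xi xj yi yj)
⊑-size-2 (false ∷ X) (true  ∷ Y) le (Fin.suc i) (Fin.suc j) ne xi xj yi yj =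
  ℕP.m≤n⇒m≤1+n (⊑-size-2 X Y (le ∘ Fin.suc) i j (ne ∘ cong Fin.suc) xi xj yi yj)
⊑-size-2 (false ∷ X) (false ∷ Y) le (Fin.suc i) (Fin.suc j) ne xi xj yi yj =
  ⊑-size-2 X Y (le ∘ Fin.suc) i j (ne ∘ cong Fin.suc) xi xj yi yj
⊑-size-2 (true  ∷ X) (false ∷ Y) le (Fin.suc i) (Fin.suc j) ne xi xj yi yj = contradiction (le Fin.zero refl) λ ()

point : ∀ {m n} → Vec (Subset n) m → Vecℤ n
point Ys i = ∑ℤ (λ α → χ (lookup Ys α) i)

Chain : ∀ {m n} → Vec (Subset n) m → Set
Chain Ys = ∀ α β → toℕ α ℕ.≤ toℕ β → lookup Ys α ⊑ lookup Ys β

chain? : ∀ {m n} → Decidable (Chain {m} {n})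
chain? Ys = FinP.all? λ α → FinP.all? λ β → (toℕ α ℕP.≤? toℕ β) →-dec
  FinP.all? λ i → (lookup (lookup Ys α) i Bool.≟ true) →-dec (lookup (lookup Ys β) i Bool.≟ true)

module _ {m} (Ys : Vec (Subset (suc m)) (suc m)) (chain : Chain Ys) (sizes : ∀ α → ∣ lookup Ys α ∣ ≡ suc (toℕ α)) where

  private
    -- The indices of the sets that contain `i`. It is an up-set, determined by its size, which is
    -- the coordinate of `point Ys` at `i`; so distinct columns give distinct coordinates.
    column : Fin (suc m) → Subset (suc m)
    column i = tabulate (λ α → lookup (lookup Ys α) i)

    column-lookup : ∀ i α → lookup (column i) α ≡ lookup (lookup Ys α) i
    column-lookup i = VecP.lookup∘tabulate (λ α → lookup (lookup Ys α) i)

    point-column : ∀ i → point Ys i ≡ + ∣ column i ∣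
    point-column i = trans (∑ℤ-cong (λ α → cong (if_then + 1 else + 0) (sym (column-lookup i α)))) (∑ℤ-χ (column i))

    column-upward : ∀ i → Upward (column i)
    column-upward i α β le e = trans (column-lookup i β) (chain α β le i (trans (sym (column-lookup i α)) e))

    ⊥-lookup : ∀ l → lookup {n = suc m} ⊥ l ≡ false
    ⊥-lookup l = VecP.lookup-replicate l false

    ⊥⊑ : ∀ X → ⊥ ⊑ X
    ⊥⊑ X l e = contradiction (trans (sym e) (⊥-lookup l)) λ ()

    last-full : ∀ i → lookup (lookup Ys (Fin.fromℕ m)) i ≡ true
    last-full i = trans (cong (λ S → lookup S i)
      (SubP.∣p∣≡n⇒p≡⊤ {p = lookup Ys (Fin.fromℕ m)} (trans (sizes (Fin.fromℕ m)) (cong suc (FinP.toℕ-fromℕ m)))))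
      (VecP.lookup-replicate i true)

    -- Each step of the chain adds one element only, so two elements with the same column are never added.
    separated : ∀ i j → i ≢ j → column i ≢ column j
    separated i j i≢j same = contradiction (trans (sym (outside-all (Fin.fromℕ m))) (last-full i)) λ ()
      where
      same-side : ∀ α → lookup (lookup Ys α) i ≡ lookup (lookup Ys α) j
      same-side α = trans (sym (column-lookup i α)) (trans (cong (λ S → lookup S α) same) (column-lookup j α))
      outside-by : ∀ X α → X ⊑ lookup Ys α → suc ∣ X ∣ ≡ ∣ lookup Ys α ∣ → lookup X i ≡ false → lookup X j ≡ false → lookup (lookup Ys α) i ≡ false
      outside-by X α X⊑ e xi xj with lookup (lookup Ys α) i in yi
      ... | false = refl
      ... | true  = contradiction (ℕP.≤-trans (⊑-size-2 X (lookup Ys α) X⊑ i j i≢j xi xj yi (trans (sym (same-side α)) yi)) (ℕP.≤-reflexive (sym e))) ℕP.1+n≰n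
      outside-all : ∀ α → lookup (lookup Ys α) i ≡ false
      outside-all = FinI.<-weakInduction (λ α → lookup (lookup Ys α) i ≡ false)
        -- The empty set acts as predecessor of the first set, which has a single element.
        (outside-by ⊥ Fin.zero (⊥⊑ (lookup Ys Fin.zero)) (trans (cong suc (SubP.∣⊥∣≡0 (suc m))) (sym (sizes Fin.zero))) (⊥-lookup i) (⊥-lookup j))
        λ α out → outside-by (lookup Ys (Fin.inject₁ α)) (Fin.suc α)
          (chain (Fin.inject₁ α) (Fin.suc α) (ℕP.≤-trans (ℕP.≤-reflexive (FinP.toℕ-inject₁ α)) (ℕP.n≤1+n _)))
          (trans (cong suc (trans (sizes (Fin.inject₁ α)) (cong suc (FinP.toℕ-inject₁ α)))) (sym (sizes (Fin.suc α))))
          out (trans (sym (same-side (Fin.inject₁ α))) out)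

    positive : ∀ i → 0 ℕ.< ∣ column i ∣
    positive i = subst (λ k → suc k ℕ.≤ ∣ column i ∣) (SubP.∣⊥∣≡0 (suc m))
      (⊑-size-1 ⊥ (column i) (⊥⊑ (column i)) (Fin.fromℕ m) (⊥-lookup (Fin.fromℕ m)) (trans (column-lookup i (Fin.fromℕ m)) (last-full i)))

    suc-pred-size : ∀ i → suc (ℕ.pred ∣ column i ∣) ≡ ∣ column i ∣
    suc-pred-size i = ℕP.suc-pred ∣ column i ∣ {{ℕ.>-nonZero (positive i)}}

    bound : ∀ i → ℕ.pred ∣ column i ∣ ℕ.< suc m
    bound i = ℕP.≤-trans (ℕP.≤-reflexive (suc-pred-size i)) (SubP.∣p∣≤n (column i))

    rank : Fin (suc m) → Fin (suc m)
    rank i = Fin.fromℕ< (bound i)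

    toℕ-rank : ∀ i → suc (toℕ (rank i)) ≡ ∣ column i ∣
    toℕ-rank i = trans (cong suc (FinP.toℕ-fromℕ< (bound i))) (suc-pred-size i)

    rank-injective : Injective _≡_ _≡_ rank
    rank-injective {i} {j} e with i FinP.≟ j
    ... | yes i≡j = i≡j
    ... | no i≢j  = contradiction (upward-unique (column i) (column j) (column-upward i) (column-upward j)
            (trans (sym (toℕ-rank i)) (trans (cong (suc ∘ toℕ) e) (toℕ-rank j)))) (separated i j i≢j)

  chain-point-permVec : IsPermVec (point Ys)
  chain-point-permVec = let π , π≡rank = injective⇒permutation rank rank-injective in π ,
    λ i → trans (point-column i) (trans (cong +_ (sym (toℕ-rank i))) (cong (λ j → + suc (toℕ j)) (sym (π≡rank i))))

chain-permutation : ∀ {n} (Ys : Vec (Subset n) n) → Chain Ys → (∀ α → ∣ lookup Ys α ∣ ≡ suc (toℕ α)) → IsPermVec (point Ys)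
chain-permutation {zero}  Ys chain sizes = Perm.id , λ ()
chain-permutation {suc m} Ys chain sizes = chain-point-permVec Ys chain sizes

-- Flags of matroids and the sum of their rank functions

allVecs : ∀ {B : Set} → List B → ∀ m → List (Vec B m)
allVecs L zero    = [] ∷ []
allVecs L (suc m) = cartesianProductWith _∷_ L (allVecs L m)

∈-allVecs : ∀ {B : Set} {L : List B} → (∀ b → b ∈ L) → ∀ {m} (v : Vec B m) → v ∈ allVecs L m
∈-allVecs all []      = here refl
∈-allVecs all (b ∷ v) = ∈-cartesianProductWith⁺ _∷_ (all b) (∈-allVecs all v)

sequences : ∀ n → List (Vec (Subset n) n)
sequences n = allVecs (allSubsets n) n

∈-sequences : ∀ {n} (Ys : Vec (Subset n) n) → Ys ∈ sequences n
∈-sequences = ∈-allVecs ∈-allSubsets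

χ-≤ : ∀ {n} (X Y : Subset n) → (∀ i → χ X i ℤ.≤ χ Y i) → X ⊑ Y
χ-≤ X Y le i e with lookup X i | lookup Y i | le i
χ-≤ X Y le i refl | true | true  | _ = refl
χ-≤ X Y le i refl | true | false | ℤ.+≤+ ()

-- Instantiated with all subsets of size k, and with the minimisers of f - w among them.
-- Decidability serves to list the chains of members as generators.
module Flag {n} (A : ℕ → Pred (Subset n) 0ℓ) (A? : ∀ k → Decidable (A k)) (A-size : ∀ {k Y} → A k Y → ∣ Y ∣ ≡ k)
            (step : ∀ {k} → k ℕ.< n → FlagStep A k) where
  open FlagStep

  r : Fin n → Subset n → ℤ
  r α = r⁺ (step (FinP.toℕ<n α))

  r-rank : ∀ α → IsRank (A (suc (toℕ α))) (r α)
  r-rank α = rank⁺ (step (FinP.toℕ<n α))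

  -- Telescoping: the upper function of one step and the lower function of the next describe the
  -- same family, so `rank-unique` identifies them.
  step-nested : ∀ {j k} → j ℕ.≤′ k → (j<n : j ℕ.< n) (k<n : k ℕ.< n) → Nested (r⁺ (step j<n)) (r⁺ (step k<n))
  step-nested ℕ.≤′-refl j<n k<n X Z = ℤP.≤-reflexive (cong₂ ℤ._-_
    (rank-unique (rank⁺ (step j<n)) (rank⁺ (step k<n)) (X ∪ Z)) (rank-unique (rank⁺ (step j<n)) (rank⁺ (step k<n)) X))
  step-nested {j} {suc k} (ℕ.≤′-step j≤k) j<n k<n X Z = ℤP.≤-trans (step-nested j≤k j<n (ℕP.<⇒≤ k<n) X Z)
    (ℤP.≤-trans (ℤP.≤-reflexive (cong₂ ℤ._-_ (middle (X ∪ Z)) (middle X))) (nested (step k<n) X Z))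
    where
    middle : ∀ S → r⁺ (step (ℕP.<⇒≤ k<n)) S ≡ r⁻ (step k<n) S
    middle = rank-unique (rank⁺ (step (ℕP.<⇒≤ k<n))) (rank⁻ (step k<n))

  r-nested : ∀ α β → toℕ α ℕ.≤ toℕ β → Nested (r α) (r β)
  r-nested α β le = step-nested (ℕP.≤⇒≤′ le) (FinP.toℕ<n α) (FinP.toℕ<n β)

  H : Subset n → ℤ
  H X = ∑ℤ (λ α → r α X)

  H-base : BaseFunction H
  H-base = ∑-base (λ α → isBase (r-rank α))

  Member : Pred (Vec (Subset n) n) 0ℓ
  Member Ys = ∀ α → A (suc (toℕ α)) (lookup Ys α)

  member-sizes : ∀ Ys → Member Ys → ∀ α → ∣ lookup Ys α ∣ ≡ suc (toℕ α)
  member-sizes Ys mem α = A-size (mem α)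

  member-base : ∀ Ys → Member Ys → Baseℤ H (point Ys)
  member-base Ys mem = ∑-points (λ α → χ (lookup Ys α)) (λ α → complete (r-rank α) (mem α))

  base-member : ∀ {x} → Baseℤ H x → ∃ λ Ys → Member Ys × (∀ i → x i ≡ point Ys i)
  base-member {x} x∈ = tabulate Y , (λ α → subst (A (suc (toℕ α))) (sym (VecP.lookup∘tabulate Y α)) (proj₁ (proj₂ (found α)))) ,
    λ i → trans (proj₂ (proj₂ parts) i) (∑ℤ-cong λ α → trans (proj₂ (proj₂ (found α)) i) (cong (λ S → χ S i) (sym (VecP.lookup∘tabulate Y α))))
    where
    parts = decompose (λ α → isBase (r-rank α)) x∈
    found : ∀ α → ∃ λ Y → A (suc (toℕ α)) Y × (∀ i → proj₁ parts α i ≡ χ Y i)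
    found α = sound (r-rank α) (proj₁ (proj₂ parts) α)
    Y : Fin n → Subset n
    Y α = proj₁ (found α)

  MemberChain : Pred (Vec (Subset n) n) 0ℓ
  MemberChain Ys = Member Ys × Chain Ys

  memberChain? : Decidable MemberChain
  memberChain? Ys = FinP.all? (λ α → A? (suc (toℕ α)) (lookup Ys α)) ×-dec chain? Ys

  greedy-chain : ∀ (π : Permutation n n) → ∃ λ Ys → MemberChain Ys × (∀ i → greedyAlong π H i ≡ point Ys i)
  greedy-chain π = tabulate Y , (member , chain) , λ i → trans (greedy-∑ (λ α → r α ∘ act π) (π ⟨$⟩ˡ i))
      (∑ℤ-cong λ α → trans (≗χ α i) (cong (λ S → χ S i) (sym (lookup-Y α))))
    where
    found : ∀ α → ∃ λ Y → A (suc (toℕ α)) Y × (∀ i → greedyAlong π (r α) i ≡ χ Y i)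
    found α = sound (r-rank α) (greedyAlong-base π (isBase (r-rank α)))
    Y : Fin n → Subset n
    Y α = proj₁ (found α)
    ≗χ : ∀ α i → greedyAlong π (r α) i ≡ χ (Y α) i
    ≗χ α = proj₂ (proj₂ (found α))
    lookup-Y : ∀ α → lookup (tabulate Y) α ≡ Y α
    lookup-Y = VecP.lookup∘tabulate Y
    member : Member (tabulate Y)
    member α = subst (A (suc (toℕ α))) (sym (lookup-Y α)) (proj₁ (proj₂ (found α)))
    chain : Chain (tabulate Y)
    chain α β le = subst₂ _⊑_ (sym (lookup-Y α)) (sym (lookup-Y β)) (χ-≤ (Y α) (Y β) λ i → subst₂ ℤ._≤_ (≗χ α i) (≗χ β i)
      (greedyAlong-nested π (isBase (r-rank α)) (isBase (r-rank β)) (r-nested α β le) i))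

  chains : List (Vec (Subset n) n)
  chains = filter memberChain? (sequences n)

  base-hull : ∀ {y} → Baseℚ H y → ∃ λ M → IsConvex MemberChain M × (∀ i → y i ≡ wsum M (λ Ys → ι (point Ys i)))
  base-hull {y} y∈ = from-list (farkas-convex chains (λ Ys → ιv (point Ys)) separated)
    where
    from-list : (∃ λ M → IsConvex (_∈ chains) M × (∀ i → y i ≡ wsum M (λ Ys → ι (point Ys i)))) → _
    from-list (M , convex s one , e) = M ,
      convex (All.map (λ (0≤μ , Ys∈) → 0≤μ , proj₂ (∈-filter⁻ memberChain? {xs = sequences n} Ys∈)) s) one , e
    separated : ∀ c d → (∀ {Ys} → Ys ∈ chains → ⟨ c , ιv (point Ys) ⟩ ℚ.≤ d) → ⟨ c , y ⟩ ℚ.≤ d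
    separated c d le = let π , dec = sort c ; Ys , mc , e = greedy-chain π in
      ℚP.≤-trans (greedyAlong-optimal π H-base c y dec y∈)
        (ℚP.≤-trans (ℚP.≤-reflexive (⟨,⟩-congʳ c (λ i → cong ι (e i)))) (le (∈-filter⁺ memberChain? (∈-sequences Ys) mc)))

  chain-permVec : ∀ Ys → MemberChain Ys → IsPermVec (point Ys)
  chain-permVec Ys (mem , ch) = chain-permutation Ys ch (member-sizes Ys mem)

Baseℚ-wsum : ∀ {n} {h : Subset n → ℤ} {A : Set} {P : Pred A 0ℓ} {x : A → Vecℤ n} → (∀ {a} → P a → Baseℤ h (x a)) →
  ∀ {y} M → IsConvex P M → (∀ i → y i ≡ wsum M (λ a → ι (x a i))) → Baseℚ h y
Baseℚ-wsum {n} {h} {A} {P} {x} x∈ {y} M (convex s one) e =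
  (λ X → subst₂ ℚ._≤_ (sym (sum-on X)) (wsum-const M one (ι (h X)))
    (wsum-mono s λ {a} Pa → ℚP.≤-trans (ℚP.≤-reflexive (trans (sym (sumOn-⟨,⟩ (ιv (x a)) X)) (sumOn-ι (x a) X))) (ι-mono (proj₁ (x∈ Pa) X)))) ,
  trans (∑ℚ-cong e) (trans (wsum-∑ M (λ i a → ι (x a i))) (ℚP.≤-antisym
    (subst (_ ℚ.≤_) (wsum-const M one (ι (h ⊤))) (wsum-mono s λ Pa → ℚP.≤-reflexive (total≡ Pa)))
    (subst (ℚ._≤ _) (wsum-const M one (ι (h ⊤))) (wsum-mono s λ Pa → ℚP.≤-reflexive (sym (total≡ Pa))))))
  where
  total≡ : ∀ {a} → P a → ∑ℚ (ιv (x a)) ≡ ι (h ⊤)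
  total≡ {a} Pa = trans (sym (∑ℤ-ι (x a))) (cong ι (proj₂ (x∈ Pa)))
  sum-on : ∀ X → sumOn y X ≡ wsum M (λ a → ⟨ ιv (χ X) , ιv (x a) ⟩)
  sum-on X = trans (sumOn-⟨,⟩ y X) (trans (⟨,⟩-congʳ (ιv (χ X)) e) (wsum-⟨,⟩ M (ιv (χ X)) (λ a → ιv (x a))))

-- The compression

≐-sym : ∀ {n} {P Q : Pred (Vecℚ n) 0ℓ} → P ≐ Q → Q ≐ P
≐-sym e x = proj₂ (e x) , proj₁ (e x)

≐-trans : ∀ {n} {P Q R : Pred (Vecℚ n) 0ℓ} → P ≐ Q → Q ≐ R → P ≐ R
≐-trans e e′ x = proj₁ (e′ x) ∘ proj₁ (e x) , proj₂ (e x) ∘ proj₂ (e′ x)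

sum-weights : ∀ {A : Set} (M : Weights A) → sumL (List.map proj₁ M) ≡ wsum M (λ _ → 1ℚ)
sum-weights []            = refl
sum-weights ((μ , a) ∷ M) = cong₂ ℚ._+_ (sym (ℚP.*-identityʳ μ)) (sum-weights M)

wsum-map : ∀ {A B : Set} (g : A → B) (M : Weights A) φ → wsum (List.map (λ (μ , a) → μ , g a) M) φ ≡ wsum M (φ ∘ g)
wsum-map g []            φ = refl
wsum-map g ((μ , a) ∷ M) φ = cong (ℚ._+_ (μ ℚ.* φ (g a))) (wsum-map g M φ)

wsum⇒Conv : ∀ {A : Set} {n} {P : Pred A 0ℓ} {S : Pred (Vecℤ n) 0ℓ} {x : A → Vecℤ n} → (∀ {a} → P a → S (x a)) →
  ∀ {y} M → IsConvex P M → (∀ i → y i ≡ wsum M (λ a → ι (x a i))) → Conv S y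
wsum⇒Conv {A} {n} {P} {S} {x} S∋ M (convex s one) e = List.map (λ (μ , a) → μ , x a) M , all s ,
  trans (sum-weights (List.map (λ (μ , a) → μ , x a) M)) (trans (wsum-map x M (λ _ → 1ℚ)) one) ,
  λ i → trans (e i) (sym (wsum-map x M (λ z → ι (z i))))
  where
  all : ∀ {M} → Supported P M → All (λ p → 0ℚ ℚ.≤ proj₁ p × S (proj₂ p)) (List.map (λ (μ , a) → μ , x a) M)
  all []               = []
  all ((0≤μ , Pa) ∷ s) = (0≤μ , S∋ Pa) ∷ all s

Conv⇒Baseℚ : ∀ {n} {S : Pred (Vecℤ n) 0ℓ} {h} → (∀ {x} → S x → Baseℤ h x) → ∀ {y} → Conv S y → Baseℚ h y
Conv⇒Baseℚ {S = S} S⇒B (M , s , one , e) = Baseℚ-wsum {P = S} {x = id} S⇒B M (convex s (trans (sym (sum-weights M)) one)) e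

∑ℚ-tight : ∀ {n} {f g : Fin n → ℚ} → (∀ i → f i ℚ.≤ g i) → ∑ℚ g ℚ.≤ ∑ℚ f → ∀ i → g i ℚ.≤ f i
∑ℚ-tight {suc n} {f} {g} f≤g le Fin.zero = ≤-diffℚ _ _ (ℚP.+-mono-≤ le (∑ℚ-mono (f≤g ∘ Fin.suc)))
  (solve 4 (λ a b c d → (a :+ c) :+ d :- ((b :+ d) :+ c) := a :- b) refl (f Fin.zero) (g Fin.zero) (∑ℚ (f ∘ Fin.suc)) (∑ℚ (g ∘ Fin.suc)))
∑ℚ-tight {suc n} {f} {g} f≤g le (Fin.suc i) = ∑ℚ-tight (f≤g ∘ Fin.suc) (≤-diffℚ _ _ (ℚP.+-mono-≤ le (f≤g Fin.zero))
  (solve 4 (λ a b c d → (a :+ c) :+ b :- ((b :+ d) :+ a) := c :- d) refl (f Fin.zero) (g Fin.zero) (∑ℚ (f ∘ Fin.suc)) (∑ℚ (g ∘ Fin.suc)))) i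

∑∞-fin : ∀ {n} {g : Fin n → ℤ∞} {h : Fin n → ℤ} → (∀ i → g i ≡ fin (h i)) → ∑∞ g ≡ fin (∑ℤ h)
∑∞-fin {zero}  e = refl
∑∞-fin {suc n} e = cong₂ _+∞_ (e Fin.zero) (∑∞-fin (e ∘ Fin.suc))

Sized : ∀ {n} → Pred (Vec (Subset n) n) 0ℓ
Sized Ys = ∀ α → ∣ lookup Ys α ∣ ≡ suc (toℕ α)

sized? : ∀ {n} → Decidable (Sized {n})
sized? Ys = FinP.all? λ α → ∣ lookup Ys α ∣ ℕP.≟ suc (toℕ α)

[_≤_] : ℕ → ℕ → ℤ
[ a ≤ b ] = if a ℕ.≤ᵇ b then + 1 else + 0

[≤]-true : ∀ {a b} → a ℕ.≤ b → [ a ≤ b ] ≡ + 1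
[≤]-true {a} {b} le with a ℕ.≤ᵇ b | ℕP.≤⇒≤ᵇ le
... | true | _ = refl

[≤]-false : ∀ {a b} → ¬ a ℕ.≤ b → [ a ≤ b ] ≡ + 0
[≤]-false {a} {b} ¬le with a ℕ.≤ᵇ b in eq
... | true  = contradiction (ℕP.≤ᵇ⇒≤ a b (subst Bool.T (sym eq) _)) ¬le
... | false = refl

[≤]-suc : ∀ a b → [ suc a ≤ suc b ] ≡ [ a ≤ b ]
[≤]-suc zero    b = refl
[≤]-suc (suc a) b = refl

∑ℤ-ones : ∀ n → ∑ℤ {n} (λ _ → + 1) ≡ + n
∑ℤ-ones zero    = refl
∑ℤ-ones (suc n) = cong (ℤ._+_ (+ 1)) (∑ℤ-ones n)

∑-threshold : ∀ n c → c ℕ.≤ n → ∑ℤ {n} (λ j → [ n ≤ toℕ j ℕ.+ c ]) ≡ + c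
∑-threshold zero    zero ℕ.z≤n = refl
∑-threshold (suc n) c    c≤ with c ℕP.≟ suc n
... | yes refl = trans (∑ℤ-cong (λ (j : Fin (suc n)) → [≤]-true (ℕP.m≤n+m (suc n) (toℕ j)))) (∑ℤ-ones (suc n))
... | no c≢    = trans (cong₂ ℤ._+_ ([≤]-false (λ le → ℕP.1+n≰n (ℕP.≤-trans le c≤n)))
    (∑ℤ-cong (λ (j : Fin n) → [≤]-suc n (toℕ j ℕ.+ c)))) (trans (ℤP.+-identityˡ _) (∑-threshold n c c≤n))
  where
  c≤n : c ℕ.≤ n
  c≤n = ℕ.s≤s⁻¹ (ℕP.≤∧≢⇒< c≤ c≢)

-- π is the sum of the characteristic vectors of its upper level sets.
permVec-decomposition : ∀ {n} {x : Vecℤ n} → IsPermVec x → ∃ λ Ys → Sized Ys × (∀ i → x i ≡ point Ys i)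
permVec-decomposition {n} {x} (π , e) = tabulate Y , sized , decomposes
  where
  Y : Fin n → Subset n
  -- The condition is symmetric in `π i` and `α`, so `∑-threshold` counts it twice: over `i` for the
  -- size of `Y α`, over `α` for the coordinate at `i`.
  Y α = tabulate (λ i → n ℕ.≤ᵇ toℕ (π ⟨$⟩ʳ i) ℕ.+ suc (toℕ α))
  χ-Y : ∀ α i → χ (Y α) i ≡ [ n ≤ toℕ (π ⟨$⟩ʳ i) ℕ.+ suc (toℕ α) ]
  χ-Y α i = cong (if_then + 1 else + 0) (VecP.lookup∘tabulate (λ i → n ℕ.≤ᵇ toℕ (π ⟨$⟩ʳ i) ℕ.+ suc (toℕ α)) i)
  sized : Sized (tabulate Y)
  sized α = trans (cong ∣_∣ (VecP.lookup∘tabulate Y α)) (ℤP.+-injective (begin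
    + ∣ Y α ∣                                                    ≡⟨ ∑ℤ-χ (Y α) ⟨
    ∑ℤ (χ (Y α))                                                 ≡⟨ ∑ℤ-cong (χ-Y α) ⟩
    ∑ℤ (λ i → [ n ≤ toℕ (π ⟨$⟩ʳ i) ℕ.+ suc (toℕ α) ])            ≡⟨ ∑ℤ-permute (λ j → [ n ≤ toℕ j ℕ.+ suc (toℕ α) ]) π ⟨
    ∑ℤ (λ (j : Fin n) → [ n ≤ toℕ j ℕ.+ suc (toℕ α) ])           ≡⟨ ∑-threshold n (suc (toℕ α)) (FinP.toℕ<n α) ⟩
    + suc (toℕ α)                                                ∎))
    where open ≡-Reasoning
  decomposes : ∀ i → x i ≡ point (tabulate Y) i
  decomposes i = begin
    x i                                                          ≡⟨ e i ⟩
    + suc (toℕ (π ⟨$⟩ʳ i))                                       ≡⟨ ∑-threshold n (suc (toℕ (π ⟨$⟩ʳ i))) (FinP.toℕ<n (π ⟨$⟩ʳ i)) ⟨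
    ∑ℤ (λ (α : Fin n) → [ n ≤ toℕ α ℕ.+ suc (toℕ (π ⟨$⟩ʳ i)) ])  ≡⟨ ∑ℤ-cong (λ α → trans (cong [ n ≤_] (swap (toℕ α) (toℕ (π ⟨$⟩ʳ i)))) (sym (χ-Y α i))) ⟩
    ∑ℤ (λ α → χ (Y α) i)                                         ≡⟨ ∑ℤ-cong (λ α → cong (λ S → χ S i) (sym (VecP.lookup∘tabulate Y α))) ⟩
    point (tabulate Y) i                                         ∎
    where
    open ≡-Reasoning
    swap : ∀ a b → a ℕ.+ suc b ≡ b ℕ.+ suc a
    swap a b = trans (ℕP.+-suc a b) (trans (cong suc (ℕP.+-comm a b)) (sym (ℕP.+-suc b a)))

module Compression {n} (f fhat : Vecℤ n → ℤ∞) (F : PolyConvFn n) (via : IsMNatConvexVia F f)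
  (cube : ∀ x → (Dom f x → ∀ i → (x i ≡ + 0) ⊎ (x i ≡ + 1)) × ((∀ i → (x i ≡ + 0) ⊎ (x i ≡ + 1)) → Dom f x))
  (compression : IsCompressionOf f fhat) where
  open ConvexOnCube f F via cube

  total-cost : ∀ {m} → Vec (Subset n) m → ℤ
  total-cost Ys = ∑ℤ (λ α → fv (lookup Ys α))

  Ψ : ∀ {m} → Vecℚ n → Vec (Subset n) m → ℚ
  Ψ w Ys = ι (total-cost Ys) ℚ.- ⟨ w , ιv (point Ys) ⟩

  -- With the sum of the family left free, the objective separates over the sizes, so optimal
  -- families are those optimal in every layer.
  Ψ-∑ : ∀ {m} w (Ys : Vec (Subset n) m) → Ψ w Ys ≡ ∑ℚ (λ α → Φ w (lookup Ys α))
  Ψ-∑ w []       = cong (ℚ._-_ 0ℚ) (⟨,⟩-zeroʳ w)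
  Ψ-∑ w (Y ∷ Ys) = trans (cong₂ ℚ._-_ (ι-+ (fv Y) (total-cost Ys))
      (trans (⟨,⟩-congʳ w (λ i → ι-+ (χ Y i) (point Ys i))) (⟨,⟩-+ʳ w (ιv (χ Y)) (ιv (point Ys)))))
    (trans (solve 4 (λ a b c d → (a :+ b) :- (c :+ d) := (a :- c) :+ (b :- d)) refl (ι (fv Y)) (ι (total-cost Ys)) ⟨ w , ιv (χ Y) ⟩ ⟨ w , ιv (point Ys) ⟩)
      (cong (ℚ._+_ (Φ w Y)) (Ψ-∑ w Ys)))

  layerMin? : ∀ w k → Decidable (LayerMin w k)
  layerMin? w k Y = (∣ Y ∣ ℕP.≟ k) ×-dec Decidable.map′
    (λ all Z → All.lookup all (∈-allSubsets Z)) (λ h → All.tabulate (λ {Z} _ → h Z))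
    (All.all? (λ Z → (∣ Z ∣ ℕP.≟ k) →-dec (Φ w Y ℚP.≤? Φ w Z)) (allSubsets n))

  module C = Flag (λ k Y → ∣ Y ∣ ≡ k) (λ k Y → ∣ Y ∣ ℕP.≟ k) id cube-step
  module W (w : Vecℚ n) = Flag (LayerMin w) (layerMin? w) proj₁ (layerMin-step w)

  -- A reference optimum for `w`, obtained by splitting a greedy vertex into members of the layers.
  best : Vecℚ n → Vec (Subset n) n
  best w = proj₁ (W.base-member w (greedy-base (W.H-base w)))

  best-member : ∀ w → W.Member w (best w)
  best-member w = proj₁ (proj₂ (W.base-member w (greedy-base (W.H-base w))))

  member-sized : ∀ w Ys → W.Member w Ys → Sized Ys
  member-sized w = W.member-sizes w

  member-optimal : ∀ w Ys Zs → W.Member w Ys → Sized Zs → Ψ w Ys ℚ.≤ Ψ w Zs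
  member-optimal w Ys Zs mem sz = subst₂ ℚ._≤_ (sym (Ψ-∑ w Ys)) (sym (Ψ-∑ w Zs)) (∑ℚ-mono λ α → proj₂ (mem α) (lookup Zs α) (sz α))

  -- Each term is at least the corresponding term of `best w`, and the sum is no larger, so every
  -- layer is optimal.
  optimal-member : ∀ w Ys → Sized Ys → Ψ w Ys ℚ.≤ Ψ w (best w) → W.Member w Ys
  optimal-member w Ys sz le α = sz α , λ Z ∣Z∣ → ℚP.≤-trans
    (∑ℚ-tight (λ β → proj₂ (best-member w β) (lookup Ys β) (sz β)) (subst₂ ℚ._≤_ (Ψ-∑ w Ys) (Ψ-∑ w (best w)) le) α)
    (proj₂ (best-member w α) Z ∣Z∣)

  cost-finite : ∀ (Y : Fin n → Subset n) → cost f Y ≡ fin (∑ℤ (λ α → fv (Y α)))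
  cost-finite Y = ∑∞-fin (λ α → f-χ (Y α))

  fin≤fin⁻ : ∀ {a b} → fin a ≤∞ fin b → a ℤ.≤ b
  fin≤fin⁻ (fin≤fin le) = le

  fhat-≤ : ∀ {x v} → fhat x ≡ fin v → ∀ Ys → Sized Ys → (∀ i → x i ≡ point Ys i) → v ℤ.≤ total-cost Ys
  fhat-≤ {x} eq Ys sz e = fin≤fin⁻ (subst₂ _≤∞_ eq (cost-finite (lookup Ys)) (proj₁ (compression x) (lookup Ys) (sz , e)))

  fhat-attained : ∀ {x v} → fhat x ≡ fin v → ∃ λ Ys → Sized Ys × (∀ i → x i ≡ point Ys i) × total-cost Ys ≡ v
  fhat-attained {x} {v} eq with proj₂ (compression x)
  ... | inj₁ eq∞ = contradiction (trans (sym eq) eq∞) λ ()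
  ... | inj₂ (Y , (sz , e) , ce) = tabulate Y , (λ α → trans (cong ∣_∣ (VecP.lookup∘tabulate Y α)) (sz α)) ,
      (λ i → trans (e i) (∑ℤ-cong (λ α → cong (λ S → χ S i) (sym (VecP.lookup∘tabulate Y α))))) ,
      trans (∑ℤ-cong (λ α → cong fv (VecP.lookup∘tabulate Y α))) (fin-injective (trans (sym (cost-finite Y)) (trans ce eq)))

  fhat-finite : ∀ {x} Ys → Sized Ys → (∀ i → x i ≡ point Ys i) → Dom fhat x
  fhat-finite {x} Ys sz e with fhat x | proj₁ (compression x) (lookup Ys) (sz , e)
  ... | fin v | _  = v , refl
  ... | ∞     | le = contradiction (subst (∞ ≤∞_) (cost-finite (lookup Ys)) le) λ ()

  Dom-base : ∀ {x} → Dom fhat x → Baseℤ C.H x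
  Dom-base (v , eq) = let Ys , sz , e , _ = fhat-attained eq in Baseℤ-cong (sym ∘ e) (C.member-base Ys sz)

  Conv-Dom : Conv (Dom fhat) ≐ Baseℚ C.H
  Conv-Dom y = Conv⇒Baseℚ Dom-base , λ y∈ → let M , cvx , e = C.base-hull y∈ in
    wsum⇒Conv {x = point} (λ {Ys} (sz , _) → fhat-finite Ys sz (λ _ → refl)) M cvx e

  -- Permutation vectors lie in the base polyhedron as sums of their level sets; its points are in
  -- turn means of chain sums.
  permutohedron-base : Permutohedron ≐ Baseℚ C.H
  permutohedron-base y = Conv⇒Baseℚ (λ perm → let Ys , sz , e = permVec-decomposition perm in Baseℤ-cong (sym ∘ e) (C.member-base Ys sz)) ,
    λ y∈ → let M , cvx , e = C.base-hull y∈ in wsum⇒Conv {x = point} (λ {Ys} → C.chain-permVec Ys) M cvx e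

  Conv-Dom-permutohedron : Conv (Dom fhat) ≐ Permutohedron
  Conv-Dom-permutohedron = ≐-trans Conv-Dom (≐-sym permutohedron-base)

  argMin-base : ∀ w {x} → ArgMin fhat w x → Baseℤ (W.H w) x
  argMin-base w {x} (v , eq , min) = from-attained (fhat-attained eq) (fhat-finite (best w) (member-sized w (best w) (best-member w)) (λ _ → refl))
    where
    from-attained : (∃ λ Ys → Sized Ys × (∀ i → x i ≡ point Ys i) × total-cost Ys ≡ v) → Dom fhat (point (best w)) → Baseℤ (W.H w) x
    from-attained (Ys , sz , e , refl) (u , eq′) = Baseℤ-cong (sym ∘ e) (W.member-base w Ys (optimal-member w Ys sz (begin
      Ψ w Ys                                                 ≡⟨ cong (ℚ._-_ (ι (total-cost Ys))) (⟨,⟩-congʳ w (λ i → cong ι (e i))) ⟨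
      ι v ℚ.- ⟨ w , ιv x ⟩                                   ≤⟨ min (point (best w)) u eq′ ⟩
      ι u ℚ.- ⟨ w , ιv (point (best w)) ⟩            ≤⟨ ℚP.+-monoˡ-≤ (ℚ.- ⟨ w , ιv (point (best w)) ⟩)
                                                                  (ι-mono (fhat-≤ eq′ (best w) (member-sized w (best w) (best-member w)) (λ _ → refl))) ⟩
      Ψ w (best w)                                   ∎)))
      where open ℚP.≤-Reasoning

  member-argMin : ∀ w Ys → W.Member w Ys → ArgMin fhat w (point Ys)
  member-argMin w Ys mem = from-finite (fhat-finite Ys sz (λ _ → refl))
    where
    sz = member-sized w Ys mem
    from-finite : Dom fhat (point Ys) → ArgMin fhat w (point Ys)
    from-finite (v , eq) = v , eq , λ y u eq′ → from-attained y u (fhat-attained eq′)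
      where
      from-attained : ∀ y u → (∃ λ Zs → Sized Zs × (∀ i → y i ≡ point Zs i) × total-cost Zs ≡ u) →
        ι v ℚ.- ⟨ w , ιv (point Ys) ⟩ ℚ.≤ ι u ℚ.- ⟨ w , ιv y ⟩
      from-attained y u (Zs , sz′ , e , refl) = begin
        ι v ℚ.- ⟨ w , ιv (point Ys) ⟩   ≤⟨ ℚP.+-monoˡ-≤ (ℚ.- ⟨ w , ιv (point Ys) ⟩) (ι-mono (fhat-≤ eq Ys sz (λ _ → refl))) ⟩
        Ψ w Ys                          ≤⟨ member-optimal w Ys Zs mem sz′ ⟩
        Ψ w Zs                          ≡⟨ cong (ℚ._-_ (ι (total-cost Zs))) (⟨,⟩-congʳ w (λ i → cong ι (e i))) ⟨
        ι u ℚ.- ⟨ w , ιv y ⟩            ∎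
        where open ℚP.≤-Reasoning

  Conv-ArgMin : ∀ w → Conv (ArgMin fhat w) ≐ Baseℚ (W.H w)
  Conv-ArgMin w y = Conv⇒Baseℚ (argMin-base w) , λ y∈ → let M , cvx , e = W.base-hull w y∈ in
    wsum⇒Conv {x = point} (λ {Ys} (mem , _) → member-argMin w Ys mem) M cvx e

  -- A minimiser such as (2, 2, 2) need not be a permutation vector. Those minimisers that are
  -- contain all chain sums, and these already span the hull.
  PermArgMin : Vecℚ n → Pred (Vecℤ n) 0ℓ
  PermArgMin w x = IsPermVec x × ArgMin fhat w x

  Conv-PermArgMin : ∀ w → Conv (PermArgMin w) ≐ Baseℚ (W.H w)
  Conv-PermArgMin w y = Conv⇒Baseℚ (λ (_ , am) → argMin-base w am) , λ y∈ → let M , cvx , e = W.base-hull w y∈ in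
    wsum⇒Conv {x = point} (λ {Ys} mc → W.chain-permVec w Ys mc , member-argMin w Ys (proj₁ mc)) M cvx e

  subPermutohedron : ∀ w → IsSubPermutohedron (Conv (ArgMin fhat w))
  subPermutohedron w = (PermArgMin w , (λ _ → proj₁) , ≐-trans (Conv-ArgMin w) (≐-sym (Conv-PermArgMin w))) ,
    base-basePolyhedron (W.H-base w) (Conv-ArgMin w)

  sizedSequences : List (Vec (Subset n) n)
  sizedSequences = filter sized? (sequences n)

  ∈-sized : ∀ Ys → Sized Ys → Ys ∈ sizedSequences
  ∈-sized Ys sz = ∈-filter⁺ sized? (∈-sequences Ys) sz

  sized-∈ : ∀ {Ys} → Ys ∈ sizedSequences → Sized Ys
  sized-∈ Ys∈ = proj₂ (∈-filter⁻ sized? {xs = sequences n} Ys∈)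

  -- The convex envelope of the points (Σ χ_{Y_α}, Σ f(Y_α)) over all decompositions; its linearity domain at z is the
  -- base polyhedron of the layers minimising f − z, so an integral point of it has an optimal decomposition.
  module Extension (E : Envelope sizedSequences (λ Ys → ιv (point Ys)) (λ Ys → ι (total-cost Ys))) where
    open Envelope E renaming (F to F̂)
    open PolyConvFn F̂ renaming (domF to domF̂; val to val̂; LinDom to LinDom̂)

    convex-sized : ∀ {P} {M : Weights (Vec (Subset n) n)} → (∀ Ys → P Ys → Sized Ys) → IsConvex P M → IsConvex (_∈ sizedSequences) M
    convex-sized P⇒ (convex s one) = convex (All.map (λ {q} (0≤μ , Pa) → 0≤μ , ∈-sized (proj₂ q) (P⇒ (proj₂ q) Pa)) s) one

    domF̂-base : domF̂ ≐ Baseℚ C.H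
    domF̂-base y = to ∘ represent , λ y∈ → from (C.base-hull y∈)
      where
      to : (∃ λ M → IsConvex (_∈ sizedSequences) M × (∀ i → y i ≡ wsum M (λ Ys → ι (point Ys i))) × wsum M (λ Ys → ι (total-cost Ys)) ℚ.≤ val̂ y) → Baseℚ C.H y
      to (M , cvx , e , _) = Baseℚ-wsum {x = point} (λ {Ys} Ys∈ → C.member-base Ys (sized-∈ Ys∈)) M cvx e
      from : (∃ λ M → IsConvex C.MemberChain M × (∀ i → y i ≡ wsum M (λ Ys → ι (point Ys i)))) → domF̂ y
      from (M , cvx , e) = domF-wsum E M (convex-sized {P = C.MemberChain} (λ _ → proj₁) cvx) e

    Ψ-tight : ∀ a b (Ys : Vec (Subset n) n) → ι (total-cost Ys) ≡ ⟨ a , ιv (point Ys) ⟩ ℚ.+ b → Ψ a Ys ≡ b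
    Ψ-tight a b Ys tight = trans (cong (ℚ._- ⟨ a , ιv (point Ys) ⟩) tight) (solve 2 (λ p b → p :+ b :- p := b) refl ⟨ a , ιv (point Ys) ⟩ b)

    Ψ-above : ∀ a b (Ys : Vec (Subset n) n) → ⟨ a , ιv (point Ys) ⟩ ℚ.+ b ℚ.≤ ι (total-cost Ys) → b ℚ.≤ Ψ a Ys
    Ψ-above a b Ys le = ≤-diffℚ _ _ le (solve 3 (λ c p b → c :- (p :+ b) := c :- p :- b) refl (ι (total-cost Ys)) ⟨ a , ιv (point Ys) ⟩ b)

    -- Where the minorant of slope `a` and intercept `b` is exact, `Ψ a` takes the value `b`, its
    -- lower bound on all families of the prescribed sizes.
    tight-member : ∀ a b → (∀ Ys → Ys ∈ sizedSequences → ⟨ a , ιv (point Ys) ⟩ ℚ.+ b ℚ.≤ ι (total-cost Ys)) →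
      ∀ Ys → Ys ∈ sizedSequences × ι (total-cost Ys) ≡ ⟨ a , ιv (point Ys) ⟩ ℚ.+ b → W.Member a Ys
    tight-member a b valid Ys (Ys∈ , tight) = optimal-member a Ys (sized-∈ Ys∈)
      (ℚP.≤-trans (ℚP.≤-reflexive (Ψ-tight a b Ys tight)) (Ψ-above a b (best a) (valid (best a) (∈-sized (best a) (member-sized a (best a) (best-member a))))))

    -- The envelope only gives `x` as a mean of sums of optimal families. Being integral, `x` is
    -- itself the sum of one such family, and its cost is the value of the affine function at `x`.
    fhat-≤-val̂ : ∀ {x v} → fhat x ≡ fin v → TightRepresentation E (ιv x) → ι v ℚ.≤ val̂ (ιv x)
    fhat-≤-val̂ {x} {v} eq (a , b , valid , val≡ , M , cvx , e) = from-member (W.base-member a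
        (Baseℚ⇒Baseℤ (Baseℚ-wsum {x = point} (λ {Ys} t → W.member-base a Ys (tight-member a b valid Ys t)) M cvx e)))
      where
      from-member : (∃ λ Ys → W.Member a Ys × (∀ i → x i ≡ point Ys i)) → ι v ℚ.≤ val̂ (ιv x)
      from-member (Ys , mem , xe) = begin
        ι v                                     ≤⟨ ι-mono (fhat-≤ eq Ys (member-sized a Ys mem) xe) ⟩
        ι (total-cost Ys)                       ≡⟨ solve 2 (λ c p → c := p :+ (c :- p)) refl (ι (total-cost Ys)) ⟨ a , ιv (point Ys) ⟩ ⟩
        ⟨ a , ιv (point Ys) ⟩ ℚ.+ Ψ a Ys        ≤⟨ ℚP.+-monoʳ-≤ ⟨ a , ιv (point Ys) ⟩ Ψ≤b ⟩
        ⟨ a , ιv (point Ys) ⟩ ℚ.+ b             ≡⟨ cong (ℚ._+ b) (⟨,⟩-congʳ a (λ i → cong ι (xe i))) ⟨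
        ⟨ a , ιv x ⟩ ℚ.+ b                      ≡⟨ val≡ ⟨
        val̂ (ιv x)                              ∎
        where
        open ℚP.≤-Reasoning
        Ψ≤b : Ψ a Ys ℚ.≤ b
        -- Averaging a constant only serves to extract an atom; its objective value is `b`.
        Ψ≤b = let Zs , (Zs∈ , tight) , _ = average-≤ cvx (λ _ → 0ℚ) (ℚP.≤-reflexive (wsum-const M (total cvx) 0ℚ)) in
          ℚP.≤-trans (member-optimal a Ys Zs mem (sized-∈ Zs∈)) (ℚP.≤-reflexive (Ψ-tight a b Zs tight))

    restricts : RestrictsTo F̂ fhat
    restricts x with fhat x in eq
    ... | ∞     = λ d → let Ys , sz , e = C.base-member (Baseℚ⇒Baseℤ (proj₁ (domF̂-base (ιv x)) d)) ; v , eq′ = fhat-finite Ys sz e in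
        contradiction (trans (sym eq) eq′) λ ()
    ... | fin v = dom , ℚP.≤-antisym (val-≤ (fhat-attained eq)) (fhat-≤-val̂ eq (tight-represent E dom))
      where
      dom : domF̂ (ιv x)
      dom = proj₂ (domF̂-base (ιv x)) (Baseℤ⇒Baseℚ (Dom-base (v , eq)))
      val-≤ : (∃ λ Ys → Sized Ys × (∀ i → x i ≡ point Ys i) × total-cost Ys ≡ v) → val̂ (ιv x) ℚ.≤ ι v
      val-≤ (Ys , sz , e , refl) = ℚP.≤-trans (ℚP.≤-reflexive (val-cong F̂ (λ i → cong ι (e i)))) (val-point E (∈-sized Ys sz))

    -- The intercept of the supporting affine function of slope `z`, that is, minus the convex
    -- conjugate of the compression at `z`.
    best-Ψ : Vecℚ n → ℚ
    best-Ψ z = Ψ z (best z)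

    best-valid : ∀ z {Ys} → Ys ∈ sizedSequences → ⟨ z , ιv (point Ys) ⟩ ℚ.+ best-Ψ z ℚ.≤ ι (total-cost Ys)
    best-valid z {Ys} Ys∈ = ≤-diffℚ _ _ (member-optimal z (best z) Ys (best-member z) (sized-∈ Ys∈))
      (solve 3 (λ c p b → c :- p :- b := c :- (p :+ b)) refl (ι (total-cost Ys)) ⟨ z , ιv (point Ys) ⟩ (best-Ψ z))

    best-below : ∀ z {y} → domF̂ y → ⟨ z , y ⟩ ℚ.+ best-Ψ z ℚ.≤ val̂ y
    best-below z {y} d = from-representation (represent d)
      where
      from-representation : (∃ λ M → IsConvex (_∈ sizedSequences) M × (∀ i → y i ≡ wsum M (λ Ys → ι (point Ys i))) × wsum M (λ Ys → ι (total-cost Ys)) ℚ.≤ val̂ y) →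
        ⟨ z , y ⟩ ℚ.+ best-Ψ z ℚ.≤ val̂ y
      from-representation (M , convex s one , e , le) = ℚP.≤-trans
        (ℚP.≤-reflexive (sym (wsum-affine z (best-Ψ z) (λ Ys → ιv (point Ys)) M one e))) (ℚP.≤-trans (wsum-mono s (best-valid z)) le)

    -- On the linearity domain the envelope meets its supporting function of slope `z`, so
    -- `tight-support` leaves only families optimal for `z`. Conversely, means of optimal chains lie
    -- on that function.
    LinDom-base : ∀ z → LinDom̂ z ≐ Baseℚ (W.H z)
    LinDom-base z y = to , λ y∈ → from (W.base-hull z y∈)
      where
      best∈ : best z ∈ sizedSequences
      best∈ = ∈-sized (best z) (member-sized z (best z) (best-member z))
      to : LinDom̂ z y → Baseℚ (W.H z) y
      to (d , min) = from-representation (represent d)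
        where
        val-≤ : val̂ y ℚ.≤ ⟨ z , y ⟩ ℚ.+ best-Ψ z
        val-≤ = ≤-diffℚ _ _ (ℚP.≤-trans (min (ιv (point (best z))) (domF-point E best∈))
            (ℚP.+-monoˡ-≤ (ℚ.- ⟨ z , ιv (point (best z)) ⟩) (val-point E best∈)))
          (solve 3 (λ v p b → b :- (v :- p) := p :+ b :- v) refl (val̂ y) ⟨ z , y ⟩ (best-Ψ z))
        from-representation : (∃ λ M → IsConvex (_∈ sizedSequences) M × (∀ i → y i ≡ wsum M (λ Ys → ι (point Ys i))) × wsum M (λ Ys → ι (total-cost Ys)) ℚ.≤ val̂ y) → Baseℚ (W.H z) y
        from-representation (M , cvx , e , le) = from-tight (tight-support {P = _∈ sizedSequences} {x = λ Ys → ιv (point Ys)} {v = λ Ys → ι (total-cost Ys)}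
            z (best-Ψ z) (best-valid z) M cvx e (ℚP.≤-trans le val-≤))
          where
          from-tight : (∃ λ M′ → IsConvex (λ Ys → Ys ∈ sizedSequences × ι (total-cost Ys) ≡ ⟨ z , ιv (point Ys) ⟩ ℚ.+ best-Ψ z) M′ × (∀ i → y i ≡ wsum M′ (λ Ys → ι (point Ys i)))) →
            Baseℚ (W.H z) y
          from-tight (M′ , cvx′ , e′) = Baseℚ-wsum {x = point} (λ {Ys} t → W.member-base z Ys (tight-member z (best-Ψ z) (λ _ → best-valid z) Ys t)) M′ cvx′ e′
      from : (∃ λ M → IsConvex (W.MemberChain z) M × (∀ i → y i ≡ wsum M (λ Ys → ι (point Ys i)))) → LinDom̂ z y
      from (M , cvx@(convex s one) , e) = domF-wsum E M cvx′ e , λ y′ d′ → ≤-diffℚ _ _ (ℚP.+-mono-≤ val-≤ (best-below z d′))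
          (solve 5 (λ v p b q u → (p :+ b) :+ u :- (v :+ (q :+ b)) := (u :- q) :- (v :- p)) refl (val̂ y) ⟨ z , y ⟩ (best-Ψ z) ⟨ z , y′ ⟩ (val̂ y′))
        where
        cvx′ : IsConvex (_∈ sizedSequences) M
        cvx′ = convex-sized {P = W.MemberChain z} (λ Ys (mem , _) → member-sized z Ys mem) cvx
        best-tight : ∀ Ys → W.MemberChain z Ys → ι (total-cost Ys) ℚ.≤ ⟨ z , ιv (point Ys) ⟩ ℚ.+ best-Ψ z
        best-tight Ys (mem , _) = ≤-diffℚ _ _ (member-optimal z Ys (best z) mem (member-sized z (best z) (best-member z)))
          (solve 3 (λ c p b → b :- (c :- p) := p :+ b :- c) refl (ι (total-cost Ys)) ⟨ z , ιv (point Ys) ⟩ (best-Ψ z))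
        val-≤ : val̂ y ℚ.≤ ⟨ z , y ⟩ ℚ.+ best-Ψ z
        val-≤ = ℚP.≤-trans (val-wsum E M cvx′ e) (ℚP.≤-trans (wsum-mono {P = W.MemberChain z} s (λ {Ys} → best-tight Ys))
          (ℚP.≤-reflexive (wsum-affine z (best-Ψ z) (λ Ys → ιv (point Ys)) M one e)))

    mConvex : IsMConvex fhat
    mConvex = F̂ , (restricts , base-polymatroid C.H-base domF̂-base , λ z _ → base-polymatroid (W.H-base z) (LinDom-base z)) ,
      base-basePolyhedron C.H-base domF̂-base

theorem5p1 : (n : ℕ) (f fhat : Vecℤ n → ℤ∞) →
    IsValuatedGMatroid f → IsCompressionOf f fhat →
    (Conv (Dom fhat) ≐ Permutohedron)
    × IsValuatedPermutohedron fhat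
    × (∀ (w : Vecℚ n) → IsSubPermutohedron (Conv (ArgMin fhat w)))
theorem5p1 n f fhat ((F , via) , cube) compression =
  Conv-Dom-permutohedron ,
  (Extension.mConvex (envelope sizedSequences (λ Ys → ιv (point Ys)) (λ Ys → ι (total-cost Ys))) , Conv-Dom-permutohedron) ,
  subPermutohedron
  where open Compression f fhat F via cube compression
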